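{- Let $\mathcal{U}$ be a summable set such that $\mathbb{C}[x]\subset\mathbf{S}(\mathcal{U})$ and let $P\in\mathbb{C}[x]$. Then, for all $x\in\mathbb{C}$, $$\Sigma_{\mathcal{U}}(P;1,x)=\int_0^x P(t)\,dt+\frac{P(x)-P(0)}{2}+\sum_{m=1}^\infty\frac{B_{2m}}{(2m)!}\bigl(P^{(2m-1)}(x)-P^{(2m-1)}(0)\bigr),$$ where $B_{2m}$ are the Bernoulli numbers.
   Context: $\mathbb{C}[x]$ denotes the set of complex polynomials, viewed as functions $\mathbb{C}\to\mathbb{C}$. Sets of functions. $\mathbb{C}^{\mathbb{C}}$ is the set of all functions $\mathbb{C}\to\mathbb{C}$. For $X\subset\mathbb{C}^{\mathbb{C}}$: $\mathbf{L}(X)$ is the set of all (finite, complex) linear combinations of functions in $X$; $\mathbf{T}(X)$ is the set of all translates $x\mapsto g(x+c)$ with $g\in X$, $c\in\mathbb{C}$; and $\mathbf{S}(X):=\mathbf{L}(\mathbf{T}(X))$. Polynomial sums. For a complex polynomial $p$, let $P$ be the unique polynomial with $P(z)-P(z-1)=p(z)$ for all $z$ and $P(0)=0$; the fractional sum of $p$ from $x$ to $y$ is $P(y)-P(x-1)$, for $x,y\in\mathbb{C}$ (this letter $P$ is local to this paragraph). Fractional summable functions. $f:\mathbb{C}\to\mathbb{C}$ is fractional summable if there are a degree bound $m$ and a sequence $(p_n)_{n\in\mathbb{N}}$ of polynomials of degree $\le m$ (the null polynomial has degree $-\infty$) such that $|f(n+x)-p_n(n+x)|\to 0$ as $n\to\infty$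 for all $x\in\mathbb{C}$, and such that for all $x,y\in\mathbb{C}$ the limit as $n\to\infty$ of (fractional sum of $p_n$ from $n+x$ to $n+y$) $+\sum_{\nu=1}^n\bigl(f(\nu+x-1)-f(\nu+y)\bigr)$ exists. $\mathcal{F}$ is the set of functions $\mathbb{C}\to\mathbb{C}$ that are linear combinations of holomorphic (entire) functions and fractional summable functions. Summable sets. A set $\mathcal{U}\subset\mathcal{F}$ is a summable set if there is a unique map $\Sigma_{\mathcal{U}}:\mathbf{S}(\mathcal{U})\times\mathbb{C}^2\to\mathbb{C}$, $(f,x,y)\mapsto\Sigma_{\mathcal{U}}(f;x,y)$ (thought of as "$\sum_{k=x}^y f(k)$"), satisfying, for all $f,g\in\mathbf{S}(\mathcal{U})$ and $x,y,z,s,\lambda,\mu\in\mathbb{C}$: (A1) $\Sigma_{\mathcal{U}}(f;x,y)+\Sigma_{\mathcal{U}}(f;y+1,z)=\Sigma_{\mathcal{U}}(f;x,z)$; (A2) $\Sigma_{\mathcal{U}}(f;x+s,y+s)=\Sigma_{\mathcal{U}}(h;x,y)$ where $h(t)=f(t+s)$; (A3) $\Sigma_{\mathcal{U}}(\lambda f+\mu g;x,y)=\lambda\Sigma_{\mathcal{U}}(f;x,y)+\mu\Sigma_{\mathcal{U}}(g;x,y)$; (A4) $\Sigma_{\mathcal{U}}(f;1,1)=f(1)$; (A5*) if $f$ is holomorphic, then $x\mapsto\Sigma_{\mathcal{U}}(f;1,x)$ is holomorphic on $\mathbb{C}$; (A6) if $\lim_{n\to\infty}f(t+n)=0$ for every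 $t\in\mathbb{C}$, then $\lim_{n\to\infty}\Sigma_{\mathcal{U}}(f(\cdot+n);x,y)=0$; moreover, if there is a sequence $(p_n)$ of polynomials of fixed degree (independent of $n$) with $|f(t+n)-p_n(t+n)|\to0$ for all $t\in\mathbb{C}$, then $\Sigma_{\mathcal{U}}(f(\cdot+n);x,y)$ minus the fractional sum of the polynomial $p_n(\cdot+n)$ from $x$ to $y$ tends to $0$ as $n\to\infty$. The map $\Sigma_{\mathcal{U}}$ is called the fractional sum relative to $\mathcal{U}$. -}

module Defs where

open import Algebra.Bundles.Raw using (RawRing)
import Algebra.Definitions.RawMonoid as RawMonoidDefinitions
open import Data.Fin.Base as Fin using (Fin; toℕ; fromℕ; inject₁)
open import Data.Integer.Base as ℤ using ()
open import Data.List.Base using (List; []; _∷_)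
open import Data.Nat.Base as ℕ using (ℕ; zero; suc; _!)
open import Data.Nat.Combinatorics using (_C_)
import Data.Nat.Properties as ℕ
open import Data.Product.Base using (Σ; ∃; ∃₂; _×_; _,_; proj₁; proj₂)
open import Data.Rational.Base as ℚ using (ℚ; 0ℚ; 1ℚ; ½; ∣_∣)
import Data.Rational.Properties as ℚ
open import Data.Rational.Solver using (module +-*-Solver)
open import Data.Sum.Base using (_⊎_)
open import Data.Vec.Base using (Vec; []; _∷_; head)
open import Data.Vec.Functional using (Vector)
open import Function.Bundles using (Func)
open import Level using (Level; 0ℓ; _⊔_)
open import Relation.Binary.Bundles using (Setoid)
open import Relation.Binary.PropositionalEquality
  using (_≡_; refl; sym; trans; cong; subst; module ≡-Reasoning)
open import Relation.Nullary.Construct.Add.Infimum using (_₋; ⊥₋; [_])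
open import Relation.Nullary.Negation.Core using (¬_)
open import Relation.Unary using (Pred; _∈_; _⊆_)

private
  variable
    ℓ : Level

private
  half-pos : ∀ {ε} → 0ℚ ℚ.< ε → 0ℚ ℚ.< ½ ℚ.* ε
  half-pos {ε} 0<ε = subst (ℚ._< ½ ℚ.* ε) (ℚ.*-zeroʳ ½) (ℚ.*-monoʳ-<-pos ½ 0<ε)

  half+half : ∀ ε → ½ ℚ.* ε ℚ.+ ½ ℚ.* ε ≡ ε
  half+half ε = trans (sym (ℚ.*-distribʳ-+ ε ½ ½)) (ℚ.*-identityˡ ε)

  dist-sym : ∀ p q → ∣ p ℚ.- q ∣ ≡ ∣ q ℚ.- p ∣
  dist-sym p q = trans (sym (ℚ.∣-p∣≡∣p∣ (p ℚ.- q))) (cong ∣_∣ (solve 2 (λ p q → :- (p :- q) := q :- p) refl p q))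
    where open +-*-Solver

  split-< : ∀ {ε} p q {r} → r ≡ p ℚ.+ q → ∣ p ∣ ℚ.< ½ ℚ.* ε → ∣ q ∣ ℚ.< ½ ℚ.* ε → ∣ r ∣ ℚ.< ε
  split-< {ε} p q refl p< q< = begin-strict
    ∣ p ℚ.+ q ∣            ≤⟨ ℚ.∣p+q∣≤∣p∣+∣q∣ p q ⟩
    ∣ p ∣ ℚ.+ ∣ q ∣        <⟨ ℚ.+-mono-< p< q< ⟩
    ½ ℚ.* ε ℚ.+ ½ ℚ.* ε    ≡⟨ half+half ε ⟩
    ε                      ∎
    where open ℚ.≤-Reasoning

  *-small : ∀ K ε → 0ℚ ℚ.< K → 0ℚ ℚ.< ε →
            ∃ λ δ → 0ℚ ℚ.< δ × (∀ p q → ∣ p ∣ ℚ.< K → ∣ q ∣ ℚ.< δ → ∣ p ℚ.* q ∣ ℚ.< ε)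
  *-small K ε 0<K 0<ε = δ , 0<δ , bound
    where
    instance
      K⁺ = ℚ.positive 0<K
      ε⁺ = ℚ.positive 0<ε
      K≢0 = ℚ.pos⇒nonZero K
      K⁻¹⁺ = ℚ.1/pos⇒pos K
    δ = ε ℚ.* ℚ.1/ K
    0<δ : 0ℚ ℚ.< δ
    0<δ = ℚ.positive⁻¹ δ {{ℚ.pos*pos⇒pos ε (ℚ.1/ K)}}
    Kδ≡ε : K ℚ.* δ ≡ ε
    Kδ≡ε = begin
      K ℚ.* (ε ℚ.* ℚ.1/ K)  ≡⟨ solve 3 (λ K ε i → K :* (ε :* i) := ε :* (K :* i)) refl K ε (ℚ.1/ K) ⟩
      ε ℚ.* (K ℚ.* ℚ.1/ K)  ≡⟨ cong (ε ℚ.*_) (ℚ.*-inverseʳ K) ⟩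
      ε ℚ.* 1ℚ              ≡⟨ ℚ.*-identityʳ ε ⟩
      ε                     ∎
      where
      open ≡-Reasoning
      open +-*-Solver
    bound : ∀ p q → ∣ p ∣ ℚ.< K → ∣ q ∣ ℚ.< δ → ∣ p ℚ.* q ∣ ℚ.< ε
    bound p q p<K q<δ = begin-strict
      ∣ p ℚ.* q ∣        ≡⟨ ℚ.∣p*q∣≡∣p∣*∣q∣ p q ⟩
      ∣ p ∣ ℚ.* ∣ q ∣    ≤⟨ ℚ.*-monoʳ-≤-nonNeg ∣ q ∣ {{ℚ.∣-∣-nonNeg q}} (ℚ.<⇒≤ p<K) ⟩
      K ℚ.* ∣ q ∣        <⟨ ℚ.*-monoʳ-<-pos K q<δ ⟩
      K ℚ.* δ            ≡⟨ Kδ≡ε ⟩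
      ε                  ∎
      where open ℚ.≤-Reasoning

Eventually : (ℕ → Set) → Set
Eventually A = ∃ λ N → ∀ n → N ℕ.≤ n → A n

private
  eventually₂ : ∀ {X Y Z : ℕ → Set} → (∀ n → X n → Y n → Z n) →
                Eventually X → Eventually Y → Eventually Z
  eventually₂ h (M , a) (N , b) = M ℕ.⊔ N , λ n M⊔N≤n →
    h n (a n (ℕ.≤-trans (ℕ.m≤m⊔n M N) M⊔N≤n)) (b n (ℕ.≤-trans (ℕ.m≤n⊔m M N) M⊔N≤n))

IsCauchy : (ℕ → ℚ) → Set
IsCauchy s = ∀ ε → 0ℚ ℚ.< ε →
  ∃ λ N → ∀ m n → N ℕ.≤ m → N ℕ.≤ n → ∣ s m ℚ.- s n ∣ ℚ.< ε

-- Real numbers are Cauchy sequences of rationals; equality is _≈ᵣ_.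
record ℝ : Set where
  constructor _,_
  field
    seq    : ℕ → ℚ
    cauchy : IsCauchy seq

open ℝ

infix 4 _≈ᵣ_ _<ᵣ_ _≤ᵣ_

_≈ᵣ_ : ℝ → ℝ → Set
x ≈ᵣ y = ∀ ε → 0ℚ ℚ.< ε → Eventually λ n → ∣ seq x n ℚ.- seq y n ∣ ℚ.< ε

_<ᵣ_ : ℝ → ℝ → Set
x <ᵣ y = ∃ λ ε → 0ℚ ℚ.< ε × Eventually λ n → seq x n ℚ.+ ε ℚ.≤ seq y n

_≤ᵣ_ : ℝ → ℝ → Set
x ≤ᵣ y = ∀ ε → 0ℚ ℚ.< ε → Eventually λ n → seq x n ℚ.≤ seq y n ℚ.+ ε

abstract
  ≈ᵣ-refl : ∀ {x} → x ≈ᵣ x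
  ≈ᵣ-refl {x} ε 0<ε = 0 , λ n _ →
    subst (ℚ._< ε) (sym (cong ∣_∣ (ℚ.+-inverseʳ (seq x n)))) 0<ε

  ≈ᵣ-sym : ∀ {x y} → x ≈ᵣ y → y ≈ᵣ x
  ≈ᵣ-sym {x} {y} x≈y ε 0<ε with x≈y ε 0<ε
  ... | N , h = N , λ n N≤n → subst (ℚ._< ε) (dist-sym (seq x n) (seq y n)) (h n N≤n)

  ≈ᵣ-trans : ∀ {x y z} → x ≈ᵣ y → y ≈ᵣ z → x ≈ᵣ z
  ≈ᵣ-trans {x} {y} {z} x≈y y≈z ε 0<ε = eventually₂
    (λ n → split-< {ε} (seq x n ℚ.- seq y n) (seq y n ℚ.- seq z n)
      (solve 3 (λ x y z → x :- z := (x :- y) :+ (y :- z)) refl (seq x n) (seq y n) (seq z n)))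
    (x≈y (½ ℚ.* ε) (half-pos 0<ε)) (y≈z (½ ℚ.* ε) (half-pos 0<ε))
    where open +-*-Solver

fromℚᵣ : ℚ → ℝ
fromℚᵣ q = (λ _ → q) , λ ε 0<ε → 0 , λ _ _ _ _ →
  subst (ℚ._< ε) (sym (cong ∣_∣ (ℚ.+-inverseʳ q))) 0<ε

private
  +-rearrange : ∀ p q r s → (p ℚ.+ q) ℚ.- (r ℚ.+ s) ≡ (p ℚ.- r) ℚ.+ (q ℚ.- s)
  +-rearrange = solve 4 (λ p q r s → (p :+ q) :- (r :+ s) := (p :- r) :+ (q :- s)) refl
    where open +-*-Solver

  neg-dist : ∀ p q → ∣ p ℚ.- q ∣ ≡ ∣ ℚ.- p ℚ.- ℚ.- q ∣
  neg-dist p q = trans (dist-sym p q)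
    (cong ∣_∣ (solve 2 (λ p q → q :- p := :- p :- :- q) refl p q))
    where open +-*-Solver

  *-rearrange : ∀ p q r s → p ℚ.* q ℚ.- r ℚ.* s ≡ p ℚ.* (q ℚ.- s) ℚ.+ s ℚ.* (p ℚ.- r)
  *-rearrange = solve 4 (λ p q r s → p :* q :- r :* s := p :* (q :- s) :+ s :* (p :- r)) refl
    where open +-*-Solver

  bounded : ∀ x → ∃ λ K → 0ℚ ℚ.< K × Eventually λ n → ∣ seq x n ∣ ℚ.< K
  bounded x with cauchy x 1ℚ (ℚ.positive⁻¹ 1ℚ)
  ... | N , h = ∣ s N ∣ ℚ.+ 1ℚ , 0<K , N , λ n N≤n → bound n (h n N N≤n ℕ.≤-refl)
    where
    s = seq x
    open ℚ.≤-Reasoning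
    0<K : 0ℚ ℚ.< ∣ s N ∣ ℚ.+ 1ℚ
    0<K = ℚ.+-mono-≤-< (ℚ.0≤∣p∣ (s N)) (ℚ.positive⁻¹ 1ℚ)
    bound : ∀ n → ∣ s n ℚ.- s N ∣ ℚ.< 1ℚ → ∣ s n ∣ ℚ.< ∣ s N ∣ ℚ.+ 1ℚ
    bound n d<1 = begin-strict
      ∣ s n ∣                        ≡⟨ cong ∣_∣ (solve 2 (λ a b → a := b :+ (a :- b)) refl (s n) (s N)) ⟩
      ∣ s N ℚ.+ (s n ℚ.- s N) ∣      ≤⟨ ℚ.∣p+q∣≤∣p∣+∣q∣ (s N) (s n ℚ.- s N) ⟩
      ∣ s N ∣ ℚ.+ ∣ s n ℚ.- s N ∣    <⟨ ℚ.+-monoʳ-< ∣ s N ∣ d<1 ⟩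
      ∣ s N ∣ ℚ.+ 1ℚ                 ∎
      where open +-*-Solver

  abstract
    +-cauchy : ∀ x y → IsCauchy λ n → seq x n ℚ.+ seq y n
    +-cauchy x y ε 0<ε =
      let M , p = cauchy x (½ ℚ.* ε) (half-pos 0<ε)
          N , q = cauchy y (½ ℚ.* ε) (half-pos 0<ε)
      in M ℕ.⊔ N , λ m n m≥ n≥ →
           split-< {ε} (seq x m ℚ.- seq x n) (seq y m ℚ.- seq y n)
             (+-rearrange (seq x m) (seq y m) (seq x n) (seq y n))
             (p m n (ℕ.m⊔n≤o⇒m≤o M N m≥) (ℕ.m⊔n≤o⇒m≤o M N n≥))
             (q m n (ℕ.m⊔n≤o⇒n≤o M N m≥) (ℕ.m⊔n≤o⇒n≤o M N n≥))

    neg-cauchy : ∀ x → IsCauchy λ n → ℚ.- seq x n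
    neg-cauchy x ε 0<ε =
      let N , p = cauchy x ε 0<ε
      in N , λ m n m≥ n≥ → subst (ℚ._< ε) (neg-dist (seq x m) (seq x n)) (p m n m≥ n≥)

    *-cauchy : ∀ x y → IsCauchy λ n → seq x n ℚ.* seq y n
    *-cauchy x y ε 0<ε =
      let K , 0<K , N₁ , x<K = bounded x
          L , 0<L , N₂ , y<L = bounded y
          δ , 0<δ , f = *-small K (½ ℚ.* ε) 0<K (half-pos 0<ε)
          η , 0<η , g = *-small L (½ ℚ.* ε) 0<L (half-pos 0<ε)
          N₃ , p = cauchy x η 0<η
          N₄ , q = cauchy y δ 0<δ
          M₁ = N₁ ℕ.⊔ N₂
          M₂ = N₃ ℕ.⊔ N₄
      in M₁ ℕ.⊔ M₂ , λ m n m≥ n≥ →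
           split-< {ε} (seq x m ℚ.* (seq y m ℚ.- seq y n)) (seq y n ℚ.* (seq x m ℚ.- seq x n))
             (*-rearrange (seq x m) (seq y m) (seq x n) (seq y n))
             (f (seq x m) _
               (x<K m (ℕ.m⊔n≤o⇒m≤o N₁ N₂ (ℕ.m⊔n≤o⇒m≤o M₁ M₂ m≥)))
               (q m n (ℕ.m⊔n≤o⇒n≤o N₃ N₄ (ℕ.m⊔n≤o⇒n≤o M₁ M₂ m≥))
                      (ℕ.m⊔n≤o⇒n≤o N₃ N₄ (ℕ.m⊔n≤o⇒n≤o M₁ M₂ n≥))))
             (g (seq y n) _
               (y<L n (ℕ.m⊔n≤o⇒n≤o N₁ N₂ (ℕ.m⊔n≤o⇒m≤o M₁ M₂ n≥)))
               (p m n (ℕ.m⊔n≤o⇒m≤o N₃ N₄ (ℕ.m⊔n≤o⇒n≤o M₁ M₂ m≥))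
                      (ℕ.m⊔n≤o⇒m≤o N₃ N₄ (ℕ.m⊔n≤o⇒n≤o M₁ M₂ n≥))))

infixl 6 _+ᵣ_
infixl 7 _*ᵣ_
infix  8 -ᵣ_

-- Opaque, like ι below, only to keep normal forms small.
opaque
  _+ᵣ_ : ℝ → ℝ → ℝ
  x +ᵣ y = (λ n → seq x n ℚ.+ seq y n) , +-cauchy x y

  -ᵣ_ : ℝ → ℝ
  -ᵣ x = (λ n → ℚ.- seq x n) , neg-cauchy x

  _*ᵣ_ : ℝ → ℝ → ℝ
  x *ᵣ y = (λ n → seq x n ℚ.* seq y n) , *-cauchy x y

  +ᵣ-cong : ∀ {x x′ y y′} → x ≈ᵣ x′ → y ≈ᵣ y′ → x +ᵣ y ≈ᵣ x′ +ᵣ y′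
  +ᵣ-cong {x} {x′} {y} {y′} x≈ y≈ ε 0<ε = eventually₂
    (λ n → split-< {ε} (seq x n ℚ.- seq x′ n) (seq y n ℚ.- seq y′ n)
      (+-rearrange (seq x n) (seq y n) (seq x′ n) (seq y′ n)))
    (x≈ (½ ℚ.* ε) (half-pos 0<ε)) (y≈ (½ ℚ.* ε) (half-pos 0<ε))

  -ᵣ-cong : ∀ {x x′} → x ≈ᵣ x′ → -ᵣ x ≈ᵣ -ᵣ x′
  -ᵣ-cong {x} {x′} x≈ ε 0<ε =
    let N , p = x≈ ε 0<ε
    in N , λ n n≥ → subst (ℚ._< ε) (neg-dist (seq x n) (seq x′ n)) (p n n≥)

  *ᵣ-cong : ∀ {x x′ y y′} → x ≈ᵣ x′ → y ≈ᵣ y′ → x *ᵣ y ≈ᵣ x′ *ᵣ y′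
  *ᵣ-cong {x} {x′} {y} {y′} x≈ y≈ ε 0<ε =
    let K , 0<K , x<K = bounded x
        L , 0<L , y<L = bounded y′
        δ , 0<δ , f = *-small K (½ ℚ.* ε) 0<K (half-pos 0<ε)
        η , 0<η , g = *-small L (½ ℚ.* ε) 0<L (half-pos 0<ε)
    in eventually₂
         (λ n → split-< {ε} (seq x n ℚ.* (seq y n ℚ.- seq y′ n)) (seq y′ n ℚ.* (seq x n ℚ.- seq x′ n))
           (*-rearrange (seq x n) (seq y n) (seq x′ n) (seq y′ n)))
         (eventually₂ (λ n → f (seq x n) _) x<K (y≈ δ 0<δ))
         (eventually₂ (λ n → g (seq y′ n) _) y<L (x≈ η 0<η))

record ℂ : Set where
  constructor _+i_
  field
    re : ℝ
    im : ℝ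

open ℂ

infix 4 _≈_

_≈_ : ℂ → ℂ → Set
z ≈ w = re z ≈ᵣ re w × im z ≈ᵣ im w

ℂ-setoid : Setoid 0ℓ 0ℓ
ℂ-setoid = record
  { Carrier = ℂ
  ; _≈_ = _≈_
  ; isEquivalence = record
    { refl  = λ {z} → ≈ᵣ-refl {re z} , ≈ᵣ-refl {im z}
    ; sym   = λ {z} {w} (p , q) → ≈ᵣ-sym {re z} {re w} p , ≈ᵣ-sym {im z} {im w} q
    ; trans = λ {z} {w} {v} (p , q) (r , s) →
        ≈ᵣ-trans {re z} {re w} {re v} p r , ≈ᵣ-trans {im z} {im w} {im v} q s
    }
  }

infixl 6 _+_ _-_
infixl 7 _*_
infix  8 -_

_+_ : ℂ → ℂ → ℂ
z + w = (re z +ᵣ re w) +i (im z +ᵣ im w)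

-_ : ℂ → ℂ
- z = (-ᵣ re z) +i (-ᵣ im z)

_-_ : ℂ → ℂ → ℂ
z - w = z + - w

_*_ : ℂ → ℂ → ℂ
z * w = (re z *ᵣ re w +ᵣ -ᵣ (im z *ᵣ im w)) +i (re z *ᵣ im w +ᵣ im z *ᵣ re w)

fromℝ : ℝ → ℂ
fromℝ x = x +i fromℚᵣ 0ℚ

fromℚ : ℚ → ℂ
fromℚ q = fromℝ (fromℚᵣ q)

opaque
  ι : ℕ → ℂ
  ι n = fromℚ (ℤ.+ n ℚ./ 1)

0# 1# : ℂ
0# = fromℚ 0ℚ
1# = fromℚ 1ℚ

ℂ-rawRing : RawRing 0ℓ 0ℓ
ℂ-rawRing = record
  { Carrier = ℂ ; _≈_ = _≈_ ; _+_ = _+_ ; _*_ = _*_ ; -_ = -_ ; 0# = 0# ; 1# = 1# }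

open RawMonoidDefinitions (RawRing.+-rawMonoid ℂ-rawRing) public using (sum)

+-cong : ∀ {z z′ w w′} → z ≈ z′ → w ≈ w′ → z + w ≈ z′ + w′
+-cong {z} {z′} {w} {w′} (p , q) (r , s) =
  +ᵣ-cong {re z} {re z′} {re w} {re w′} p r , +ᵣ-cong {im z} {im z′} {im w} {im w′} q s

*-cong : ∀ {z z′ w w′} → z ≈ z′ → w ≈ w′ → z * w ≈ z′ * w′
*-cong {a +i b} {a′ +i b′} {c +i d} {c′ +i d′} (p , q) (r , s) =
  +ᵣ-cong {a *ᵣ c} {a′ *ᵣ c′} { -ᵣ (b *ᵣ d)} { -ᵣ (b′ *ᵣ d′)}
    (*ᵣ-cong {a} {a′} {c} {c′} p r)
    (-ᵣ-cong {b *ᵣ d} {b′ *ᵣ d′} (*ᵣ-cong {b} {b′} {d} {d′} q s)) ,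
  +ᵣ-cong {a *ᵣ d} {a′ *ᵣ d′} {b *ᵣ c} {b′ *ᵣ c′}
    (*ᵣ-cong {a} {a′} {d} {d′} p s) (*ᵣ-cong {b} {b′} {c} {c′} q r)

-- The modulus only occurs in comparisons with a nonnegative real, where both
-- sides are squared so that no square root is needed.
normSq : ℂ → ℝ
normSq z = re z *ᵣ re z +ᵣ im z *ᵣ im z

infix 4 ∣_∣<_ ∣_∣≤_·∣_∣

∣_∣<_ : ℂ → ℚ → Set
∣ z ∣< ε = normSq z <ᵣ fromℚᵣ (ε ℚ.* ε)

∣_∣≤_·∣_∣ : ℂ → ℚ → ℂ → Set
∣ z ∣≤ ε ·∣ w ∣ = normSq z ≤ᵣ fromℚᵣ (ε ℚ.* ε) *ᵣ normSq w

-- In limits, derivatives and integrals rational tolerances suffice, since every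
-- positive real exceeds a positive rational.

infix 4 _⟶_

_⟶_ : (ℕ → ℂ) → ℂ → Set
a ⟶ l = ∀ ε → 0ℚ ℚ.< ε → Eventually λ n → ∣ a n - l ∣< ε

-- ∑₁ n a = a 1 + ⋯ + a n
∑₁ : ℕ → (ℕ → ℂ) → ℂ
∑₁ n a = sum {n} λ i → a (suc (toℕ i))

-- The series a 1 + a 2 + ⋯ converges to s.
HasSum₁ : (ℕ → ℂ) → ℂ → Set
HasSum₁ a s = (λ n → ∑₁ n a) ⟶ s

HasDerivativeAt : (ℂ → ℂ) → ℂ → ℂ → Set
HasDerivativeAt f c z = ∀ ε → 0ℚ ℚ.< ε → ∃ λ δ → 0ℚ ℚ.< δ ×
  (∀ w → ∣ w - z ∣< δ → ∣ (f w - f z) - c * (w - z) ∣≤ ε ·∣ w - z ∣)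

Entire : (ℂ → ℂ) → Set
Entire f = ∀ z → ∃ λ c → HasDerivativeAt f c z

-- A tagged partition 0 = t₀ ≤ τ₀ ≤ t₁ ≤ τ₁ ≤ ⋯ ≤ tₙ = 1.
record TaggedPartition : Set where
  field
    size   : ℕ
    point  : Vector ℝ (suc size)
    tag    : Vector ℝ size
    start  : point Fin.zero ≈ᵣ fromℚᵣ 0ℚ
    end    : point (fromℕ size) ≈ᵣ fromℚᵣ 1ℚ
    below  : ∀ i → point (inject₁ i) ≤ᵣ tag i
    above  : ∀ i → tag i ≤ᵣ point (Fin.suc i)

  mesh<_ : ℚ → Set
  mesh< δ = ∀ i → point (Fin.suc i) +ᵣ -ᵣ point (inject₁ i) <ᵣ fromℚᵣ δ

  riemannSum : (f γ : ℂ → ℂ) → ℂ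
  riemannSum f γ = sum {size} λ i →
    f (γ (fromℝ (tag i))) * (γ (fromℝ (point (Fin.suc i))) - γ (fromℝ (point (inject₁ i))))

-- v is the Riemann integral of f along the segment from a to b.
IsIntegral : (ℂ → ℂ) → ℂ → ℂ → ℂ → Set
IsIntegral f a b v = ∀ ε → 0ℚ ℚ.< ε → ∃ λ δ → 0ℚ ℚ.< δ ×
  (∀ π → let open TaggedPartition π in
         mesh< δ → ∣ riemannSum f (λ t → a + t * (b - a)) - v ∣< ε)

Fun : Set
Fun = Func ℂ-setoid ℂ-setoid

open Func public using (to)

-- Coefficients, constant term first; trailing zeros are allowed.
ℂ[x] : Set
ℂ[x] = List ℂ

eval : ℂ[x] → ℂ → ℂ
eval []      z = 0#
eval (a ∷ p) z = a + z * eval p z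

⟦_⟧ : ℂ[x] → Fun
⟦ p ⟧ = record { to = eval p ; cong = eval-cong p }
  where
  eval-cong : ∀ p {z w} → z ≈ w → eval p z ≈ eval p w
  eval-cong []      z≈w = Setoid.refl ℂ-setoid {0#}
  eval-cong (a ∷ p) {z} {w} z≈w =
    +-cong {a} {a} {z * eval p z} {w * eval p w} (Setoid.refl ℂ-setoid {a})
      (*-cong {z} {w} {eval p z} {eval p w} z≈w (eval-cong p z≈w))

coeff : ℂ[x] → ℕ → ℂ
coeff []      _       = 0#
coeff (a ∷ p) zero    = a
coeff (a ∷ p) (suc k) = coeff p k

infix 4 degree_≤_

degree_≤_ : ℂ[x] → ℕ → Set
degree p ≤ m = ∀ k → m ℕ.< k → coeff p k ≈ 0#

-- ⊥₋ plays the role of −∞.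
HasDegree : ℂ[x] → ℕ ₋ → Set
HasDegree p ⊥₋    = ∀ k → coeff p k ≈ 0#
HasDegree p [ d ] = ¬ coeff p d ≈ 0# × degree p ≤ d

derivative : ℂ[x] → ℂ[x]
derivative []      = []
derivative (_ ∷ p) = go 1 p
  where
  go : ℕ → ℂ[x] → ℂ[x]
  go k []      = []
  go k (a ∷ p) = ι k * a ∷ go (suc k) p

_⁽_⁾ : ℂ[x] → ℕ → ℂ[x]
p ⁽ zero ⁾  = p
p ⁽ suc k ⁾ = derivative (p ⁽ k ⁾)

-- Bernoulli numbers from B₀ = 1 and ∑_{k ≤ n} C(n+1,k) Bₖ = 0 for n ≥ 1;
-- weighted n (Bₖ ∷ ⋯ ∷ B₀ ∷ []) = ∑_{j ≤ k} C(n,j) Bⱼ.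
weighted : ℕ → ∀ {k} → Vec ℚ k → ℚ
weighted n []               = 0ℚ
weighted n (_∷_ {k} b bs) = (ℤ.+ (n C k) ℚ./ 1) ℚ.* b ℚ.+ weighted n bs

mutual
  -- B n ∷ ⋯ ∷ B 1 ∷ B 0 ∷ []
  bernoullis : ∀ n → Vec ℚ (suc n)
  bernoullis zero    = 1ℚ ∷ []
  bernoullis (suc n) = nextBernoulli n (bernoullis n) ∷ bernoullis n

  nextBernoulli : ∀ n → Vec ℚ (suc n) → ℚ
  nextBernoulli n bs = ℚ.- ((ℤ.+ 1 ℚ./ suc (suc n)) ℚ.* weighted (suc (suc n)) bs)

B : ℕ → ℚ
B n = head (bernoullis n)

B/! : ℕ → ℚ
B/! n = B n ℚ.* (ℤ.+ 1 ℚ./ n !) {{n ℕ.!≢0}}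

linearCombination : {X : Pred Fun ℓ} → List (ℂ × ∃ X) → ℂ → ℂ
linearCombination []                  z = 0#
linearCombination ((c , g , _) ∷ cgs) z = c * to g z + linearCombination cgs z

L : Pred Fun ℓ → Pred Fun ℓ
L X f = Σ (List (ℂ × ∃ X)) λ cgs → ∀ z → to f z ≈ linearCombination cgs z

T : Pred Fun ℓ → Pred Fun ℓ
T X f = ∃₂ λ g c → g ∈ X × (∀ z → to f z ≈ to g (z + c))

S : Pred Fun ℓ → Pred Fun ℓ
S X = L (T X)

-- For a polynomial function p, v is the fractional sum of p from x to y.
IsPolynomialSum : (ℂ → ℂ) → ℂ → ℂ → ℂ → Set
IsPolynomialSum p x y v = Σ ℂ[x] λ Q →
  (∀ z → eval Q z - eval Q (z - 1#) ≈ p z) ×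
  eval Q 0# ≈ 0# ×
  v ≈ eval Q y - eval Q (x - 1#)

record FractionalSummable (f : Fun) : Set where
  field
    bound    : ℕ
    p        : ℕ → ℂ[x]
    degree≤  : ∀ n → degree p n ≤ bound
    approx   : ∀ x → (λ n → to f (ι n + x) - eval (p n) (ι n + x)) ⟶ 0#
    converge : ∀ x y → ∃₂ λ (v : ℕ → ℂ) l →
      (∀ n → IsPolynomialSum (eval (p n)) (ι n + x) (ι n + y) (v n)) ×
      (λ n → v n + ∑₁ n (λ ν → to f (ι ν + x - 1#) - to f (ι ν + y))) ⟶ l

ℱ : Pred Fun 0ℓ
ℱ = L (λ f → Entire (to f) ⊎ FractionalSummable f)

-- A map S(U) × ℂ² → ℂ respecting equality and satisfying the axioms.  Derived
-- functions such as t ↦ f(t+s) are elements h of S(U) that agree with them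
-- pointwise.
record FractionalSum (U : Pred Fun ℓ) : Set ℓ where
  field
    ⨋ : ∃ (S U) → ℂ → ℂ → ℂ

  _·_ : ∃ (S U) → ℂ → ℂ
  f · z = to (proj₁ f) z

  field
    ⨋-cong : ∀ f g {x x′ y y′} → (∀ z → f · z ≈ g · z) → x ≈ x′ → y ≈ y′ →
             ⨋ f x y ≈ ⨋ g x′ y′

    A1 : ∀ f x y z → ⨋ f x y + ⨋ f (y + 1#) z ≈ ⨋ f x z

    A2 : ∀ f h s x y → (∀ t → h · t ≈ f · (t + s)) →
         ⨋ f (x + s) (y + s) ≈ ⨋ h x y

    A3 : ∀ f g h c d x y → (∀ t → h · t ≈ c * (f · t) + d * (g · t)) →
         ⨋ h x y ≈ c * ⨋ f x y + d * ⨋ g x y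

    A4 : ∀ f → ⨋ f 1# 1# ≈ f · 1#

    A5* : ∀ f → Entire (f ·_) → Entire (⨋ f 1#)

    A6 : ∀ f (h : ℕ → ∃ (S U)) x y → (∀ n t → h n · t ≈ f · (t + ι n)) →
         (∀ t → (λ n → f · (t + ι n)) ⟶ 0#) →
         (λ n → ⨋ (h n) x y) ⟶ 0#

    A6-polynomial :
         ∀ f (h : ℕ → ∃ (S U)) x y → (∀ n t → h n · t ≈ f · (t + ι n)) →
         ∀ d (p : ℕ → ℂ[x]) → (∀ n → HasDegree (p n) d) →
         (∀ t → (λ n → f · (t + ι n) - eval (p n) (t + ι n)) ⟶ 0#) →
         ∀ (v : ℕ → ℂ) → (∀ n → IsPolynomialSum (λ t → eval (p n) (t + ι n)) x y (v n)) →
         (λ n → ⨋ (h n) x y - v n) ⟶ 0#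

record SummableSet (U : Pred Fun ℓ) : Set ℓ where
  field
    U⊆ℱ           : U ⊆ ℱ
    fractionalSum : FractionalSum U

  open FractionalSum fractionalSum public using (⨋)

  field
    unique : ∀ (other : FractionalSum U) f x y → FractionalSum.⨋ other f x y ≈ ⨋ f x y

{-# OPTIONS --safe #-}

-- Polynomials are paired with exponential generating functions, a monomial xⁿ
-- with the coefficient of tⁿ/n!: evaluation at z is the pairing with e^{zt},
-- and differentiation is multiplication by t.  Since t/(1 − e⁻ᵗ) = ∑ Bₙ⁺ tⁿ/n!
-- has no odd terms beyond ½t, the right-hand side of the theorem is the pairing
-- of an antiderivative of P with t/(1 − e⁻ᵗ) · (e^{xt} − 1).  Its difference
-- between x and x − 1 is therefore the pairing with t e^{xt}, that is P(x).  On
-- the other side, (A1), (A2) and (A4) show that subtracting any polynomial with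
-- this difference from Σ(P;1,·) leaves a function of period 1, and (A6) shows
-- that this function is constant.
module Submission where

open import Algebra.Bundles using (CommutativeRing)
import Algebra.Properties.CommutativeSemigroup as CommutativeSemigroupProperties
import Algebra.Properties.Monoid.Mult as MultProperties
import Algebra.Properties.Ring as RingProperties
import Algebra.Solver.Ring as RingSolver
open import Algebra.Solver.Ring.AlmostCommutativeRing using (fromCommutativeRing; _-Raw-AlmostCommutative⟶_)
open import Data.Fin.Base as Fin using (Fin; toℕ; fromℕ; inject₁)
import Data.Integer.Base as ℤ
import Data.Integer.Properties as ℤ
open import Data.List.Base using ([]; _∷_; _∷ʳ_; drop; length; map; replicate)
open import Data.Maybe.Base as Maybe using (Maybe)
open import Data.Nat.Base as ℕ using (ℕ; zero; suc; _!)
open import Data.Nat.Combinatorics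
  using (_C_; nC1≡n; nCn≡1; nCk≡nC[n∸k]; k>n⇒nCk≡0; nCk+nC[k+1]≡[n+1]C[k+1])
open import Data.Nat.Induction using (<-rec)
import Data.Nat.Properties as ℕ
open import Data.Product.Base using (∃; ∃₂; _×_; _,_; proj₁; proj₂)
open import Data.Rational.Base as ℚ using (ℚ; 0ℚ; 1ℚ; ½; ∣_∣) renaming (+-*-rawRing to ℚ-rawRing)
import Data.Rational.Properties as ℚ
open import Data.Rational.Solver using (module +-*-Solver)
import Data.Rational.Unnormalised.Base as ℚᵘ
import Data.Rational.Unnormalised.Properties as ℚᵘ
open import Data.Sum.Base using (inj₁; inj₂)
open import Data.Vec.Functional using (Vector)
open import Function.Base using (_∘_)
open import Function.Bundles using (Func)
open import Level using (0ℓ)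
open import Relation.Binary.Bundles using (Setoid)
import Relation.Binary.Reasoning.Setoid as SetoidReasoning
open import Relation.Binary.Structures using (IsEquivalence)
open import Relation.Nullary.Construct.Add.Infimum using ([_])
open import Relation.Nullary.Decidable.Core using (dec⇒maybe)
open import Relation.Nullary.Negation.Core using (¬_)
open import Relation.Unary using (Pred; _∈_)

-- Equality with zero is undecidable in `ℂ`, so a coefficient list need not have a known degree,
-- whereas the polynomial clause of (A6) asks for one. A list extended by the leading coefficient
-- `1#` does have a known degree, and (A3) takes the added monomial away again. For the same reason
-- every bound on orders comes from the length of a list; derivatives of at least that order are
-- empty lists, which makes the Bernoulli series a finite sum. Defining the product by the Leibniz
-- rule lets identities between series be proved by induction through derivatives; factorials enter
-- only where a series is expanded in powers of t. The integral ranges over all tagged partitions.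
-- It is compared with the antiderivative on each subinterval, by a second-order expansion at the
-- tag, so that the errors are quadratic in the widths.

-- The sequence a stands for the exponential generating function ∑ aₙ tⁿ/n!, whose
-- derivative is a ∘ suc; the product is defined by its Leibniz rule.
module HurwitzSeries {c ℓ} (R : CommutativeRing c ℓ) where

  open CommutativeRing R hiding (zero)
  open RingProperties ring
    using (-0#≈0#; -‿distribˡ-*; -‿distribʳ-*; -‿+-comm; -‿involutive; +-identityʳ-unique; x∙y⁻¹≈ε⇒x≈y)
  open MultProperties +-monoid using (×-congʳ) renaming (_×_ to _⊠_)
  open CommutativeSemigroupProperties +-commutativeSemigroup using (interchange)
  private module ≈ = SetoidReasoning setoid

  Series : Set c
  Series = ℕ → Carrier

  infix 4 _≐_
  infixl 7 _∗_ _·_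
  infixl 6 _⊞_

  _≐_ : Series → Series → Set ℓ
  a ≐ b = ∀ n → a n ≈ b n

  _∗_ : Series → Series → Series
  (a ∗ b) zero    = a 0 * b 0
  (a ∗ b) (suc n) = (a ∘ suc ∗ b) n + (a ∗ b ∘ suc) n

  _⊞_ : Series → Series → Series
  (a ⊞ b) n = a n + b n

  _·_ : Carrier → Series → Series
  (x · a) n = x * a n

  one : Series
  one zero    = 1#
  one (suc _) = 0#

  var : Series
  var zero    = 0#
  var (suc n) = one n

  -- The exponential e^{xt}: its derivative, the tail of the sequence, is x times itself.
  powers : Carrier → Series
  powers x zero    = 1#
  powers x (suc n) = x * powers x n

  ∗-cong : ∀ {a a′ b b′} → a ≐ a′ → b ≐ b′ → a ∗ b ≐ a′ ∗ b′
  ∗-cong a≐ b≐ zero    = *-cong (a≐ 0) (b≐ 0)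
  ∗-cong a≐ b≐ (suc n) = +-cong (∗-cong (a≐ ∘ suc) b≐ n) (∗-cong a≐ (b≐ ∘ suc) n)

  ∗-comm : ∀ a b → a ∗ b ≐ b ∗ a
  ∗-comm a b zero    = *-comm _ _
  ∗-comm a b (suc n) = trans (+-comm _ _) (+-cong (∗-comm a (b ∘ suc) n) (∗-comm (a ∘ suc) b n))

  ∗-distribʳ : ∀ a b d → (a ⊞ b) ∗ d ≐ a ∗ d ⊞ b ∗ d
  ∗-distribʳ a b d zero    = distribʳ _ _ _
  ∗-distribʳ a b d (suc n) =
    trans (+-cong (∗-distribʳ (a ∘ suc) (b ∘ suc) d n) (∗-distribʳ a b (d ∘ suc) n)) (interchange _ _ _ _)

  ∗-distribˡ : ∀ d a b → d ∗ (a ⊞ b) ≐ d ∗ a ⊞ d ∗ b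
  ∗-distribˡ d a b n =
    trans (∗-comm d (a ⊞ b) n) (trans (∗-distribʳ a b d n) (+-cong (∗-comm a d n) (∗-comm b d n)))

  ·-∗ˡ : ∀ x a b → (x · a) ∗ b ≐ x · (a ∗ b)
  ·-∗ˡ x a b zero    = *-assoc _ _ _
  ·-∗ˡ x a b (suc n) =
    trans (+-cong (·-∗ˡ x (a ∘ suc) b n) (·-∗ˡ x a (b ∘ suc) n)) (sym (distribˡ _ _ _))

  ·-∗ʳ : ∀ x a b → a ∗ (x · b) ≐ x · (a ∗ b)
  ·-∗ʳ x a b n = trans (∗-comm a (x · b) n) (trans (·-∗ˡ x b a n) (*-congˡ (∗-comm b a n)))

  ∗-assoc : ∀ a b d → (a ∗ b) ∗ d ≐ a ∗ (b ∗ d)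
  ∗-assoc a b d zero    = *-assoc _ _ _
  ∗-assoc a b d (suc n) = begin
    ((a′ ∗ b ⊞ a ∗ b′) ∗ d) n + ((a ∗ b) ∗ d′) n
      ≈⟨ +-cong (∗-distribʳ (a′ ∗ b) (a ∗ b′) d n) (∗-assoc a b d′ n) ⟩
    (((a′ ∗ b) ∗ d) n + ((a ∗ b′) ∗ d) n) + (a ∗ (b ∗ d′)) n
      ≈⟨ +-assoc _ _ _ ⟩
    ((a′ ∗ b) ∗ d) n + (((a ∗ b′) ∗ d) n + (a ∗ (b ∗ d′)) n)
      ≈⟨ +-cong (∗-assoc a′ b d n) (+-congʳ (∗-assoc a b′ d n)) ⟩
    (a′ ∗ (b ∗ d)) n + ((a ∗ (b′ ∗ d)) n + (a ∗ (b ∗ d′)) n)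
      ≈⟨ +-congˡ (∗-distribˡ a (b′ ∗ d) (b ∗ d′) n) ⟨
    (a′ ∗ (b ∗ d)) n + (a ∗ (b′ ∗ d ⊞ b ∗ d′)) n  ∎
    where
    open ≈
    a′ = a ∘ suc
    b′ = b ∘ suc
    d′ = d ∘ suc

  zero-∗ : ∀ {a} b → (∀ n → a n ≈ 0#) → ∀ n → (a ∗ b) n ≈ 0#
  zero-∗ b a≈0 zero    = trans (*-congʳ (a≈0 0)) (zeroˡ _)
  zero-∗ b a≈0 (suc n) =
    trans (+-cong (zero-∗ b (a≈0 ∘ suc) n) (zero-∗ (b ∘ suc) a≈0 n)) (+-identityˡ _)

  one-∗ : ∀ b → one ∗ b ≐ b
  one-∗ b zero    = *-identityˡ _
  one-∗ b (suc n) = trans (+-cong (zero-∗ b (λ _ → refl) n) (one-∗ (b ∘ suc) n)) (+-identityˡ _)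

  -- The Leibniz rule for t · b; the derivative of `var` is `one` by definition.
  var-∗-suc : ∀ b n → (var ∗ b) (suc n) ≈ b n + (var ∗ b ∘ suc) n
  var-∗-suc b n = +-congʳ (one-∗ b n)

  -- Both sides start with 1 and have x + y times themselves as derivative, so this form of the
  -- binomial theorem needs no binomial coefficients.
  powers-∗ : ∀ x y → powers x ∗ powers y ≐ powers (x + y)
  powers-∗ x y zero    = *-identityˡ _
  powers-∗ x y (suc n) = begin
    ((x · powers x) ∗ powers y) n + (powers x ∗ (y · powers y)) n
      ≈⟨ +-cong (·-∗ˡ x (powers x) (powers y) n) (·-∗ʳ y (powers x) (powers y) n) ⟩
    x * (powers x ∗ powers y) n + y * (powers x ∗ powers y) n
      ≈⟨ distribʳ _ _ _ ⟨
    (x + y) * (powers x ∗ powers y) n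
      ≈⟨ *-congˡ (powers-∗ x y n) ⟩
    (x + y) * powers (x + y) n  ∎
    where open ≈

  powers-cong : ∀ {x y} → x ≈ y → powers x ≐ powers y
  powers-cong x≈y zero    = refl
  powers-cong x≈y (suc n) = *-cong x≈y (powers-cong x≈y n)

  powers-0 : powers 0# ≐ one
  powers-0 zero    = refl
  powers-0 (suc n) = zeroˡ _

  powers-1 : ∀ n → powers 1# n ≈ 1#
  powers-1 zero    = refl
  powers-1 (suc n) = trans (*-identityˡ _) (powers-1 n)

  powers-inverse : ∀ a x → a ∗ powers x ∗ powers (- x) ≐ a
  powers-inverse a x n = begin
    (a ∗ powers x ∗ powers (- x)) n    ≈⟨ ∗-assoc a (powers x) (powers (- x)) n ⟩
    (a ∗ (powers x ∗ powers (- x))) n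
      ≈⟨ ∗-cong {a} (λ _ → refl)
           (λ k → trans (powers-∗ x (- x) k) (trans (powers-cong (-‿inverseʳ x) k) (powers-0 k))) n ⟩
    (a ∗ one) n                        ≈⟨ ∗-comm a one n ⟩
    (one ∗ a) n                        ≈⟨ one-∗ a n ⟩
    a n                                ∎
    where open ≈

  -‿∗ˡ : ∀ a b → (-_ ∘ a) ∗ b ≐ -_ ∘ (a ∗ b)
  -‿∗ˡ a b zero    = sym (-‿distribˡ-* _ _)
  -‿∗ˡ a b (suc n) =
    trans (+-cong (-‿∗ˡ (a ∘ suc) b n) (-‿∗ˡ a (b ∘ suc) n)) (-‿+-comm _ _)

  -‿∗ʳ : ∀ a b → a ∗ (-_ ∘ b) ≐ -_ ∘ (a ∗ b)
  -‿∗ʳ a b n = trans (∗-comm a (-_ ∘ b) n) (trans (-‿∗ˡ b a n) (-‿cong (∗-comm b a n)))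

  -- a(−t)
  reflect : Series → Series
  reflect a zero    = a 0
  reflect a (suc n) = - reflect (a ∘ suc) n

  reflect-cong : ∀ {a b} → a ≐ b → reflect a ≐ reflect b
  reflect-cong a≐b zero    = a≐b 0
  reflect-cong a≐b (suc n) = -‿cong (reflect-cong (a≐b ∘ suc) n)

  reflect-⊞ : ∀ a b → reflect (a ⊞ b) ≐ reflect a ⊞ reflect b
  reflect-⊞ a b zero    = refl
  reflect-⊞ a b (suc n) =
    trans (-‿cong (reflect-⊞ (a ∘ suc) (b ∘ suc) n)) (sym (-‿+-comm _ _))

  reflect-· : ∀ x a → reflect (x · a) ≐ x · reflect a
  reflect-· x a zero    = refl
  reflect-· x a (suc n) = trans (-‿cong (reflect-· x (a ∘ suc) n)) (-‿distribʳ-* _ _)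

  reflect-∗ : ∀ a b → reflect (a ∗ b) ≐ reflect a ∗ reflect b
  reflect-∗ a b zero    = refl
  reflect-∗ a b (suc n) = begin
    - reflect (a ∘ suc ∗ b ⊞ a ∗ b ∘ suc) n
      ≈⟨ -‿cong (trans (reflect-⊞ (a ∘ suc ∗ b) (a ∗ b ∘ suc) n)
                  (+-cong (reflect-∗ (a ∘ suc) b n) (reflect-∗ a (b ∘ suc) n))) ⟩
    - ((reflect (a ∘ suc) ∗ reflect b) n + (reflect a ∗ reflect (b ∘ suc)) n)
      ≈⟨ -‿+-comm _ _ ⟨
    - (reflect (a ∘ suc) ∗ reflect b) n + - (reflect a ∗ reflect (b ∘ suc)) n
      ≈⟨ +-cong (-‿∗ˡ (reflect (a ∘ suc)) (reflect b) n) (-‿∗ʳ (reflect a) (reflect (b ∘ suc)) n) ⟨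
    ((-_ ∘ reflect (a ∘ suc)) ∗ reflect b) n + (reflect a ∗ (-_ ∘ reflect (b ∘ suc))) n  ∎
    where open ≈

  reflect-powers : ∀ x → reflect (powers x) ≐ powers (- x)
  reflect-powers x zero    = refl
  reflect-powers x (suc n) = begin
    - reflect (x · powers x) n    ≈⟨ -‿cong (reflect-· x (powers x) n) ⟩
    - (x * reflect (powers x) n)  ≈⟨ -‿distribˡ-* _ _ ⟩
    - x * reflect (powers x) n    ≈⟨ *-congˡ (reflect-powers x n) ⟩
    - x * powers (- x) n          ∎
    where open ≈

  reflect-var : reflect var ≐ -_ ∘ var
  reflect-var zero          = sym -0#≈0#
  reflect-var (suc zero)    = refl
  reflect-var (suc (suc n)) = -‿cong (zeros (suc n))
    where
    zeros : ∀ n → reflect (λ _ → 0#) n ≈ 0#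
    zeros zero    = refl
    zeros (suc n) = trans (-‿cong (zeros n)) -0#≈0#

  -- Two derivatives are removed at a time; their signs cancel, which descends to index 1.
  reflect-odd : ∀ a m → reflect a (suc (2 ℕ.* m)) ≈ - a (suc (2 ℕ.* m))
  reflect-odd a zero    = refl
  reflect-odd a (suc m) rewrite ℕ.+-suc m (m ℕ.+ 0) =
    trans (-‿involutive _) (reflect-odd (a ∘ suc ∘ suc) m)

  ∗-at-order : ∀ {n} a b → (∀ k → k ℕ.< n → a k ≈ 0#) → (a ∗ b) n ≈ a n * b 0
  ∗-at-order {zero}  a b a≈0 = refl
  ∗-at-order {suc n} a b a≈0 = begin
    (a ∘ suc ∗ b) n + (a ∗ b ∘ suc) n
      ≈⟨ +-cong (∗-at-order (a ∘ suc) b (λ k k<n → a≈0 (suc k) (ℕ.s<s k<n)))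
                (∗-at-order a (b ∘ suc) (λ k k<n → a≈0 k (ℕ.m<n⇒m<1+n k<n))) ⟩
    a (suc n) * b 0 + a n * b 1
      ≈⟨ +-congˡ (trans (*-congʳ (a≈0 n (ℕ.n<1+n n))) (zeroˡ _)) ⟩
    a (suc n) * b 0 + 0#
      ≈⟨ +-identityʳ _ ⟩
    a (suc n) * b 0  ∎
    where open ≈

  -- Two terms survive in the convolution. The binomial coefficient of the second, n + 1, appears as
  -- iterated addition, the form in which torsion-freeness can cancel it.
  ∗-past-order : ∀ {n} a b → (∀ k → k ℕ.< n → a k ≈ 0#) →
                 (a ∗ b) (suc n) ≈ a (suc n) * b 0 + suc n ⊠ (a n * b 1)
  ∗-past-order {zero}  a b a≈0 = +-congˡ (sym (+-identityʳ _))
  ∗-past-order {suc n} a b a≈0 = begin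
    (a ∘ suc ∗ b) (suc n) + (a ∗ b ∘ suc) (suc n)
      ≈⟨ +-cong (∗-past-order (a ∘ suc) b (λ k k<n → a≈0 (suc k) (ℕ.s<s k<n)))
                (∗-at-order a (b ∘ suc) a≈0) ⟩
    (a (suc (suc n)) * b 0 + suc n ⊠ (a (suc n) * b 1)) + a (suc n) * b 1
      ≈⟨ trans (+-assoc _ _ _) (+-congˡ (+-comm _ _)) ⟩
    a (suc (suc n)) * b 0 + suc (suc n) ⊠ (a (suc n) * b 1)  ∎
    where open ≈

  -- b eᵗ = b + t says b = t/(eᵗ − 1); then b(−t) − b(t) − t is fixed by
  -- multiplication by eᵗ, so it vanishes.
  module BernoulliSeries
    (torsionFree : ∀ n x → suc n ⊠ x ≈ 0# → x ≈ 0#)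
    (b : Series) (b∗exp : b ∗ powers 1# ≐ b ⊞ var)
    where

    private
      E d : Series
      E = powers 1#
      d = reflect b ⊞ (-_ ∘ (b ⊞ var))

      -- Reflecting `b∗exp` gives b(-t) e⁻ᵗ = b(-t) - t; multiplication by eᵗ and rearrangement give
      -- the claim.
      reflect-b∗E : reflect b ∗ E ≐ reflect b ⊞ var ∗ E
      reflect-b∗E n = begin
        (reflect b ∗ E) n
          ≈⟨ trans (sym (+-identityʳ _)) (+-congˡ (sym (-‿inverseˡ _))) ⟩
        (reflect b ∗ E) n + (- (var ∗ E) n + (var ∗ E) n)
          ≈⟨ +-assoc _ _ _ ⟨
        ((reflect b ∗ E) n + - (var ∗ E) n) + (var ∗ E) n
          ≈⟨ +-congʳ (+-congˡ (-‿∗ˡ var E n)) ⟨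
        ((reflect b ∗ E) n + ((-_ ∘ var) ∗ E) n) + (var ∗ E) n
          ≈⟨ +-congʳ (∗-distribʳ (reflect b) (-_ ∘ var) E n) ⟨
        ((reflect b ⊞ (-_ ∘ var)) ∗ E) n + (var ∗ E) n
          ≈⟨ +-congʳ (∗-cong (λ k → trans (sym (+-congˡ (reflect-var k))) (reflected k))
                             (powers-cong (sym (-‿involutive 1#))) n) ⟩
        (reflect b ∗ powers (- 1#) ∗ powers (- - 1#)) n + (var ∗ E) n
          ≈⟨ +-congʳ (powers-inverse (reflect b) (- 1#) n) ⟩
        reflect b n + (var ∗ E) n  ∎
        where
        open ≈
        reflected : reflect b ⊞ reflect var ≐ reflect b ∗ powers (- 1#)
        reflected k = begin
          reflect b k + reflect var k          ≈⟨ reflect-⊞ b var k ⟨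
          reflect (b ⊞ var) k                  ≈⟨ reflect-cong b∗exp k ⟨
          reflect (b ∗ E) k                    ≈⟨ reflect-∗ b E k ⟩
          (reflect b ∗ reflect E) k            ≈⟨ ∗-cong {reflect b} (λ _ → refl) (reflect-powers 1#) k ⟩
          (reflect b ∗ powers (- 1#)) k        ∎

      d∗E : d ∗ E ≐ d
      d∗E n = begin
        (d ∗ E) n
          ≈⟨ ∗-distribʳ (reflect b) (-_ ∘ (b ⊞ var)) E n ⟩
        (reflect b ∗ E) n + ((-_ ∘ (b ⊞ var)) ∗ E) n
          ≈⟨ +-cong (reflect-b∗E n) (-‿∗ˡ (b ⊞ var) E n) ⟩
        (reflect b n + (var ∗ E) n) + - ((b ⊞ var) ∗ E) n
          ≈⟨ +-congˡ (-‿cong (trans (∗-distribʳ b var E n) (+-congʳ (b∗exp n)))) ⟩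
        (reflect b n + (var ∗ E) n) + - ((b n + var n) + (var ∗ E) n)
          ≈⟨ +-congˡ (sym (-‿+-comm _ _)) ⟩
        (reflect b n + (var ∗ E) n) + (- (b n + var n) + - (var ∗ E) n)
          ≈⟨ interchange _ _ _ _ ⟩
        d n + ((var ∗ E) n + - (var ∗ E) n)
          ≈⟨ trans (+-congˡ (-‿inverseʳ _)) (+-identityʳ _) ⟩
        d n  ∎
        where open ≈

      -- Strong induction: if d vanishes below n, then coefficient n + 1 of d eᵗ = d reads dₙ₊₁ + (n
      -- + 1) dₙ = dₙ₊₁, so (n + 1) dₙ = 0.
      d≈0 : ∀ n → d n ≈ 0#
      d≈0 = <-rec _ λ n below → torsionFree n (d n) (begin
        suc n ⊠ d n
          ≈⟨ ×-congʳ (suc n) (trans (*-congˡ (*-identityʳ 1#)) (*-identityʳ _)) ⟨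
        suc n ⊠ (d n * E 1)
          ≈⟨ +-identityʳ-unique _ _ (begin
               d (suc n) + suc n ⊠ (d n * E 1)       ≈⟨ +-congʳ (*-identityʳ _) ⟨
               d (suc n) * 1# + suc n ⊠ (d n * E 1)  ≈⟨ ∗-past-order d E (λ k → below {k}) ⟨
               (d ∗ E) (suc n)                       ≈⟨ d∗E (suc n) ⟩
               d (suc n)                             ∎) ⟩
        0#  ∎)
        where open ≈

    odd≈0 : ∀ m → b (suc (2 ℕ.* suc m)) ≈ 0#
    odd≈0 m = torsionFree 1 _ (begin
      -- Since o is at least 2, `var o` reduces to `0#`, and this expression is `2 ⊠ b o` by
      -- definition.
      b o + (b o + var o)    ≈⟨ +-congˡ (x∙y⁻¹≈ε⇒x≈y _ _ (d≈0 o)) ⟨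
      b o + reflect b o      ≈⟨ +-congˡ (reflect-odd b (suc m)) ⟩
      b o + - b o            ≈⟨ -‿inverseʳ _ ⟩
      0#                     ∎)
      where
      open ≈
      o = suc (2 ℕ.* suc m)

open import Defs
open ℝ
open ℂ
open import Relation.Binary.PropositionalEquality
  using (_≡_; refl; sym; trans; cong; cong₂; subst; subst₂; module ≡-Reasoning)

-- Rational coefficients and Bernoulli numbers

module ℚ-Series = HurwitzSeries ℚ.+-*-commutativeRing

ℕ⇒ℚ : ℕ → ℚ
ℕ⇒ℚ n = ℤ.+ n ℚ./ 1

ℕ⇒ℚ-+ : ∀ m n → ℕ⇒ℚ (m ℕ.+ n) ≡ ℕ⇒ℚ m ℚ.+ ℕ⇒ℚ n
ℕ⇒ℚ-+ m n = ℚ.toℚᵘ-injective (begin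
  ℚ.toℚᵘ (ℕ⇒ℚ (m ℕ.+ n))               ≈⟨ ℚ.toℚᵘ-fromℚᵘ (ℚᵘ.mkℚᵘ (ℤ.+ (m ℕ.+ n)) 0) ⟩
  ℚᵘ.mkℚᵘ (ℤ.+ (m ℕ.+ n)) 0
    ≈⟨ ℚᵘ.*≡* (cong (ℤ._* ℤ.1ℤ) (cong₂ ℤ._+_ (sym (ℤ.*-identityʳ (ℤ.+ m))) (sym (ℤ.*-identityʳ (ℤ.+ n))))) ⟩
  ℚᵘ.mkℚᵘ (ℤ.+ m) 0 ℚᵘ.+ ℚᵘ.mkℚᵘ (ℤ.+ n) 0
    ≈⟨ ℚᵘ.+-cong (ℚ.toℚᵘ-fromℚᵘ (ℚᵘ.mkℚᵘ (ℤ.+ m) 0)) (ℚ.toℚᵘ-fromℚᵘ (ℚᵘ.mkℚᵘ (ℤ.+ n) 0)) ⟨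
  ℚ.toℚᵘ (ℕ⇒ℚ m) ℚᵘ.+ ℚ.toℚᵘ (ℕ⇒ℚ n)  ≈⟨ ℚ.toℚᵘ-homo-+ (ℕ⇒ℚ m) (ℕ⇒ℚ n) ⟨
  ℚ.toℚᵘ (ℕ⇒ℚ m ℚ.+ ℕ⇒ℚ n)            ∎)
  where
  open ℚᵘ.≃-Reasoning

ℕ⇒ℚ-* : ∀ m n → ℕ⇒ℚ (m ℕ.* n) ≡ ℕ⇒ℚ m ℚ.* ℕ⇒ℚ n
ℕ⇒ℚ-* zero    n = sym (ℚ.*-zeroˡ (ℕ⇒ℚ n))
ℕ⇒ℚ-* (suc m) n = begin
  ℕ⇒ℚ (n ℕ.+ m ℕ.* n)                   ≡⟨ ℕ⇒ℚ-+ n (m ℕ.* n) ⟩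
  ℕ⇒ℚ n ℚ.+ ℕ⇒ℚ (m ℕ.* n)            ≡⟨ cong (ℕ⇒ℚ n ℚ.+_) (ℕ⇒ℚ-* m n) ⟩
  ℕ⇒ℚ n ℚ.+ ℕ⇒ℚ m ℚ.* ℕ⇒ℚ n
    ≡⟨ solve 2 (λ m n → n :+ m :* n := (con 1ℚ :+ m) :* n) refl (ℕ⇒ℚ m) (ℕ⇒ℚ n) ⟩
  (1ℚ ℚ.+ ℕ⇒ℚ m) ℚ.* ℕ⇒ℚ n           ≡⟨ cong (ℚ._* ℕ⇒ℚ n) (ℕ⇒ℚ-+ 1 m) ⟨
  ℕ⇒ℚ (suc m) ℚ.* ℕ⇒ℚ n              ∎
  where
  open ≡-Reasoning
  open +-*-Solver

n*1/n≡1 : ∀ n .{{_ : ℕ.NonZero n}} → ℕ⇒ℚ n ℚ.* (ℤ.+ 1 ℚ./ n) ≡ 1ℚ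
n*1/n≡1 (suc n) = ℚ.toℚᵘ-injective (begin
  ℚ.toℚᵘ (ℕ⇒ℚ (suc n) ℚ.* (ℤ.+ 1 ℚ./ suc n))
    ≈⟨ ℚ.toℚᵘ-homo-* (ℕ⇒ℚ (suc n)) (ℤ.+ 1 ℚ./ suc n) ⟩
  ℚ.toℚᵘ (ℕ⇒ℚ (suc n)) ℚᵘ.* ℚ.toℚᵘ (ℤ.+ 1 ℚ./ suc n)
    ≈⟨ ℚᵘ.*-cong (ℚ.toℚᵘ-fromℚᵘ (ℚᵘ.mkℚᵘ (ℤ.+ suc n) 0)) (ℚ.toℚᵘ-fromℚᵘ (ℚᵘ.mkℚᵘ (ℤ.+ 1) n)) ⟩
  ℚᵘ.mkℚᵘ (ℤ.+ suc n) 0 ℚᵘ.* ℚᵘ.mkℚᵘ (ℤ.+ 1) n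
    ≈⟨ ℚᵘ.*≡* (trans (ℤ.*-identityʳ _) (trans (ℤ.*-identityʳ (ℤ.+ suc n))
         (sym (trans (ℤ.*-identityˡ _) (ℤ.*-identityˡ (ℤ.+ suc n)))))) ⟩
  ℚᵘ.1ℚᵘ  ∎)
  where open ℚᵘ.≃-Reasoning

open MultProperties ℚ.+-0-monoid using () renaming (_×_ to _×ℚ_)

×ℚ≡* : ∀ n q → n ×ℚ q ≡ ℕ⇒ℚ n ℚ.* q
×ℚ≡* zero    q = sym (ℚ.*-zeroˡ q)
×ℚ≡* (suc n) q = begin
  q ℚ.+ n ×ℚ q                     ≡⟨ cong (q ℚ.+_) (×ℚ≡* n q) ⟩
  q ℚ.+ ℕ⇒ℚ n ℚ.* q            ≡⟨ solve 2 (λ m n → n :+ m :* n := (con 1ℚ :+ m) :* n) refl (ℕ⇒ℚ n) q ⟩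
  (1ℚ ℚ.+ ℕ⇒ℚ n) ℚ.* q         ≡⟨ cong (ℚ._* q) (ℕ⇒ℚ-+ 1 n) ⟨
  ℕ⇒ℚ (suc n) ℚ.* q            ∎
  where
  open ≡-Reasoning
  open +-*-Solver

ℚ-torsionFree : ∀ n q → suc n ×ℚ q ≡ 0ℚ → q ≡ 0ℚ
ℚ-torsionFree n q nq≡0 = begin
  q                                            ≡⟨ ℚ.*-identityˡ q ⟨
  1ℚ ℚ.* q                                     ≡⟨ cong (ℚ._* q) (n*1/n≡1 (suc n)) ⟨
  ℕ⇒ℚ (suc n) ℚ.* 1/n ℚ.* q
    ≡⟨ solve 3 (λ n m q → n :* m :* q := m :* (n :* q)) refl (ℕ⇒ℚ (suc n)) 1/n q ⟩
  1/n ℚ.* (ℕ⇒ℚ (suc n) ℚ.* q)               ≡⟨ cong (1/n ℚ.*_) (trans (sym (×ℚ≡* (suc n) q)) nq≡0) ⟩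
  1/n ℚ.* 0ℚ                                   ≡⟨ ℚ.*-zeroʳ 1/n ⟩
  0ℚ                                           ∎
  where
  open ≡-Reasoning
  open +-*-Solver
  1/n = ℤ.+ 1 ℚ./ suc n

-- `weighted` over a sequence in place of a vector, so that the sequence can be shifted in Pascal's
-- rule.
binomialSum : ℕ → (ℕ → ℚ) → ℕ → ℚ
binomialSum n b zero    = 0ℚ
binomialSum n b (suc k) = ℕ⇒ℚ (n C k) ℚ.* b k ℚ.+ binomialSum n b k

weighted≡binomialSum : ∀ n k → weighted n (bernoullis k) ≡ binomialSum n B (suc k)
weighted≡binomialSum n zero    = refl
weighted≡binomialSum n (suc k) = cong (ℕ⇒ℚ (n C suc k) ℚ.* B (suc k) ℚ.+_) (weighted≡binomialSum n k)

-- Pascal's rule splits each C(n+1,k+1); the parts C(n,k) form the sum over the shifted sequence.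
binomialSum-suc : ∀ n b k →
  binomialSum (suc n) b (suc k) ≡ binomialSum n (b ∘ suc) k ℚ.+ binomialSum n b (suc k)
binomialSum-suc n b zero    = sym (ℚ.+-identityˡ _)
binomialSum-suc n b (suc k) = begin
  ℕ⇒ℚ (suc n C suc k) ℚ.* b (suc k) ℚ.+ binomialSum (suc n) b (suc k)
    ≡⟨ cong₂ (λ c s → c ℚ.* b (suc k) ℚ.+ s)
         (trans (cong ℕ⇒ℚ (sym (nCk+nC[k+1]≡[n+1]C[k+1] n k))) (ℕ⇒ℚ-+ (n C k) (n C suc k)))
         (binomialSum-suc n b k) ⟩
  (ℕ⇒ℚ (n C k) ℚ.+ ℕ⇒ℚ (n C suc k)) ℚ.* b (suc k) ℚ.+ (binomialSum n (b ∘ suc) k ℚ.+ binomialSum n b (suc k))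
    ≡⟨ solve 5 (λ p q b s t → (p :+ q) :* b :+ (s :+ t) := (p :* b :+ s) :+ (q :* b :+ t)) refl
         (ℕ⇒ℚ (n C k)) (ℕ⇒ℚ (n C suc k)) (b (suc k)) (binomialSum n (b ∘ suc) k) (binomialSum n b (suc k)) ⟩
  binomialSum n (b ∘ suc) (suc k) ℚ.+ binomialSum n b (suc (suc k))  ∎
  where
  open ≡-Reasoning
  open +-*-Solver

-- The explicit convolution agrees with the Hurwitz product because Pascal's rule is the Leibniz
-- rule in coefficients. The unshifted sum is one term too long, but that term carries C(n,n+1) = 0.
binomialSum-∗ : ∀ b n → binomialSum n b (suc n) ≡ (b ℚ-Series.∗ ℚ-Series.powers 1ℚ) n
binomialSum-∗ b zero    = begin
  1ℚ ℚ.* b 0 ℚ.+ 0ℚ  ≡⟨ solve 1 (λ b → con 1ℚ :* b :+ con 0ℚ := b :* con 1ℚ) refl (b 0) ⟩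
  b 0 ℚ.* 1ℚ         ∎
  where
  open ≡-Reasoning
  open +-*-Solver
binomialSum-∗ b (suc n) = begin
  binomialSum (suc n) b (suc (suc n))
    ≡⟨ binomialSum-suc n b (suc n) ⟩
  binomialSum n (b ∘ suc) (suc n) ℚ.+ (ℕ⇒ℚ (n C suc n) ℚ.* b (suc n) ℚ.+ binomialSum n b (suc n))
    ≡⟨ cong (λ c → binomialSum n (b ∘ suc) (suc n) ℚ.+ (ℕ⇒ℚ c ℚ.* b (suc n) ℚ.+ binomialSum n b (suc n)))
         (k>n⇒nCk≡0 (ℕ.n<1+n n)) ⟩
  binomialSum n (b ∘ suc) (suc n) ℚ.+ (0ℚ ℚ.* b (suc n) ℚ.+ binomialSum n b (suc n))
    ≡⟨ solve 3 (λ s c t → s :+ (con 0ℚ :* c :+ t) := s :+ t) refl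
         (binomialSum n (b ∘ suc) (suc n)) (b (suc n)) (binomialSum n b (suc n)) ⟩
  binomialSum n (b ∘ suc) (suc n) ℚ.+ binomialSum n b (suc n)
    ≡⟨ cong₂ ℚ._+_ (binomialSum-∗ (b ∘ suc) n)
         (trans (binomialSum-∗ b n) (ℚ-Series.∗-cong {b} (λ _ → refl) (λ k → sym (ℚ.*-identityˡ _)) n)) ⟩
  (b ℚ-Series.∗ ℚ-Series.powers 1ℚ) (suc n)  ∎
  where
  open ≡-Reasoning
  open +-*-Solver

-- From degree N = n + 2 on this is the recursion for `B`: the term N · Bₙ₊₁ equals -w, where w is
-- the sum of all lower terms, so only B_N remains.
B∗exp : B ℚ-Series.∗ ℚ-Series.powers 1ℚ ℚ-Series.≐ B ℚ-Series.⊞ ℚ-Series.var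
B∗exp zero          = refl
B∗exp (suc zero)    = refl
B∗exp (suc (suc n)) = begin
  (B ℚ-Series.∗ ℚ-Series.powers 1ℚ) (suc (suc n))
    ≡⟨ binomialSum-∗ B (suc (suc n)) ⟨
  ℕ⇒ℚ (N C N) ℚ.* B N ℚ.+ (ℕ⇒ℚ (N C suc n) ℚ.* B (suc n) ℚ.+ binomialSum N B (suc n))
    ≡⟨ cong (λ w → ℕ⇒ℚ (N C N) ℚ.* B N ℚ.+ (ℕ⇒ℚ (N C suc n) ℚ.* B (suc n) ℚ.+ w)) (weighted≡binomialSum N n) ⟨
  ℕ⇒ℚ (N C N) ℚ.* B N ℚ.+ (ℕ⇒ℚ (N C suc n) ℚ.* ℚ.- (1/N ℚ.* w) ℚ.+ w)
    ≡⟨ cong₂ (λ c d → ℕ⇒ℚ c ℚ.* B N ℚ.+ (ℕ⇒ℚ d ℚ.* ℚ.- (1/N ℚ.* w) ℚ.+ w)) (nCn≡1 N) NC[N∸1]≡N ⟩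
  1ℚ ℚ.* B N ℚ.+ (ℕ⇒ℚ N ℚ.* ℚ.- (1/N ℚ.* w) ℚ.+ w)
    ≡⟨ solve 4 (λ b n i w → con 1ℚ :* b :+ (n :* :- (i :* w) :+ w) := b :+ (con 1ℚ :- n :* i) :* w) refl
         (B N) (ℕ⇒ℚ N) 1/N w ⟩
  B N ℚ.+ (1ℚ ℚ.- ℕ⇒ℚ N ℚ.* 1/N) ℚ.* w
    ≡⟨ cong (λ e → B N ℚ.+ (1ℚ ℚ.- e) ℚ.* w) (n*1/n≡1 N) ⟩
  B N ℚ.+ 0ℚ ℚ.* w
    ≡⟨ cong (B N ℚ.+_) (ℚ.*-zeroˡ w) ⟩
  B (suc (suc n)) ℚ.+ 0ℚ  ∎
  where
  open ≡-Reasoning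
  open +-*-Solver
  N = suc (suc n)
  1/N = ℤ.+ 1 ℚ./ N
  w = weighted N (bernoullis n)
  NC[N∸1]≡N : N C suc n ≡ N
  NC[N∸1]≡N = trans (nCk≡nC[n∸k] (ℕ.n≤1+n (suc n))) (trans (cong (N C_) (ℕ.m+n∸n≡m 1 (suc n))) (nC1≡n N))

B-odd : ∀ m → B (suc (2 ℕ.* suc m)) ≡ 0ℚ
B-odd = ℚ-Series.BernoulliSeries.odd≈0 ℚ-torsionFree B B∗exp

-- The ring of complex numbers

-- Unlike _≈_ and _≤ᵣ_, the wrapped relations determine their arguments, so
-- that these can be inferred.
infix 4 _≋_ _≼_

record _≋_ (z w : ℂ) : Set where
  constructor wrap
  field unwrap : z ≈ w

record _≼_ (x y : ℝ) : Set where
  constructor wrap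
  field unwrap : x ≤ᵣ y

open _≋_ using (unwrap)

eventually-zip : ∀ {X Y Z : ℕ → Set} → (∀ n → X n → Y n → Z n) →
                 Eventually X → Eventually Y → Eventually Z
eventually-zip h (M , a) (N , b) = M ℕ.⊔ N , λ n n≥ →
  h n (a n (ℕ.m⊔n≤o⇒m≤o M N n≥)) (b n (ℕ.m⊔n≤o⇒n≤o M N n≥))

0<½ε : ∀ {ε} → 0ℚ ℚ.< ε → 0ℚ ℚ.< ½ ℚ.* ε
0<½ε {ε} 0<ε = subst (ℚ._< ½ ℚ.* ε) (ℚ.*-zeroʳ ½) (ℚ.*-monoʳ-<-pos ½ 0<ε)

½ε+½ε : ∀ ε → ½ ℚ.* ε ℚ.+ ½ ℚ.* ε ≡ ε
½ε+½ε ε = trans (sym (ℚ.*-distribʳ-+ ε ½ ½)) (ℚ.*-identityˡ ε)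

pointwise-≈ᵣ : ∀ {x y} → (∀ n → seq x n ≡ seq y n) → x ≈ᵣ y
pointwise-≈ᵣ {x} {y} x≡y ε 0<ε = 0 , λ n _ →
  subst (ℚ._< ε) (sym (cong ∣_∣ (trans (cong (ℚ._- seq y n) (x≡y n)) (ℚ.+-inverseʳ (seq y n))))) 0<ε

-- Arithmetic acts term by term on the Cauchy sequences, so every ring law of `ℂ` reduces to an
-- identity in ℚ.
pointwise-≋ : ∀ {z w} → (∀ n → seq (re z) n ≡ seq (re w) n) → (∀ n → seq (im z) n ≡ seq (im w) n) → z ≋ w
pointwise-≋ {z} {w} re≡ im≡ = wrap (pointwise-≈ᵣ {re z} {re w} re≡ , pointwise-≈ᵣ {im z} {im w} im≡)

≋-isEquivalence : IsEquivalence _≋_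
≋-isEquivalence = record
  { refl  = λ {z} → wrap (≈.refl {z})
  ; sym   = λ {z} {w} (wrap p) → wrap (≈.sym {z} {w} p)
  ; trans = λ {z} {w} {v} (wrap p) (wrap q) → wrap (≈.trans {z} {w} {v} p q)
  }
  where module ≈ = Setoid ℂ-setoid

≋-+-cong : ∀ {z z′ w w′} → z ≋ z′ → w ≋ w′ → z + w ≋ z′ + w′
≋-+-cong {z} {z′} {w} {w′} (wrap p) (wrap q) = wrap (+-cong {z} {z′} {w} {w′} p q)

≋-*-cong : ∀ {z z′ w w′} → z ≋ z′ → w ≋ w′ → z * w ≋ z′ * w′
≋-*-cong {z} {z′} {w} {w′} (wrap p) (wrap q) = wrap (*-cong {z} {z′} {w} {w′} p q)

≋-neg-cong : ∀ {z z′} → z ≋ z′ → - z ≋ - z′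
≋-neg-cong {z} {z′} (wrap (p , q)) = wrap (-ᵣ-cong {re z} {re z′} p , -ᵣ-cong {im z} {im z′} q)

opaque
  unfolding _+ᵣ_

  ≋-+-assoc : ∀ z w v → (z + w) + v ≋ z + (w + v)
  ≋-+-assoc (a +i b) (c +i d) (e +i f) = pointwise-≋
    (λ n → ℚ.+-assoc (seq a n) (seq c n) (seq e n)) (λ n → ℚ.+-assoc (seq b n) (seq d n) (seq f n))

  ≋-+-comm : ∀ z w → z + w ≋ w + z
  ≋-+-comm (a +i b) (c +i d) = pointwise-≋
    (λ n → ℚ.+-comm (seq a n) (seq c n)) (λ n → ℚ.+-comm (seq b n) (seq d n))

  ≋-+-identityˡ : ∀ z → 0# + z ≋ z
  ≋-+-identityˡ z = pointwise-≋ (λ n → ℚ.+-identityˡ _) (λ n → ℚ.+-identityˡ _)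

  ≋-+-inverseˡ : ∀ z → - z + z ≋ 0#
  ≋-+-inverseˡ (a +i b) = pointwise-≋ (λ n → ℚ.+-inverseˡ (seq a n)) (λ n → ℚ.+-inverseˡ (seq b n))

  ≋-*-assoc : ∀ z w v → (z * w) * v ≋ z * (w * v)
  ≋-*-assoc (a +i b) (c +i d) (e +i f) = pointwise-≋
    (λ n → solve 6 (λ a b c d e f → (a :* c :+ :- (b :* d)) :* e :+ :- ((a :* d :+ b :* c) :* f)
        := a :* (c :* e :+ :- (d :* f)) :+ :- (b :* (c :* f :+ d :* e))) refl
      (seq a n) (seq b n) (seq c n) (seq d n) (seq e n) (seq f n))
    (λ n → solve 6 (λ a b c d e f → (a :* c :+ :- (b :* d)) :* f :+ (a :* d :+ b :* c) :* e
        := a :* (c :* f :+ d :* e) :+ b :* (c :* e :+ :- (d :* f))) refl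
      (seq a n) (seq b n) (seq c n) (seq d n) (seq e n) (seq f n))
    where open +-*-Solver

  ≋-*-comm : ∀ z w → z * w ≋ w * z
  ≋-*-comm (a +i b) (c +i d) = pointwise-≋
    (λ n → solve 4 (λ a b c d → a :* c :+ :- (b :* d) := c :* a :+ :- (d :* b)) refl
      (seq a n) (seq b n) (seq c n) (seq d n))
    (λ n → solve 4 (λ a b c d → a :* d :+ b :* c := c :* b :+ d :* a) refl
      (seq a n) (seq b n) (seq c n) (seq d n))
    where open +-*-Solver

  ≋-*-identityˡ : ∀ z → 1# * z ≋ z
  ≋-*-identityˡ (a +i b) = pointwise-≋
    (λ n → solve 2 (λ a b → con 1ℚ :* a :+ :- (con 0ℚ :* b) := a) refl (seq a n) (seq b n))
    (λ n → solve 2 (λ a b → con 1ℚ :* b :+ con 0ℚ :* a := b) refl (seq a n) (seq b n))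
    where open +-*-Solver

  ≋-*-distribʳ-+ : ∀ z w v → (w + v) * z ≋ w * z + v * z
  ≋-*-distribʳ-+ (a +i b) (c +i d) (e +i f) = pointwise-≋
    (λ n → solve 6 (λ a b c d e f → (c :+ e) :* a :+ :- ((d :+ f) :* b)
        := (c :* a :+ :- (d :* b)) :+ (e :* a :+ :- (f :* b))) refl
      (seq a n) (seq b n) (seq c n) (seq d n) (seq e n) (seq f n))
    (λ n → solve 6 (λ a b c d e f → (c :+ e) :* b :+ (d :+ f) :* a
        := (c :* b :+ d :* a) :+ (e :* b :+ f :* a)) refl
      (seq a n) (seq b n) (seq c n) (seq d n) (seq e n) (seq f n))
    where open +-*-Solver

  fromℚ-+ : ∀ p q → fromℚ (p ℚ.+ q) ≋ fromℚ p + fromℚ q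
  fromℚ-+ p q = pointwise-≋ (λ n → refl) (λ n → refl)

  fromℚ-neg : ∀ p → fromℚ (ℚ.- p) ≋ - fromℚ p
  fromℚ-neg p = pointwise-≋ (λ n → refl) (λ n → refl)

  fromℚ-* : ∀ p q → fromℚ (p ℚ.* q) ≋ fromℚ p * fromℚ q
  fromℚ-* p q = pointwise-≋
    (λ n → solve 2 (λ p q → p :* q := p :* q :+ :- (con 0ℚ :* con 0ℚ)) refl p q)
    (λ n → solve 2 (λ p q → con 0ℚ := p :* con 0ℚ :+ con 0ℚ :* q) refl p q)
    where open +-*-Solver

  fromℝ-sub : ∀ s t → fromℝ (s +ᵣ -ᵣ t) ≋ fromℝ s - fromℝ t
  fromℝ-sub s t = pointwise-≋ (λ n → refl) (λ n → refl)

ℂ-commutativeRing : CommutativeRing 0ℓ 0ℓ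
ℂ-commutativeRing = record
  { Carrier = ℂ ; _≈_ = _≋_ ; _+_ = _+_ ; _*_ = _*_ ; -_ = -_ ; 0# = 0# ; 1# = 1#
  ; isCommutativeRing = record
    { isRing = record
      { +-isAbelianGroup = record
        { isGroup = record
          { isMonoid = record
            { isSemigroup = record
              { isMagma = record { isEquivalence = ≋-isEquivalence ; ∙-cong = ≋-+-cong }
              ; assoc = ≋-+-assoc
              }
            ; identity = ≋-+-identityˡ , λ z → ≋-trans (≋-+-comm z 0#) (≋-+-identityˡ z)
            }
          ; inverse = ≋-+-inverseˡ , λ z → ≋-trans (≋-+-comm z (- z)) (≋-+-inverseˡ z)
          ; ⁻¹-cong = ≋-neg-cong
          }
        ; comm = ≋-+-comm
        }
      ; *-cong = ≋-*-cong
      ; *-assoc = ≋-*-assoc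
      ; *-identity = ≋-*-identityˡ , λ z → ≋-trans (≋-*-comm z 1#) (≋-*-identityˡ z)
      ; distrib = (λ z w v → ≋-trans (≋-*-comm z (w + v))
                    (≋-trans (≋-*-distribʳ-+ z w v) (≋-+-cong (≋-*-comm w z) (≋-*-comm v z))))
                , ≋-*-distribʳ-+
      }
    ; *-comm = ≋-*-comm
    }
  }
  where open IsEquivalence ≋-isEquivalence using () renaming (trans to ≋-trans)

module 𝔽 = CommutativeRing ℂ-commutativeRing

-- The solver has to compare coefficients, which is impossible in `ℂ`; its coefficients are
-- therefore rational.
fromℚ-morphism : ℚ-rawRing -Raw-AlmostCommutative⟶ fromCommutativeRing ℂ-commutativeRing
fromℚ-morphism = record
  { ⟦_⟧ = fromℚ ; +-homo = fromℚ-+ ; *-homo = fromℚ-* ; -‿homo = fromℚ-neg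
  ; 0-homo = 𝔽.refl ; 1-homo = 𝔽.refl
  }

_fromℚ≟_ : ∀ p q → Maybe (fromℚ p ≋ fromℚ q)
p fromℚ≟ q = Maybe.map (λ p≡q → 𝔽.reflexive (cong fromℚ p≡q)) (dec⇒maybe (p ℚ.≟ q))

module ℂ-Solver = RingSolver ℚ-rawRing (fromCommutativeRing ℂ-commutativeRing) fromℚ-morphism _fromℚ≟_

-- Real inequalities and the norm |re| + |im|

∣∣-least : ∀ {p q} → p ℚ.≤ q → ℚ.- p ℚ.≤ q → ∣ p ∣ ℚ.≤ q
∣∣-least {p} {q} p≤q -p≤q with ℚ.∣p∣≡p∨∣p∣≡-p p
... | inj₁ eq = subst (ℚ._≤ q) (sym eq) p≤q
... | inj₂ eq = subst (ℚ._≤ q) (sym eq) -p≤q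

p≤∣p∣ : ∀ p → p ℚ.≤ ∣ p ∣
p≤∣p∣ p with ℚ.∣p∣≡p∨∣p∣≡-p p | ℚ.≤-total 0ℚ p
... | _ | inj₁ 0≤p = ℚ.≤-reflexive (sym (ℚ.0≤p⇒∣p∣≡p 0≤p))
... | _ | inj₂ p≤0 = ℚ.≤-trans p≤0 (ℚ.0≤∣p∣ p)

p*p≡∣p∣*∣p∣ : ∀ p → p ℚ.* p ≡ ∣ p ∣ ℚ.* ∣ p ∣
p*p≡∣p∣*∣p∣ p with ℚ.∣p∣≡p∨∣p∣≡-p p
... | inj₁ eq = cong₂ ℚ._*_ (sym eq) (sym eq)
... | inj₂ eq = trans (solve 1 (λ p → p :* p := :- p :* :- p) refl p) (cong₂ ℚ._*_ (sym eq) (sym eq))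
  where open +-*-Solver

∣p∣≤∣q∣+∣p-q∣ : ∀ p q → ∣ p ∣ ℚ.≤ ∣ q ∣ ℚ.+ ∣ p ℚ.- q ∣
∣p∣≤∣q∣+∣p-q∣ p q = subst (ℚ._≤ ∣ q ∣ ℚ.+ ∣ p ℚ.- q ∣)
  (cong ∣_∣ (solve 2 (λ p q → q :+ (p :- q) := p) refl p q)) (ℚ.∣p+q∣≤∣p∣+∣q∣ q (p ℚ.- q))
  where open +-*-Solver

∣p-q∣≡∣q-p∣ : ∀ p q → ∣ p ℚ.- q ∣ ≡ ∣ q ℚ.- p ∣
∣p-q∣≡∣q-p∣ p q = trans (cong ∣_∣ (solve 2 (λ p q → p :- q := :- (q :- p)) refl p q)) (ℚ.∣-p∣≡∣p∣ (q ℚ.- p))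
  where open +-*-Solver

p≤q+r⇒p-q≤r : ∀ {p} q {r} → p ℚ.≤ q ℚ.+ r → p ℚ.- q ℚ.≤ r
p≤q+r⇒p-q≤r {p} q {r} p≤q+r = subst (p ℚ.- q ℚ.≤_)
  (solve 2 (λ q r → q :+ r :- q := r) refl q r) (ℚ.+-monoˡ-≤ (ℚ.- q) p≤q+r)
  where open +-*-Solver

∣∣p∣-∣q∣∣≤∣p-q∣ : ∀ p q → ∣ ∣ p ∣ ℚ.- ∣ q ∣ ∣ ℚ.≤ ∣ p ℚ.- q ∣
∣∣p∣-∣q∣∣≤∣p-q∣ p q = ∣∣-least
  (p≤q+r⇒p-q≤r ∣ q ∣ (∣p∣≤∣q∣+∣p-q∣ p q))
  (subst₂ ℚ._≤_ (solve 2 (λ p q → q :- p := :- (p :- q)) refl (∣ p ∣) (∣ q ∣)) (∣p-q∣≡∣q-p∣ q p)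
    (p≤q+r⇒p-q≤r ∣ p ∣ (∣p∣≤∣q∣+∣p-q∣ q p)))
  where open +-*-Solver

0≤p*q : ∀ {p q} → 0ℚ ℚ.≤ p → 0ℚ ℚ.≤ q → 0ℚ ℚ.≤ p ℚ.* q
0≤p*q {p} {q} 0≤p 0≤q = subst (ℚ._≤ p ℚ.* q) (ℚ.*-zeroʳ p) (ℚ.*-monoˡ-≤-nonNeg p {{ℚ.nonNegative 0≤p}} 0≤q)

p*p-mono-< : ∀ {p q} → 0ℚ ℚ.≤ p → p ℚ.< q → p ℚ.* p ℚ.< q ℚ.* q
p*p-mono-< {p} {q} 0≤p p<q = begin-strict
  p ℚ.* p  ≤⟨ ℚ.*-monoˡ-≤-nonNeg p {{ℚ.nonNegative 0≤p}} (ℚ.<⇒≤ p<q) ⟩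
  p ℚ.* q  <⟨ ℚ.*-monoˡ-<-pos q {{ℚ.positive (ℚ.≤-<-trans 0≤p p<q)}} p<q ⟩
  q ℚ.* q  ∎
  where open ℚ.≤-Reasoning

p*p-cancel-< : ∀ {p q} → 0ℚ ℚ.≤ q → p ℚ.* p ℚ.< q ℚ.* q → p ℚ.< q
p*p-cancel-< {p} {q} 0≤q pp<qq = ℚ.≰⇒> λ q≤p → ℚ.<-irrefl refl (ℚ.<-≤-trans pp<qq (begin
  q ℚ.* q  ≤⟨ ℚ.*-monoˡ-≤-nonNeg q {{ℚ.nonNegative 0≤q}} q≤p ⟩
  q ℚ.* p  ≤⟨ ℚ.*-monoʳ-≤-nonNeg p {{ℚ.nonNegative (ℚ.≤-trans 0≤q q≤p)}} q≤p ⟩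
  p ℚ.* p  ∎))
  where open ℚ.≤-Reasoning

0<q-p : ∀ {p q} → p ℚ.< q → 0ℚ ℚ.< q ℚ.- p
0<q-p {p} {q} p<q = subst (ℚ._< q ℚ.- p) (ℚ.+-inverseʳ p) (ℚ.+-monoˡ-< (ℚ.- p) p<q)

p+[q-p]≡q : ∀ p q → p ℚ.+ (q ℚ.- p) ≡ q
p+[q-p]≡q = solve 2 (λ p q → p :+ (q :- p) := q) refl
  where open +-*-Solver

p≤p+ε : ∀ p {ε} → 0ℚ ℚ.< ε → p ℚ.≤ p ℚ.+ ε
p≤p+ε p {ε} 0<ε = subst (ℚ._≤ p ℚ.+ ε) (ℚ.+-identityʳ p) (ℚ.+-monoʳ-≤ p (ℚ.<⇒≤ 0<ε))

pointwise-≼ : ∀ {x y} → (∀ n → seq x n ℚ.≤ seq y n) → x ≼ y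
pointwise-≼ {x} {y} x≤y = wrap λ ε 0<ε → 0 , λ n _ → ℚ.≤-trans (x≤y n) (p≤p+ε (seq y n) 0<ε)

≼-refl : ∀ {x} → x ≼ x
≼-refl = pointwise-≼ λ n → ℚ.≤-refl

≼-trans : ∀ {x y z} → x ≼ y → y ≼ z → x ≼ z
≼-trans {x} {y} {z} (wrap x≤y) (wrap y≤z) = wrap λ ε 0<ε → eventually-zip
  (λ n p q → begin
    seq x n                                  ≤⟨ p ⟩
    seq y n ℚ.+ ½ ℚ.* ε                      ≤⟨ ℚ.+-monoˡ-≤ (½ ℚ.* ε) q ⟩
    seq z n ℚ.+ ½ ℚ.* ε ℚ.+ ½ ℚ.* ε          ≡⟨ ℚ.+-assoc (seq z n) (½ ℚ.* ε) (½ ℚ.* ε) ⟩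
    seq z n ℚ.+ (½ ℚ.* ε ℚ.+ ½ ℚ.* ε)        ≡⟨ cong (seq z n ℚ.+_) (½ε+½ε ε) ⟩
    seq z n ℚ.+ ε                            ∎)
  (x≤y (½ ℚ.* ε) (0<½ε 0<ε)) (y≤z (½ ℚ.* ε) (0<½ε 0<ε))
  where open ℚ.≤-Reasoning

≈ᵣ⇒≼ : ∀ x y → x ≈ᵣ y → x ≼ y
≈ᵣ⇒≼ x y x≈y = wrap λ ε 0<ε → let N , p = x≈y ε 0<ε in N , λ n n≥ → begin
  seq x n                            ≡⟨ p+[q-p]≡q (seq y n) (seq x n) ⟨
  seq y n ℚ.+ (seq x n ℚ.- seq y n)  ≤⟨ ℚ.+-monoʳ-≤ (seq y n) (ℚ.≤-trans (p≤∣p∣ _) (ℚ.<⇒≤ (p n n≥))) ⟩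
  seq y n ℚ.+ ε                      ∎
  where open ℚ.≤-Reasoning

<ᵣ⇒≼ : ∀ x y → x <ᵣ y → x ≼ y
<ᵣ⇒≼ x y (η , 0<η , N , p) = wrap λ ε 0<ε → N , λ n n≥ → begin
  seq x n        ≤⟨ p≤p+ε (seq x n) 0<η ⟩
  seq x n ℚ.+ η  ≤⟨ p n n≥ ⟩
  seq y n        ≤⟨ p≤p+ε (seq y n) 0<ε ⟩
  seq y n ℚ.+ ε  ∎
  where open ℚ.≤-Reasoning

seq-bound : ∀ x → ∃ λ K → 0ℚ ℚ.< K × Eventually λ n → seq x n ℚ.≤ K
seq-bound x = let N , p = cauchy x 1ℚ (ℚ.positive⁻¹ 1ℚ) in
  ∣ seq x N ∣ ℚ.+ 1ℚ , ℚ.+-mono-≤-< (ℚ.0≤∣p∣ (seq x N)) (ℚ.positive⁻¹ 1ℚ) , N , λ n n≥ → begin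
    seq x n                                    ≡⟨ p+[q-p]≡q (seq x N) (seq x n) ⟨
    seq x N ℚ.+ (seq x n ℚ.- seq x N)
      ≤⟨ ℚ.+-mono-≤ (p≤∣p∣ (seq x N)) (p≤∣p∣ (seq x n ℚ.- seq x N)) ⟩
    ∣ seq x N ∣ ℚ.+ ∣ seq x n ℚ.- seq x N ∣    ≤⟨ ℚ.+-monoʳ-≤ ∣ seq x N ∣ (ℚ.<⇒≤ (p n N n≥ ℕ.≤-refl)) ⟩
    ∣ seq x N ∣ ℚ.+ 1ℚ                         ∎
  where open ℚ.≤-Reasoning

rational-bound : ∀ x → ∃ λ K → 0ℚ ℚ.< K × x ≼ fromℚᵣ K
rational-bound x = let K , 0<K , N , p = seq-bound x in
  K , 0<K , wrap λ ε 0<ε → N , λ n n≥ →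
    ℚ.≤-trans (p n n≥) (p≤p+ε K 0<ε)

positive-quotient : ∀ {K ε} → 0ℚ ℚ.< K → 0ℚ ℚ.< ε → ∃ λ δ → 0ℚ ℚ.< δ × K ℚ.* δ ≡ ε
positive-quotient {K} {ε} 0<K 0<ε = δ , ℚ.positive⁻¹ δ {{ℚ.pos*pos⇒pos ε (ℚ.1/ K)}} , (begin
  K ℚ.* (ε ℚ.* ℚ.1/ K)  ≡⟨ solve 3 (λ K ε i → K :* (ε :* i) := ε :* (K :* i)) refl K ε (ℚ.1/ K) ⟩
  ε ℚ.* (K ℚ.* ℚ.1/ K)  ≡⟨ cong (ε ℚ.*_) (ℚ.*-inverseʳ K) ⟩
  ε ℚ.* 1ℚ              ≡⟨ ℚ.*-identityʳ ε ⟩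
  ε                     ∎)
  where
  instance
    K⁺ = ℚ.positive 0<K
    ε⁺ = ℚ.positive 0<ε
    K≢0 = ℚ.pos⇒nonZero K
    K⁻¹⁺ = ℚ.1/pos⇒pos K
  δ = ε ℚ.* ℚ.1/ K
  open ≡-Reasoning
  open +-*-Solver

-- Stronger than `fromℚᵣ 0ℚ ≼ x`, as it concerns every term. It holds for norms and for nonnegative
-- rational constants, the factors by which inequalities get multiplied.
NonNegᵣ : ℝ → Set
NonNegᵣ x = ∀ n → 0ℚ ℚ.≤ seq x n

opaque
  unfolding _+ᵣ_

  +ᵣ-mono-≼ : ∀ {x x′ y y′} → x ≼ x′ → y ≼ y′ → x +ᵣ y ≼ x′ +ᵣ y′
  +ᵣ-mono-≼ {x} {x′} {y} {y′} (wrap p) (wrap q) = wrap λ ε 0<ε → eventually-zip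
    (λ n p q → ℚ.≤-trans (ℚ.+-mono-≤ p q) (ℚ.≤-reflexive (trans
      (solve 3 (λ x y e → (x :+ e) :+ (y :+ e) := (x :+ y) :+ (e :+ e)) refl
           (seq x′ n) (seq y′ n) (½ ℚ.* ε))
      (cong (seq x′ n ℚ.+ seq y′ n ℚ.+_) (½ε+½ε ε)))))
    (p (½ ℚ.* ε) (0<½ε 0<ε)) (q (½ ℚ.* ε) (0<½ε 0<ε))
    where open +-*-Solver

  *ᵣ-monoʳ-≼ : ∀ {z x y} → NonNegᵣ z → x ≼ y → z *ᵣ x ≼ z *ᵣ y
  *ᵣ-monoʳ-≼ {z} {x} {y} 0≤z (wrap p) = wrap λ ε 0<ε →
    let K , 0<K , z≤K = seq-bound z
        δ , 0<δ , Kδ≡ε = positive-quotient 0<K 0<ε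
    in eventually-zip (λ n z≤K x≤y+δ → begin
      seq z n ℚ.* seq x n
        ≤⟨ ℚ.*-monoˡ-≤-nonNeg (seq z n) {{ℚ.nonNegative (0≤z n)}} x≤y+δ ⟩
      seq z n ℚ.* (seq y n ℚ.+ δ)              ≡⟨ ℚ.*-distribˡ-+ (seq z n) (seq y n) δ ⟩
      seq z n ℚ.* seq y n ℚ.+ seq z n ℚ.* δ
        ≤⟨ ℚ.+-monoʳ-≤ (seq z n ℚ.* seq y n) (ℚ.*-monoʳ-≤-nonNeg δ {{ℚ.nonNegative (ℚ.<⇒≤ 0<δ)}} z≤K) ⟩
      seq z n ℚ.* seq y n ℚ.+ K ℚ.* δ          ≡⟨ cong (seq z n ℚ.* seq y n ℚ.+_) Kδ≡ε ⟩
      seq z n ℚ.* seq y n ℚ.+ ε                ∎)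
      z≤K (p δ 0<δ)
    where open ℚ.≤-Reasoning

  *ᵣ-comm-≼ : ∀ x y → x *ᵣ y ≼ y *ᵣ x
  *ᵣ-comm-≼ x y = pointwise-≼ λ n → ℚ.≤-reflexive (ℚ.*-comm (seq x n) (seq y n))

  fromℚᵣ-*-≼ : ∀ p q → fromℚᵣ p *ᵣ fromℚᵣ q ≼ fromℚᵣ (p ℚ.* q)
  fromℚᵣ-*-≼ p q = pointwise-≼ λ n → ℚ.≤-refl

  fromℚᵣ-+-≼ : ∀ p q → fromℚᵣ p +ᵣ fromℚᵣ q ≼ fromℚᵣ (p ℚ.+ q)
  fromℚᵣ-+-≼ p q = pointwise-≼ λ n → ℚ.≤-refl

  *ᵣ-telescope-≼ : ∀ c r s t → c *ᵣ (s +ᵣ -ᵣ r) +ᵣ c *ᵣ (t +ᵣ -ᵣ s) ≼ c *ᵣ (t +ᵣ -ᵣ r)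
  *ᵣ-telescope-≼ c r s t = pointwise-≼ λ n → ℚ.≤-reflexive
    (solve 4 (λ c r s t → c :* (s :- r) :+ c :* (t :- s) := c :* (t :- r)) refl
         (seq c n) (seq r n) (seq s n) (seq t n))
    where open +-*-Solver

  0≼c*[t-t] : ∀ c t → fromℚᵣ 0ℚ ≼ c *ᵣ (t +ᵣ -ᵣ t)
  0≼c*[t-t] c t = pointwise-≼ λ n → ℚ.≤-reflexive
    (solve 2 (λ c t → con 0ℚ := c :* (t :- t)) refl (seq c n) (seq t n))
    where open +-*-Solver

  fromℚᵣ-sub-≼ : ∀ p q → fromℚᵣ p +ᵣ -ᵣ fromℚᵣ q ≼ fromℚᵣ (p ℚ.- q)
  fromℚᵣ-sub-≼ p q = pointwise-≼ λ n → ℚ.≤-refl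

  ≼⇒0≼t-s : ∀ {s t} → s ≼ t → fromℚᵣ 0ℚ ≼ t +ᵣ -ᵣ s
  ≼⇒0≼t-s {s} {t} (wrap p) = wrap λ ε 0<ε → let N , q = p ε 0<ε in N , λ n n≥ → begin
    0ℚ                              ≡⟨ ℚ.+-inverseʳ (seq s n) ⟨
    seq s n ℚ.- seq s n             ≤⟨ ℚ.+-monoˡ-≤ (ℚ.- seq s n) (q n n≥) ⟩
    seq t n ℚ.+ ε ℚ.- seq s n
      ≡⟨ solve 3 (λ s t e → t :+ e :- s := t :- s :+ e) refl (seq s n) (seq t n) ε ⟩
    seq t n ℚ.- seq s n ℚ.+ ε       ∎
    where
    open ℚ.≤-Reasoning
    open +-*-Solver

  +ᵣ-neg-mono-≼ : ∀ {s s′ t t′} → t ≼ t′ → s′ ≼ s → t +ᵣ -ᵣ s ≼ t′ +ᵣ -ᵣ s′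
  +ᵣ-neg-mono-≼ {s} {s′} {t} {t′} (wrap p) (wrap q) = wrap λ ε 0<ε → eventually-zip
    (λ n p q → ℚ.≤-trans (ℚ.+-mono-≤ p (ℚ.neg-antimono-≤ (p≤q+r⇒p-q≤r (½ ℚ.* ε) (ℚ.≤-trans q (ℚ.≤-reflexive (ℚ.+-comm (seq s n) (½ ℚ.* ε)))))))
      (ℚ.≤-reflexive (trans
      (solve 3 (λ s t e → (t :+ e) :+ :- (s :- e) := (t :- s) :+ (e :+ e)) refl
           (seq s′ n) (seq t′ n) (½ ℚ.* ε))
      (cong (seq t′ n ℚ.- seq s′ n ℚ.+_) (½ε+½ε ε)))))
    (p (½ ℚ.* ε) (0<½ε 0<ε)) (q (½ ℚ.* ε) (0<½ε 0<ε))
    where open +-*-Solver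

  -- This norm needs no square root, and its triangle inequality and submultiplicativity hold term
  -- by term. It dominates the modulus, so bounds for it yield the limits required.
  ‖_‖ : ℂ → ℝ
  ‖ a +i b ‖ = (λ n → ∣ seq a n ∣ ℚ.+ ∣ seq b n ∣) , λ ε 0<ε →
    let M , p = cauchy a (½ ℚ.* ε) (0<½ε 0<ε)
        N , q = cauchy b (½ ℚ.* ε) (0<½ε 0<ε)
    in M ℕ.⊔ N , λ m n m≥ n≥ →
      let a₁ = seq a m ; a₂ = seq a n ; b₁ = seq b m ; b₂ = seq b n in begin-strict
      ∣ (∣ a₁ ∣ ℚ.+ ∣ b₁ ∣) ℚ.- (∣ a₂ ∣ ℚ.+ ∣ b₂ ∣) ∣
        ≡⟨ cong ∣_∣ (solve 4 (λ p q r s → (p :+ q) :- (r :+ s) := (p :- r) :+ (q :- s)) refl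
             (∣ a₁ ∣) (∣ b₁ ∣) (∣ a₂ ∣) (∣ b₂ ∣)) ⟩
      ∣ (∣ a₁ ∣ ℚ.- ∣ a₂ ∣) ℚ.+ (∣ b₁ ∣ ℚ.- ∣ b₂ ∣) ∣
        ≤⟨ ℚ.∣p+q∣≤∣p∣+∣q∣ (∣ a₁ ∣ ℚ.- ∣ a₂ ∣) (∣ b₁ ∣ ℚ.- ∣ b₂ ∣) ⟩
      ∣ ∣ a₁ ∣ ℚ.- ∣ a₂ ∣ ∣ ℚ.+ ∣ ∣ b₁ ∣ ℚ.- ∣ b₂ ∣ ∣
        ≤⟨ ℚ.+-mono-≤ (∣∣p∣-∣q∣∣≤∣p-q∣ a₁ a₂) (∣∣p∣-∣q∣∣≤∣p-q∣ b₁ b₂) ⟩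
      ∣ a₁ ℚ.- a₂ ∣ ℚ.+ ∣ b₁ ℚ.- b₂ ∣
        <⟨ ℚ.+-mono-< (p m n (ℕ.m⊔n≤o⇒m≤o M N m≥) (ℕ.m⊔n≤o⇒m≤o M N n≥))
                       (q m n (ℕ.m⊔n≤o⇒n≤o M N m≥) (ℕ.m⊔n≤o⇒n≤o M N n≥)) ⟩
      ½ ℚ.* ε ℚ.+ ½ ℚ.* ε
        ≡⟨ ½ε+½ε ε ⟩
      ε  ∎
    where
    open ℚ.≤-Reasoning
    open +-*-Solver

  ‖‖-nonNeg : ∀ z → NonNegᵣ ‖ z ‖
  ‖‖-nonNeg (a +i b) n = ℚ.+-mono-≤ (ℚ.0≤∣p∣ (seq a n)) (ℚ.0≤∣p∣ (seq b n))

  ‖‖-cong : ∀ {z w} → z ≋ w → ‖ z ‖ ≼ ‖ w ‖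
  ‖‖-cong {a +i b} {c +i d} (wrap (a≈c , b≈d)) = wrap λ ε 0<ε → eventually-zip
    (λ n p q → begin
      ∣ seq a n ∣ ℚ.+ ∣ seq b n ∣
        ≤⟨ ℚ.+-mono-≤ (∣p∣≤∣q∣+∣p-q∣ (seq a n) (seq c n)) (∣p∣≤∣q∣+∣p-q∣ (seq b n) (seq d n)) ⟩
      (∣ seq c n ∣ ℚ.+ ∣ seq a n ℚ.- seq c n ∣) ℚ.+ (∣ seq d n ∣ ℚ.+ ∣ seq b n ℚ.- seq d n ∣)
        ≤⟨ ℚ.+-mono-≤ (ℚ.+-monoʳ-≤ ∣ seq c n ∣ (ℚ.<⇒≤ p)) (ℚ.+-monoʳ-≤ ∣ seq d n ∣ (ℚ.<⇒≤ q)) ⟩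
      (∣ seq c n ∣ ℚ.+ ½ ℚ.* ε) ℚ.+ (∣ seq d n ∣ ℚ.+ ½ ℚ.* ε)
        ≡⟨ solve 3 (λ x y e → (x :+ e) :+ (y :+ e) := (x :+ y) :+ (e :+ e)) refl
             (∣ seq c n ∣) (∣ seq d n ∣) (½ ℚ.* ε) ⟩
      (∣ seq c n ∣ ℚ.+ ∣ seq d n ∣) ℚ.+ (½ ℚ.* ε ℚ.+ ½ ℚ.* ε)
        ≡⟨ cong (∣ seq c n ∣ ℚ.+ ∣ seq d n ∣ ℚ.+_) (½ε+½ε ε) ⟩
      (∣ seq c n ∣ ℚ.+ ∣ seq d n ∣) ℚ.+ ε  ∎)
    (a≈c (½ ℚ.* ε) (0<½ε 0<ε)) (b≈d (½ ℚ.* ε) (0<½ε 0<ε))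
    where
    open ℚ.≤-Reasoning
    open +-*-Solver

  ‖z+w‖≼‖z‖+‖w‖ : ∀ z w → ‖ z + w ‖ ≼ ‖ z ‖ +ᵣ ‖ w ‖
  ‖z+w‖≼‖z‖+‖w‖ (a +i b) (c +i d) = pointwise-≼ λ n → ℚ.≤-trans
    (ℚ.+-mono-≤ (ℚ.∣p+q∣≤∣p∣+∣q∣ (seq a n) (seq c n)) (ℚ.∣p+q∣≤∣p∣+∣q∣ (seq b n) (seq d n)))
    (ℚ.≤-reflexive (solve 4 (λ a b c d → (a :+ c) :+ (b :+ d) := (a :+ b) :+ (c :+ d)) refl
      (∣ seq a n ∣) (∣ seq b n ∣) (∣ seq c n ∣) (∣ seq d n ∣)))
    where open +-*-Solver

  ‖-z‖≼‖z‖ : ∀ z → ‖ - z ‖ ≼ ‖ z ‖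
  ‖-z‖≼‖z‖ (a +i b) = pointwise-≼ λ n →
    ℚ.≤-reflexive (cong₂ ℚ._+_ (ℚ.∣-p∣≡∣p∣ (seq a n)) (ℚ.∣-p∣≡∣p∣ (seq b n)))

  ‖z*w‖≼‖z‖*‖w‖ : ∀ z w → ‖ z * w ‖ ≼ ‖ z ‖ *ᵣ ‖ w ‖
  ‖z*w‖≼‖z‖*‖w‖ (a +i b) (c +i d) = pointwise-≼ λ n →
    let p = seq a n ; q = seq b n ; r = seq c n ; s = seq d n in begin
    ∣ p ℚ.* r ℚ.- q ℚ.* s ∣ ℚ.+ ∣ p ℚ.* s ℚ.+ q ℚ.* r ∣
      ≤⟨ ℚ.+-mono-≤ (ℚ.∣p-q∣≤∣p∣+∣q∣ (p ℚ.* r) (q ℚ.* s)) (ℚ.∣p+q∣≤∣p∣+∣q∣ (p ℚ.* s) (q ℚ.* r)) ⟩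
    (∣ p ℚ.* r ∣ ℚ.+ ∣ q ℚ.* s ∣) ℚ.+ (∣ p ℚ.* s ∣ ℚ.+ ∣ q ℚ.* r ∣)
      ≡⟨ cong₂ ℚ._+_ (cong₂ ℚ._+_ (ℚ.∣p*q∣≡∣p∣*∣q∣ p r) (ℚ.∣p*q∣≡∣p∣*∣q∣ q s))
                     (cong₂ ℚ._+_ (ℚ.∣p*q∣≡∣p∣*∣q∣ p s) (ℚ.∣p*q∣≡∣p∣*∣q∣ q r)) ⟩
    (∣ p ∣ ℚ.* ∣ r ∣ ℚ.+ ∣ q ∣ ℚ.* ∣ s ∣) ℚ.+ (∣ p ∣ ℚ.* ∣ s ∣ ℚ.+ ∣ q ∣ ℚ.* ∣ r ∣)
      ≡⟨ solve 4 (λ p q r s → (p :* r :+ q :* s) :+ (p :* s :+ q :* r) := (p :+ q) :* (r :+ s)) refl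
           (∣ p ∣) (∣ q ∣) (∣ r ∣) (∣ s ∣) ⟩
    (∣ p ∣ ℚ.+ ∣ q ∣) ℚ.* (∣ r ∣ ℚ.+ ∣ s ∣)  ∎
    where
    open ℚ.≤-Reasoning
    open +-*-Solver

  -- Individual terms of t may be negative, but eventually by at most ½ε, and then -t ≤ t + ε.
  ‖fromℝt‖≼t : ∀ {t} → fromℚᵣ 0ℚ ≼ t → ‖ fromℝ t ‖ ≼ t
  ‖fromℝt‖≼t {t} (wrap p) = wrap λ ε 0<ε → let N , q = p (½ ℚ.* ε) (0<½ε 0<ε) in N , λ n n≥ → begin
    ∣ seq t n ∣ ℚ.+ 0ℚ   ≡⟨ ℚ.+-identityʳ ∣ seq t n ∣ ⟩
    ∣ seq t n ∣          ≤⟨ ∣∣-least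
      (p≤p+ε (seq t n) 0<ε)
      (subst₂ ℚ._≤_ (solve 1 (λ t → con 0ℚ :+ con 0ℚ :- t := :- t) refl (seq t n))
        (trans (solve 2 (λ t e → (t :+ e) :+ (t :+ e) :- t := t :+ (e :+ e)) refl (seq t n) (½ ℚ.* ε))
               (cong (seq t n ℚ.+_) (½ε+½ε ε)))
        (ℚ.+-monoˡ-≤ (ℚ.- seq t n) (ℚ.+-mono-≤ (q n n≥) (q n n≥)))) ⟩
    seq t n ℚ.+ ε        ∎
    where
    open ℚ.≤-Reasoning
    open +-*-Solver

  ‖0‖≼0 : ‖ 0# ‖ ≼ fromℚᵣ 0ℚ
  ‖0‖≼0 = pointwise-≼ λ n → ℚ.≤-refl

  -- This rests on x² + y² ≤ (|x| + |y|)². A rational m between q and ε absorbs the slack in `≼` and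
  -- leaves ε² - m² as the uniform gap that `<ᵣ` demands.
  ‖z‖≼q⇒∣z∣<ε : ∀ z {q ε} → 0ℚ ℚ.≤ q → q ℚ.< ε → ‖ z ‖ ≼ fromℚᵣ q → ∣ z ∣< ε
  ‖z‖≼q⇒∣z∣<ε (a +i b) {q} {ε} 0≤q q<ε (wrap p) =
    let m , q<m , m<ε = ℚ.<-dense q<ε
        N , bound = p (m ℚ.- q) (0<q-p q<m)
        mm<εε = p*p-mono-< (ℚ.≤-trans 0≤q (ℚ.<⇒≤ q<m)) m<ε
    in ε ℚ.* ε ℚ.- m ℚ.* m , 0<q-p mm<εε , N , λ n n≥ →
      let x = seq a n ; y = seq b n
          s = ∣ x ∣ ℚ.+ ∣ y ∣
          0≤s = ℚ.+-mono-≤ (ℚ.0≤∣p∣ x) (ℚ.0≤∣p∣ y)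
          s≤m = subst (s ℚ.≤_) (p+[q-p]≡q q m) (bound n n≥)
      in begin
      x ℚ.* x ℚ.+ y ℚ.* y ℚ.+ (ε ℚ.* ε ℚ.- m ℚ.* m)
        ≤⟨ ℚ.+-monoˡ-≤ (ε ℚ.* ε ℚ.- m ℚ.* m) (begin
             x ℚ.* x ℚ.+ y ℚ.* y
               ≡⟨ cong₂ ℚ._+_ (p*p≡∣p∣*∣p∣ x) (p*p≡∣p∣*∣p∣ y) ⟩
             ∣ x ∣ ℚ.* ∣ x ∣ ℚ.+ ∣ y ∣ ℚ.* ∣ y ∣
               ≡⟨ ℚ.+-identityʳ _ ⟨
             ∣ x ∣ ℚ.* ∣ x ∣ ℚ.+ ∣ y ∣ ℚ.* ∣ y ∣ ℚ.+ 0ℚ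
               ≤⟨ ℚ.+-monoʳ-≤ (∣ x ∣ ℚ.* ∣ x ∣ ℚ.+ ∣ y ∣ ℚ.* ∣ y ∣)
                    (ℚ.+-mono-≤ (0≤p*q (ℚ.0≤∣p∣ x) (ℚ.0≤∣p∣ y)) (0≤p*q (ℚ.0≤∣p∣ x) (ℚ.0≤∣p∣ y))) ⟩
             ∣ x ∣ ℚ.* ∣ x ∣ ℚ.+ ∣ y ∣ ℚ.* ∣ y ∣ ℚ.+ (∣ x ∣ ℚ.* ∣ y ∣ ℚ.+ ∣ x ∣ ℚ.* ∣ y ∣)
               ≡⟨ solve 2 (λ x y → x :* x :+ y :* y :+ (x :* y :+ x :* y) := (x :+ y) :* (x :+ y)) refl
                    (∣ x ∣) (∣ y ∣) ⟩
             s ℚ.* s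
               ≤⟨ ℚ.*-monoˡ-≤-nonNeg s {{ℚ.nonNegative 0≤s}} s≤m ⟩
             s ℚ.* m
               ≤⟨ ℚ.*-monoʳ-≤-nonNeg m {{ℚ.nonNegative (ℚ.≤-trans 0≤s s≤m)}} s≤m ⟩
             m ℚ.* m  ∎) ⟩
      m ℚ.* m ℚ.+ (ε ℚ.* ε ℚ.- m ℚ.* m)
        ≡⟨ p+[q-p]≡q (m ℚ.* m) (ε ℚ.* ε) ⟩
      ε ℚ.* ε  ∎
    where
    open ℚ.≤-Reasoning
    open +-*-Solver

  ∣z∣<ε⇒components : ∀ z {ε} → 0ℚ ℚ.< ε → ∣ z ∣< ε →
    Eventually λ n → ∣ seq (re z) n ∣ ℚ.< ε × ∣ seq (im z) n ∣ ℚ.< ε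
  ∣z∣<ε⇒components (a +i b) {ε} 0<ε (η , 0<η , N , p) = N , λ n n≥ →
    component (seq a n) (seq b n) (p n n≥) ,
    component (seq b n) (seq a n)
      (subst (λ s → s ℚ.+ η ℚ.≤ ε ℚ.* ε) (ℚ.+-comm (seq a n ℚ.* seq a n) (seq b n ℚ.* seq b n)) (p n n≥))
    where
    component : ∀ x y → x ℚ.* x ℚ.+ y ℚ.* y ℚ.+ η ℚ.≤ ε ℚ.* ε → ∣ x ∣ ℚ.< ε
    component x y h = p*p-cancel-< (ℚ.<⇒≤ 0<ε) (begin-strict
      ∣ x ∣ ℚ.* ∣ x ∣                ≡⟨ p*p≡∣p∣*∣p∣ x ⟨
      x ℚ.* x                        ≡⟨ trans (sym (ℚ.+-identityʳ _)) (sym (ℚ.+-identityʳ _)) ⟩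
      x ℚ.* x ℚ.+ 0ℚ ℚ.+ 0ℚ
        <⟨ ℚ.+-mono-≤-< (ℚ.+-monoʳ-≤ (x ℚ.* x) (subst (0ℚ ℚ.≤_) (sym (p*p≡∣p∣*∣p∣ y)) (0≤p*q (ℚ.0≤∣p∣ y) (ℚ.0≤∣p∣ y)))) 0<η ⟩
      x ℚ.* x ℚ.+ y ℚ.* y ℚ.+ η      ≤⟨ h ⟩
      ε ℚ.* ε                        ∎)
      where open ℚ.≤-Reasoning

≋0⇒∣∣< : ∀ {z} → z ≋ 0# → ∀ {ε} → 0ℚ ℚ.< ε → ∣ z ∣< ε
≋0⇒∣∣< {z} z≋0 0<ε = ‖z‖≼q⇒∣z∣<ε z ℚ.≤-refl 0<ε (≼-trans (‖‖-cong z≋0) ‖0‖≼0)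

-- Each ε may have its own representative w of z, so that `∣_∣<` need not be transported along `≋`.
small⇒≋0 : ∀ {z} → (∀ ε → 0ℚ ℚ.< ε → ∃ λ w → w ≋ z × ∣ w ∣< ε) → z ≋ 0#
small⇒≋0 {z} small = wrap
  ( (λ ε 0<ε → let w , wrap (p , _) , w<½ε = small (½ ℚ.* ε) (0<½ε 0<ε)
                   N , h = ∣z∣<ε⇒components w (0<½ε 0<ε) w<½ε in
      eventually-zip (λ n → near {seq (re z) n} {seq (re w) n})
        (N , λ n N≤n → proj₁ (h n N≤n)) (p (½ ℚ.* ε) (0<½ε 0<ε)))
  , (λ ε 0<ε → let w , wrap (_ , p) , w<½ε = small (½ ℚ.* ε) (0<½ε 0<ε)
                   N , h = ∣z∣<ε⇒components w (0<½ε 0<ε) w<½ε in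
      eventually-zip (λ n → near {seq (im z) n} {seq (im w) n})
        (N , λ n N≤n → proj₂ (h n N≤n)) (p (½ ℚ.* ε) (0<½ε 0<ε))) )
  where
  near : ∀ {x y ε} → ∣ y ∣ ℚ.< ½ ℚ.* ε → ∣ y ℚ.- x ∣ ℚ.< ½ ℚ.* ε → ∣ x ℚ.- 0ℚ ∣ ℚ.< ε
  near {x} {y} {ε} y<½ε y-x<½ε = begin-strict
    ∣ x ℚ.- 0ℚ ∣             ≡⟨ cong ∣_∣ (ℚ.+-identityʳ x) ⟩
    ∣ x ∣                    ≤⟨ ∣p∣≤∣q∣+∣p-q∣ x y ⟩
    ∣ y ∣ ℚ.+ ∣ x ℚ.- y ∣    ≡⟨ cong (∣ y ∣ ℚ.+_) (∣p-q∣≡∣q-p∣ x y) ⟩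
    ∣ y ∣ ℚ.+ ∣ y ℚ.- x ∣    <⟨ ℚ.+-mono-< y<½ε y-x<½ε ⟩
    ½ ℚ.* ε ℚ.+ ½ ℚ.* ε      ≡⟨ ½ε+½ε ε ⟩
    ε                        ∎
    where open ℚ.≤-Reasoning

-- Natural numbers and finite sums in ℂ

open ℂ-Solver using (solve; _:+_; _:*_; _:-_; :-_; _:=_; con)

module ≋-Reasoning = SetoidReasoning 𝔽.setoid
open CommutativeSemigroupProperties 𝔽.+-commutativeSemigroup using (interchange)

module ℂ-Series = HurwitzSeries ℂ-commutativeRing
open ℂ-Series using (_∗_; _⊞_; _·_; _≐_; var; powers)

opaque
  unfolding ι

  ι≋fromℚ : ∀ n → ι n ≋ fromℚ (ℕ⇒ℚ n)
  ι≋fromℚ n = 𝔽.refl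

ι-0 : ι 0 ≋ 0#
ι-0 = ι≋fromℚ 0

ι-1 : ι 1 ≋ 1#
ι-1 = ι≋fromℚ 1

ι-suc : ∀ n → ι (suc n) ≋ 1# + ι n
ι-suc n = begin
  ι (suc n)                      ≈⟨ ι≋fromℚ (suc n) ⟩
  fromℚ (ℕ⇒ℚ (1 ℕ.+ n))          ≡⟨ cong fromℚ (ℕ⇒ℚ-+ 1 n) ⟩
  fromℚ (1ℚ ℚ.+ ℕ⇒ℚ n)           ≈⟨ fromℚ-+ 1ℚ (ℕ⇒ℚ n) ⟩
  1# + fromℚ (ℕ⇒ℚ n)             ≈⟨ 𝔽.+-congˡ (ι≋fromℚ n) ⟨
  1# + ι n                       ∎
  where open ≋-Reasoning

ι-* : ∀ m n → ι (m ℕ.* n) ≋ ι m * ι n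
ι-* m n = begin
  ι (m ℕ.* n)                    ≈⟨ ι≋fromℚ (m ℕ.* n) ⟩
  fromℚ (ℕ⇒ℚ (m ℕ.* n))          ≡⟨ cong fromℚ (ℕ⇒ℚ-* m n) ⟩
  fromℚ (ℕ⇒ℚ m ℚ.* ℕ⇒ℚ n)        ≈⟨ fromℚ-* (ℕ⇒ℚ m) (ℕ⇒ℚ n) ⟩
  fromℚ (ℕ⇒ℚ m) * fromℚ (ℕ⇒ℚ n)  ≈⟨ 𝔽.*-cong (ι≋fromℚ m) (ι≋fromℚ n) ⟨
  ι m * ι n                      ∎
  where open ≋-Reasoning

ι-inverse : ∀ n .{{_ : ℕ.NonZero n}} → ι n * fromℚ (ℤ.+ 1 ℚ./ n) ≋ 1#
ι-inverse n = begin
  ι n * fromℚ (ℤ.+ 1 ℚ./ n)            ≈⟨ 𝔽.*-congʳ (ι≋fromℚ n) ⟩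
  fromℚ (ℕ⇒ℚ n) * fromℚ (ℤ.+ 1 ℚ./ n)  ≈⟨ fromℚ-* (ℕ⇒ℚ n) (ℤ.+ 1 ℚ./ n) ⟨
  fromℚ (ℕ⇒ℚ n ℚ.* (ℤ.+ 1 ℚ./ n))      ≡⟨ cong fromℚ (n*1/n≡1 n) ⟩
  1#                                   ∎
  where open ≋-Reasoning

∑< : ℕ → (ℕ → ℂ) → ℂ
∑< n a = sum {n} λ i → a (toℕ i)

∑<-cong : ∀ n {a b} → (∀ k → a k ≋ b k) → ∑< n a ≋ ∑< n b
∑<-cong zero    a≋b = 𝔽.refl
∑<-cong (suc n) a≋b = 𝔽.+-cong (a≋b 0) (∑<-cong n (a≋b ∘ suc))

∑<-+ : ∀ n a b → ∑< n (λ k → a k + b k) ≋ ∑< n a + ∑< n b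
∑<-+ zero    a b = 𝔽.sym (𝔽.+-identityˡ 0#)
∑<-+ (suc n) a b = 𝔽.trans (𝔽.+-congˡ (∑<-+ n (a ∘ suc) (b ∘ suc))) (interchange _ _ _ _)

∑<-0 : ∀ n {a} → (∀ k → a k ≋ 0#) → ∑< n a ≋ 0#
∑<-0 zero    a≋0 = 𝔽.refl
∑<-0 (suc n) a≋0 = 𝔽.trans (𝔽.+-cong (a≋0 0) (∑<-0 n (a≋0 ∘ suc))) (𝔽.+-identityˡ 0#)

∑<-neg : ∀ n a → ∑< n (-_ ∘ a) ≋ - ∑< n a
∑<-neg zero    a = solve 0 (con 0ℚ := :- con 0ℚ) 𝔽.refl
∑<-neg (suc n) a = 𝔽.trans (𝔽.+-congˡ (∑<-neg n (a ∘ suc)))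
  (solve 2 (λ x y → :- x :- y := :- (x :+ y)) 𝔽.refl (a 0) (∑< n (a ∘ suc)))

∑<-even-odd : ∀ n a → ∑< (2 ℕ.* n) a ≋ ∑< n (λ m → a (2 ℕ.* m) + a (suc (2 ℕ.* m)))
∑<-even-odd zero    a = 𝔽.refl
∑<-even-odd (suc n) a rewrite ℕ.+-suc n (n ℕ.+ 0) = begin
  a 0 + (a 1 + ∑< (2 ℕ.* n) (a ∘ suc ∘ suc))
    ≈⟨ 𝔽.+-congˡ (𝔽.+-congˡ (𝔽.trans (∑<-even-odd n (a ∘ suc ∘ suc)) (∑<-cong n λ m →
         𝔽.reflexive (cong (λ k → a k + a (suc k)) (sym (ℕ.*-suc 2 m)))))) ⟩
  a 0 + (a 1 + ∑< n (λ m → a (2 ℕ.* suc m) + a (suc (2 ℕ.* suc m))))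
    ≈⟨ 𝔽.+-assoc _ _ _ ⟨
  a 0 + a 1 + ∑< n (λ m → a (2 ℕ.* suc m) + a (suc (2 ℕ.* suc m)))  ∎
  where open ≋-Reasoning

-- Polynomials

pair : ℂ[x] → (ℕ → ℂ) → ℂ
pair []      φ = 0#
pair (a ∷ p) φ = a * φ 0 + pair p (φ ∘ suc)

-- Only indices below the length matter, so a series may be truncated beyond them.
pair-cong-< : ∀ p {φ ψ} → (∀ n → n ℕ.< length p → φ n ≋ ψ n) → pair p φ ≋ pair p ψ
pair-cong-< []      φ≋ψ = 𝔽.refl
pair-cong-< (a ∷ p) φ≋ψ = 𝔽.+-cong (𝔽.*-congˡ (φ≋ψ 0 ℕ.z<s)) (pair-cong-< p (λ n n< → φ≋ψ (suc n) (ℕ.s<s n<)))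

pair-cong : ∀ p {φ ψ} → φ ≐ ψ → pair p φ ≋ pair p ψ
pair-cong p φ≐ψ = pair-cong-< p (λ n _ → φ≐ψ n)

pair-⊞ : ∀ p φ ψ → pair p (φ ⊞ ψ) ≋ pair p φ + pair p ψ
pair-⊞ []      φ ψ = 𝔽.sym (𝔽.+-identityˡ 0#)
pair-⊞ (a ∷ p) φ ψ = 𝔽.trans (𝔽.+-cong (𝔽.distribˡ _ _ _) (pair-⊞ p (φ ∘ suc) (ψ ∘ suc))) (interchange _ _ _ _)

pair-· : ∀ p c φ → pair p (c · φ) ≋ c * pair p φ
pair-· []      c φ = 𝔽.sym (𝔽.zeroʳ c)
pair-· (a ∷ p) c φ = 𝔽.trans (𝔽.+-congˡ (pair-· p c (φ ∘ suc)))
  (solve 4 (λ a c x y → a :* (c :* x) :+ c :* y := c :* (a :* x :+ y)) 𝔽.refl a c (φ 0) (pair p (φ ∘ suc)))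

pair-0 : ∀ p → pair p (λ _ → 0#) ≋ 0#
pair-0 []      = 𝔽.refl
pair-0 (a ∷ p) = 𝔽.trans (𝔽.+-cong (𝔽.zeroʳ a) (pair-0 p)) (𝔽.+-identityˡ 0#)

pair-∑< : ∀ p n (c : ℕ → ℂ) (φ : ℕ → ℕ → ℂ) →
          pair p (λ j → ∑< n λ k → c k * φ k j) ≋ ∑< n λ k → c k * pair p (φ k)
pair-∑< p zero    c φ = pair-0 p
pair-∑< p (suc n) c φ = 𝔽.trans (pair-⊞ p (c 0 · φ 0) (λ j → ∑< n λ k → c (suc k) * φ (suc k) j))
  (𝔽.+-cong (pair-· p (c 0) (φ 0)) (pair-∑< p n (c ∘ suc) (φ ∘ suc)))

eval≋pair : ∀ p z → eval p z ≋ pair p (powers z)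
eval≋pair []      z = 𝔽.refl
eval≋pair (a ∷ p) z = 𝔽.+-cong (𝔽.sym (𝔽.*-identityʳ a))
  (𝔽.trans (𝔽.*-congˡ (eval≋pair p z)) (𝔽.sym (pair-· p z (powers z))))

-- The common core of differentiation and integration, which differ in the weights and in the shift
-- of the list; `k` is the running index.
weigh : (ℕ → ℂ) → ℕ → ℂ[x] → ℂ[x]
weigh w k []      = []
weigh w k (a ∷ p) = w k * a ∷ weigh w (suc k) p

pair-weigh : ∀ w k p φ → pair (weigh w k p) φ ≋ pair p (λ j → w (j ℕ.+ k) * φ j)
pair-weigh w k []      φ = 𝔽.refl
pair-weigh w k (a ∷ p) φ = 𝔽.+-cong
  (solve 3 (λ w a x → w :* a :* x := a :* (w :* x)) 𝔽.refl (w k) a (φ 0))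
  (𝔽.trans (pair-weigh w (suc k) p (φ ∘ suc))
    (pair-cong p λ j → 𝔽.*-congʳ (𝔽.reflexive (cong w (ℕ.+-suc j k)))))

length-weigh : ∀ w k p → length (weigh w k p) ≡ length p
length-weigh w k []      = refl
length-weigh w k (a ∷ p) = cong suc (length-weigh w (suc k) p)

weigh-unique : ∀ w (g : ℕ → ℂ[x] → ℂ[x]) → (∀ k → g k [] ≡ []) →
               (∀ k a p → g k (a ∷ p) ≡ w k * a ∷ g (suc k) p) →
               ∀ k p → g k p ≡ weigh w k p
weigh-unique w g g[] g∷ k []      = g[] k
weigh-unique w g g[] g∷ k (a ∷ p) = trans (g∷ k a p) (cong (w k * a ∷_) (weigh-unique w g g[] g∷ (suc k) p))

-- The local function by which derivative is defined cannot be named here.  It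
-- fills the blank in the type of go≡weigh by unification, once with has turned
-- its arguments into distinct variables.
mutual
  derivative-∷ : ∀ a p → derivative (a ∷ p) ≡ weigh ι 1 p
  derivative-∷ a []      = refl
  derivative-∷ a (b ∷ p) = cong (ι 1 * b ∷_) (tail-derivative a b p)

  tail-derivative : ∀ a b p → drop 1 (derivative (a ∷ b ∷ p)) ≡ weigh ι 2 p
  tail-derivative a b p with b ∷ p | 2
  ... | q | k = go≡weigh a q k p

  go≡weigh : ∀ (a : ℂ) (q : ℂ[x]) (k : ℕ) (p : ℂ[x]) → _ ≡ weigh ι k p
  go≡weigh a q = weigh-unique ι _ (λ _ → refl) (λ _ _ _ → refl)

-- In exponential coefficients, t · tⁿ/n! = (n + 1) · tⁿ⁺¹/(n + 1)!.
var-∗ : ∀ φ n → (var ∗ φ) (suc n) ≋ ι (suc n) * φ n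
var-∗ φ zero    = begin
  (var ∗ φ) 1                  ≈⟨ ℂ-Series.var-∗-suc φ 0 ⟩
  φ 0 + 0# * φ 1               ≈⟨ solve 2 (λ x y → x :+ con 0ℚ :* y := con 1ℚ :* x) 𝔽.refl (φ 0) (φ 1) ⟩
  1# * φ 0                     ≈⟨ 𝔽.*-congʳ ι-1 ⟨
  ι 1 * φ 0                    ∎
  where open ≋-Reasoning
var-∗ φ (suc n) = begin
  (var ∗ φ) (suc (suc n))                    ≈⟨ ℂ-Series.var-∗-suc φ (suc n) ⟩
  φ (suc n) + (var ∗ φ ∘ suc) (suc n)        ≈⟨ 𝔽.+-congˡ (var-∗ (φ ∘ suc) n) ⟩
  φ (suc n) + ι (suc n) * φ (suc n)
    ≈⟨ solve 2 (λ x i → x :+ i :* x := (con 1ℚ :+ i) :* x) 𝔽.refl (φ (suc n)) (ι (suc n)) ⟩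
  (1# + ι (suc n)) * φ (suc n)               ≈⟨ 𝔽.*-congʳ (ι-suc (suc n)) ⟨
  ι (suc (suc n)) * φ (suc n)                ∎
  where open ≋-Reasoning

pair-derivative : ∀ p φ → pair (derivative p) φ ≋ pair p (var ∗ φ)
pair-derivative []      φ = 𝔽.refl
pair-derivative (a ∷ p) φ = begin
  pair (derivative (a ∷ p)) φ                   ≡⟨ cong (λ q → pair q φ) (derivative-∷ a p) ⟩
  pair (weigh ι 1 p) φ                          ≈⟨ pair-weigh ι 1 p φ ⟩
  pair p (λ j → ι (j ℕ.+ 1) * φ j)
    ≈⟨ pair-cong p (λ j → 𝔽.trans (𝔽.*-congʳ (𝔽.reflexive (cong ι (ℕ.+-comm j 1)))) (𝔽.sym (var-∗ φ j))) ⟩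
  pair p ((var ∗ φ) ∘ suc)
    ≈⟨ solve 3 (λ a x y → y := a :* (con 0ℚ :* x) :+ y) 𝔽.refl a (φ 0) (pair p ((var ∗ φ) ∘ suc)) ⟩
  a * (0# * φ 0) + pair p ((var ∗ φ) ∘ suc)     ∎
  where open ≋-Reasoning

length-derivative : ∀ p → length (derivative p) ≡ ℕ.pred (length p)
length-derivative []      = refl
length-derivative (a ∷ p) = trans (cong length (derivative-∷ a p)) (length-weigh ι 1 p)

length-⁽⁾ : ∀ p k → length (p ⁽ k ⁾) ≡ length p ℕ.∸ k
length-⁽⁾ p zero    = refl
length-⁽⁾ p (suc k) = trans (length-derivative (p ⁽ k ⁾))
  (trans (cong ℕ.pred (length-⁽⁾ p k)) (ℕ.pred[m∸n]≡m∸[1+n] (length p) k))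

eval-⁽⁾≋0 : ∀ p {k} z → length p ℕ.≤ k → eval (p ⁽ k ⁾) z ≋ 0#
eval-⁽⁾≋0 p {k} z len≤k with p ⁽ k ⁾ | trans (length-⁽⁾ p k) (ℕ.m≤n⇒m∸n≡0 len≤k)
... | [] | _ = 𝔽.refl

antiderivative : ℂ[x] → ℂ[x]
antiderivative p = 0# ∷ weigh (λ k → fromℚ (ℤ.+ 1 ℚ./ suc k)) 0 p

-- The factor j + 1 from multiplication by t cancels the 1/(j + 1) from integration. At the price of
-- one power of t, p and all its derivatives become pairings with a single polynomial, the
-- antiderivative.
pair-antiderivative : ∀ p φ → pair (antiderivative p) (var ∗ φ) ≋ pair p φ
pair-antiderivative p φ = begin
  0# * (0# * φ 0) + pair (weigh w 0 p) ((var ∗ φ) ∘ suc)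
    ≈⟨ solve 2 (λ x y → con 0ℚ :* (con 0ℚ :* x) :+ y := y) 𝔽.refl
         (φ 0) (pair (weigh w 0 p) ((var ∗ φ) ∘ suc)) ⟩
  pair (weigh w 0 p) ((var ∗ φ) ∘ suc)
    ≈⟨ pair-weigh w 0 p ((var ∗ φ) ∘ suc) ⟩
  pair p (λ j → w (j ℕ.+ 0) * (var ∗ φ) (suc j))
    ≈⟨ pair-cong p (λ j → begin
         w (j ℕ.+ 0) * (var ∗ φ) (suc j)  ≈⟨ 𝔽.*-cong (𝔽.reflexive (cong w (ℕ.+-identityʳ j))) (var-∗ φ j) ⟩
         w j * (ι (suc j) * φ j)
           ≈⟨ solve 3 (λ w i x → w :* (i :* x) := i :* w :* x) 𝔽.refl (w j) (ι (suc j)) (φ j) ⟩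
         ι (suc j) * w j * φ j            ≈⟨ 𝔽.*-congʳ (ι-inverse (suc j)) ⟩
         1# * φ j                         ≈⟨ 𝔽.*-identityˡ (φ j) ⟩
         φ j                              ∎) ⟩
  pair p φ  ∎
  where
  open ≋-Reasoning
  w : ℕ → ℂ
  w k = fromℚ (ℤ.+ 1 ℚ./ suc k)

var^_∗_ : ℕ → (ℕ → ℂ) → ℕ → ℂ
var^ zero  ∗ φ = φ
var^ suc k ∗ φ = var ∗ (var^ k ∗ φ)

var^-shift : ∀ k φ → var^ k ∗ (var ∗ φ) ≡ var^ suc k ∗ φ
var^-shift zero    φ = refl
var^-shift (suc k) φ = cong (var ∗_) (var^-shift k φ)

pair-⁽⁾ : ∀ p k φ → pair (p ⁽ k ⁾) φ ≋ pair p (var^ k ∗ φ)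
pair-⁽⁾ p zero    φ = 𝔽.refl
pair-⁽⁾ p (suc k) φ = 𝔽.trans (pair-derivative (p ⁽ k ⁾) φ)
  (𝔽.trans (pair-⁽⁾ p k (var ∗ φ)) (𝔽.reflexive (cong (pair p) (var^-shift k φ))))

eval-⁽⁾≋pair : ∀ p k z → eval (p ⁽ k ⁾) z ≋ pair (antiderivative p) (var^ suc k ∗ powers z)
eval-⁽⁾≋pair p k z = begin
  eval (p ⁽ k ⁾) z                                   ≈⟨ eval≋pair (p ⁽ k ⁾) z ⟩
  pair (p ⁽ k ⁾) (powers z)                          ≈⟨ pair-⁽⁾ p k (powers z) ⟩
  pair p (var^ k ∗ powers z)                         ≈⟨ pair-antiderivative p (var^ k ∗ powers z) ⟨
  pair (antiderivative p) (var^ suc k ∗ powers z)    ∎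
  where open ≋-Reasoning

-- The Leibniz rule for tᵏ⁺¹ φ, with (tᵏ⁺¹)′ = (k + 1) tᵏ.
var^-suc : ∀ k φ n → (var^ suc k ∗ φ) (suc n) ≋ ι (suc k) * (var^ k ∗ φ) n + (var^ suc k ∗ (φ ∘ suc)) n
var^-suc zero    φ n = 𝔽.trans (ℂ-Series.var-∗-suc φ n)
  (𝔽.+-congʳ (𝔽.sym (𝔽.trans (𝔽.*-congʳ ι-1) (𝔽.*-identityˡ (φ n)))))
var^-suc (suc k) φ n = begin
  (var ∗ ψ) (suc n)
    ≈⟨ ℂ-Series.var-∗-suc ψ n ⟩
  ψ n + (var ∗ ψ ∘ suc) n
    ≈⟨ 𝔽.+-congˡ (ℂ-Series.∗-cong {var} (λ _ → 𝔽.refl) (var^-suc k φ) n) ⟩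
  ψ n + (var ∗ (ι (suc k) · (var^ k ∗ φ) ⊞ var^ suc k ∗ (φ ∘ suc))) n
    ≈⟨ 𝔽.+-congˡ (𝔽.trans (ℂ-Series.∗-distribˡ var (ι (suc k) · (var^ k ∗ φ)) (var^ suc k ∗ (φ ∘ suc)) n)
         (𝔽.+-congʳ (ℂ-Series.·-∗ʳ (ι (suc k)) var (var^ k ∗ φ) n))) ⟩
  ψ n + (ι (suc k) * ψ n + (var^ suc (suc k) ∗ (φ ∘ suc)) n)
    ≈⟨ solve 3 (λ x i y → x :+ (i :* x :+ y) := (con 1ℚ :+ i) :* x :+ y) 𝔽.refl
         (ψ n) (ι (suc k)) ((var^ suc (suc k) ∗ (φ ∘ suc)) n) ⟩
  (1# + ι (suc k)) * ψ n + (var^ suc (suc k) ∗ (φ ∘ suc)) n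
    ≈⟨ 𝔽.+-congʳ (𝔽.*-congʳ (ι-suc (suc k))) ⟨
  ι (suc (suc k)) * ψ n + (var^ suc (suc k) ∗ (φ ∘ suc)) n  ∎
  where
  open ≋-Reasoning
  ψ = var^ suc k ∗ φ

-- Expanding the generating function a as ∑ cₖ tᵏ with cₖ = aₖ/k!.
∑-var^ : ∀ N n (a c φ : ℕ → ℂ) → n ℕ.< N → (∀ k → a k ≋ ι (k !) * c k) →
         ∑< N (λ k → c k * (var^ k ∗ φ) n) ≋ (a ∗ φ) n
∑-var^ (suc N) zero    a c φ n<N a≋k!c = begin
  c 0 * φ 0 + ∑< N (λ k → c (suc k) * (0# * (var^ k ∗ φ) 0))
    ≈⟨ 𝔽.+-congˡ (∑<-0 N λ k → solve 2 (λ c x → c :* (con 0ℚ :* x) := con 0ℚ) 𝔽.refl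
         (c (suc k)) ((var^ k ∗ φ) 0)) ⟩
  c 0 * φ 0 + 0#
    ≈⟨ solve 2 (λ c x → c :* x :+ con 0ℚ := con 1ℚ :* c :* x) 𝔽.refl (c 0) (φ 0) ⟩
  1# * c 0 * φ 0
    ≈⟨ 𝔽.*-congʳ (𝔽.trans (a≋k!c 0) (𝔽.*-congʳ ι-1)) ⟨
  a 0 * φ 0  ∎
  where open ≋-Reasoning
∑-var^ (suc N) (suc n) a c φ (ℕ.s<s n<N) a≋k!c = begin
  c 0 * φ (suc n) + ∑< N (λ k → c (suc k) * (var^ suc k ∗ φ) (suc n))
    ≈⟨ 𝔽.+-congˡ (∑<-cong N λ k → 𝔽.trans (𝔽.*-congˡ (var^-suc k φ n))
         (solve 4 (λ c i x y → c :* (i :* x :+ y) := i :* c :* x :+ c :* y) 𝔽.refl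
           (c (suc k)) (ι (suc k)) ((var^ k ∗ φ) n) ((var^ suc k ∗ (φ ∘ suc)) n))) ⟩
  c 0 * φ (suc n) + ∑< N (λ k → d k * (var^ k ∗ φ) n + c (suc k) * (var^ suc k ∗ (φ ∘ suc)) n)
    ≈⟨ 𝔽.+-congˡ (∑<-+ N (λ k → d k * (var^ k ∗ φ) n) (λ k → c (suc k) * (var^ suc k ∗ (φ ∘ suc)) n)) ⟩
  c 0 * φ (suc n) + (∑< N (λ k → d k * (var^ k ∗ φ) n) + rest)
    ≈⟨ solve 3 (λ x y z → x :+ (y :+ z) := y :+ (x :+ z)) 𝔽.refl
         (c 0 * φ (suc n)) (∑< N (λ k → d k * (var^ k ∗ φ) n)) rest ⟩
  ∑< N (λ k → d k * (var^ k ∗ φ) n) + (c 0 * φ (suc n) + rest)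
    ≈⟨ 𝔽.+-cong (∑-var^ N n (a ∘ suc) d φ n<N a′≋k!d) (∑-var^ (suc N) n a c (φ ∘ suc) (ℕ.m<n⇒m<1+n n<N) a≋k!c) ⟩
  (a ∘ suc ∗ φ) n + (a ∗ φ ∘ suc) n  ∎
  where
  open ≋-Reasoning
  -- The ordinary coefficients of the derivative of a, namely aₖ₊₁/k!.
  d : ℕ → ℂ
  d k = ι (suc k) * c (suc k)
  rest = ∑< N (λ k → c (suc k) * (var^ suc k ∗ (φ ∘ suc)) n)
  a′≋k!d : ∀ k → a (suc k) ≋ ι (k !) * d k
  a′≋k!d k = 𝔽.trans (a≋k!c (suc k)) (𝔽.trans (𝔽.*-congʳ (ι-* (suc k) (k !)))
    (solve 3 (λ i j x → i :* j :* x := j :* (i :* x)) 𝔽.refl (ι (suc k)) (ι (k !)) (c (suc k))))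

-- Sums, multiples and translates of polynomials

infixl 6 _+ₚ_
infixl 7 _·ₚ_

_+ₚ_ : ℂ[x] → ℂ[x] → ℂ[x]
[]      +ₚ q       = q
(a ∷ p) +ₚ []      = a ∷ p
(a ∷ p) +ₚ (b ∷ q) = a + b ∷ p +ₚ q

_·ₚ_ : ℂ → ℂ[x] → ℂ[x]
c ·ₚ p = map (c *_) p

eval-+ₚ : ∀ p q z → eval (p +ₚ q) z ≋ eval p z + eval q z
eval-+ₚ []      q       z = 𝔽.sym (𝔽.+-identityˡ _)
eval-+ₚ (a ∷ p) []      z = 𝔽.sym (𝔽.+-identityʳ _)
eval-+ₚ (a ∷ p) (b ∷ q) z = 𝔽.trans (𝔽.+-congˡ (𝔽.*-congˡ (eval-+ₚ p q z)))
  (solve 5 (λ a b z p q → a :+ b :+ z :* (p :+ q) := a :+ z :* p :+ (b :+ z :* q)) 𝔽.refl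
       a b z (eval p z) (eval q z))

eval-·ₚ : ∀ c p z → eval (c ·ₚ p) z ≋ c * eval p z
eval-·ₚ c []      z = 𝔽.sym (𝔽.zeroʳ c)
eval-·ₚ c (a ∷ p) z = 𝔽.trans (𝔽.+-congˡ (𝔽.*-congˡ (eval-·ₚ c p z)))
  (solve 4 (λ a c z p → c :* a :+ z :* (c :* p) := c :* (a :+ z :* p)) 𝔽.refl a c z (eval p z))

-- Horner's scheme at x + c: with q the translated tail, the result is a + xq + cq.
translate : ℂ → ℂ[x] → ℂ[x]
translate c []      = []
translate c (a ∷ p) = (a ∷ translate c p) +ₚ c ·ₚ translate c p

eval-translate : ∀ c p z → eval (translate c p) z ≋ eval p (z + c)
eval-translate c []      z = 𝔽.refl
eval-translate c (a ∷ p) z = begin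
  eval ((a ∷ q) +ₚ c ·ₚ q) z               ≈⟨ eval-+ₚ (a ∷ q) (c ·ₚ q) z ⟩
  a + z * eval q z + eval (c ·ₚ q) z       ≈⟨ 𝔽.+-congˡ (eval-·ₚ c q z) ⟩
  a + z * eval q z + c * eval q z
    ≈⟨ solve 4 (λ a z c x → a :+ z :* x :+ c :* x := a :+ (z :+ c) :* x) 𝔽.refl a z c (eval q z) ⟩
  a + (z + c) * eval q z                   ≈⟨ 𝔽.+-congˡ (𝔽.*-congˡ (eval-translate c p z)) ⟩
  a + (z + c) * eval p (z + c)             ∎
  where
  open ≋-Reasoning
  q = translate c p

sumₚ : ℕ → (ℕ → ℂ[x]) → ℂ[x]
sumₚ zero    p = []
sumₚ (suc n) p = p 0 +ₚ sumₚ n (p ∘ suc)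

eval-sumₚ : ∀ n p z → eval (sumₚ n p) z ≋ ∑< n (λ k → eval (p k) z)
eval-sumₚ zero    p z = 𝔽.refl
eval-sumₚ (suc n) p z = 𝔽.trans (eval-+ₚ (p 0) (sumₚ n (p ∘ suc)) z) (𝔽.+-congˡ (eval-sumₚ n (p ∘ suc) z))

-- The coefficients of t/(1 − e⁻ᵗ).
B⁺/! : ℕ → ℚ
B⁺/! 0             = 1ℚ
B⁺/! 1             = ½
B⁺/! n@(suc (suc _)) = B/! n

-- Adding t to t/(eᵗ - 1) gives t/(1 - e⁻ᵗ); of the numbers `B n` only B₁ = -½ changes, to ½.
B⁺ : ℕ → ℂ
B⁺ n = fromℚ (B n ℚ.+ ℚ-Series.var n)

B⁺≋k!*B⁺/! : ∀ k → B⁺ k ≋ ι (k !) * fromℚ (B⁺/! k)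
B⁺≋k!*B⁺/! 0 = 𝔽.sym (𝔽.trans (𝔽.*-congʳ ι-1) (𝔽.*-identityˡ 1#))
B⁺≋k!*B⁺/! 1 = 𝔽.sym (𝔽.trans (𝔽.*-congʳ ι-1) (𝔽.*-identityˡ (fromℚ ½)))
B⁺≋k!*B⁺/! k@(suc (suc _)) = begin
  fromℚ (B k ℚ.+ 0ℚ)
    ≡⟨ cong fromℚ (trans (ℚ.+-identityʳ (B k)) (sym (ℚ.*-identityʳ (B k)))) ⟩
  fromℚ (B k ℚ.* 1ℚ)
    ≡⟨ cong (λ q → fromℚ (B k ℚ.* q)) (n*1/n≡1 (k !) {{k ℕ.!≢0}}) ⟨
  fromℚ (B k ℚ.* (ℕ⇒ℚ (k !) ℚ.* 1/k!))
    ≡⟨ cong fromℚ (solve′ 3 (λ b n i → b :*′ (n :*′ i) :=′ n :*′ (b :*′ i)) refl (B k) (ℕ⇒ℚ (k !)) 1/k!) ⟩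
  fromℚ (ℕ⇒ℚ (k !) ℚ.* B/! k)                              ≈⟨ fromℚ-* (ℕ⇒ℚ (k !)) (B/! k) ⟩
  fromℚ (ℕ⇒ℚ (k !)) * fromℚ (B/! k)                        ≈⟨ 𝔽.*-congʳ (ι≋fromℚ (k !)) ⟨
  ι (k !) * fromℚ (B/! k)                                  ∎
  where
  open ≋-Reasoning
  open +-*-Solver using () renaming (solve to solve′; _:*_ to _:*′_; _:=_ to _:=′_)
  1/k! = (ℤ.+ 1 ℚ./ k !) {{k ℕ.!≢0}}

-- Euler–Maclaurin polynomials

eulerMaclaurinTerm : ℂ[x] → ℂ → ℕ → ℂ
eulerMaclaurinTerm p z m = fromℚ (B/! (2 ℕ.* m)) * eval (p ⁽ 2 ℕ.* m ℕ.∸ 1 ⁾) z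

-- This is ∑ Bₖ⁺/k! Dᵏ applied to the antiderivative, without the vanishing odd terms. Stopping
-- after `length p` terms loses nothing, as the later derivatives are zero, and keeps the result a
-- polynomial.
eulerMaclaurin : ℂ[x] → ℂ[x]
eulerMaclaurin p = antiderivative p +ₚ fromℚ ½ ·ₚ p +ₚ
  sumₚ (length p) (λ m → fromℚ (B/! (2 ℕ.* suc m)) ·ₚ p ⁽ 2 ℕ.* suc m ℕ.∸ 1 ⁾)

eval-eulerMaclaurin : ∀ p z → eval (eulerMaclaurin p) z ≋
  eval (antiderivative p) z + fromℚ ½ * eval p z + ∑₁ (length p) (eulerMaclaurinTerm p z)
eval-eulerMaclaurin p z = 𝔽.trans
  (eval-+ₚ (antiderivative p +ₚ fromℚ ½ ·ₚ p) (sumₚ (length p) term) z)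
  (𝔽.+-cong
    (𝔽.trans (eval-+ₚ (antiderivative p) (fromℚ ½ ·ₚ p) z) (𝔽.+-congˡ (eval-·ₚ (fromℚ ½) p z)))
    (𝔽.trans (eval-sumₚ (length p) term z)
      (∑<-cong (length p) λ m → eval-·ₚ (fromℚ (B/! (2 ℕ.* suc m))) (p ⁽ 2 ℕ.* suc m ℕ.∸ 1 ⁾) z)))
  where
  term : ℕ → ℂ[x]
  term m = fromℚ (B/! (2 ℕ.* suc m)) ·ₚ p ⁽ 2 ℕ.* suc m ℕ.∸ 1 ⁾

-- The odd terms vanish by `B-odd` and can be put back, which completes the sum over all orders
-- below 2 + 2 `length p`. The antiderivative is no longer than that, so the pairing cannot tell
-- this truncation from the whole series.
eulerMaclaurin≋pair : ∀ p z → eval (eulerMaclaurin p) z ≋ pair (antiderivative p) (B⁺ ∗ powers z)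
eulerMaclaurin≋pair p z = begin
  eval (eulerMaclaurin p) z
    ≈⟨ eval-eulerMaclaurin p z ⟩
  eval A z + fromℚ ½ * eval p z + ∑₁ N (eulerMaclaurinTerm p z)
    ≈⟨ 𝔽.+-cong (𝔽.+-cong (𝔽.trans (eval≋pair A z) (𝔽.sym (𝔽.*-identityˡ _))) (𝔽.*-congˡ (eval-⁽⁾≋pair p 0 z)))
         (∑<-cong N even) ⟩
  f 0 + f 1 + ∑< N (λ m → f (2 ℕ.+ 2 ℕ.* m) + f (3 ℕ.+ 2 ℕ.* m))
    ≈⟨ 𝔽.+-congˡ (∑<-even-odd N (f ∘ suc ∘ suc)) ⟨
  f 0 + f 1 + ∑< (2 ℕ.* N) (f ∘ suc ∘ suc)
    ≈⟨ 𝔽.+-assoc _ _ _ ⟩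
  ∑< (2 ℕ.+ 2 ℕ.* N) f
    ≈⟨ pair-∑< A (2 ℕ.+ 2 ℕ.* N) c (λ k → var^ k ∗ X) ⟨
  pair A (λ n → ∑< (2 ℕ.+ 2 ℕ.* N) λ k → c k * (var^ k ∗ X) n)
    ≈⟨ pair-cong-< A (λ n n< → ∑-var^ (2 ℕ.+ 2 ℕ.* N) n B⁺ c X (ℕ.<-≤-trans n< length-A) B⁺≋k!*B⁺/!) ⟩
  pair A (B⁺ ∗ X)  ∎
  where
  open ≋-Reasoning
  A = antiderivative p
  N = length p
  X = powers z
  c f : ℕ → ℂ
  c k = fromℚ (B⁺/! k)
  f k = c k * pair A (var^ k ∗ X)
  length-A : length A ℕ.≤ 2 ℕ.+ 2 ℕ.* N
  length-A = subst (λ l → suc l ℕ.≤ 2 ℕ.+ 2 ℕ.* N) (sym (length-weigh _ 0 p))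
    (ℕ.m≤n⇒m≤1+n (ℕ.s≤s (ℕ.m≤m+n N (N ℕ.+ 0))))
  odd : ∀ m → f (3 ℕ.+ 2 ℕ.* m) ≋ 0#
  odd m = begin
    fromℚ (B n ℚ.* 1/n!) * y
      ≡⟨ cong (λ b → fromℚ (b ℚ.* 1/n!) * y) (trans (cong (B ∘ suc) (sym (ℕ.*-suc 2 m))) (B-odd m)) ⟩
    fromℚ (0ℚ ℚ.* 1/n!) * y     ≡⟨ cong (λ b → fromℚ b * y) (ℚ.*-zeroˡ 1/n!) ⟩
    0# * y                      ≈⟨ 𝔽.zeroˡ y ⟩
    0#                          ∎
    where
    n = 3 ℕ.+ 2 ℕ.* m
    1/n! = (ℤ.+ 1 ℚ./ n !) {{n ℕ.!≢0}}
    y = pair A (var^ n ∗ X)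
  even : ∀ m → eulerMaclaurinTerm p z (suc m) ≋ f (2 ℕ.+ 2 ℕ.* m) + f (3 ℕ.+ 2 ℕ.* m)
  even m = begin
    eulerMaclaurinTerm p z (suc m)
      ≈⟨ 𝔽.*-congˡ (eval-⁽⁾≋pair p (2 ℕ.* suc m ℕ.∸ 1) z) ⟩
    fromℚ (B/! (2 ℕ.* suc m)) * pair A (var^ (2 ℕ.* suc m) ∗ X)
      ≡⟨ cong (λ k → fromℚ (B/! k) * pair A (var^ k ∗ X)) (ℕ.*-suc 2 m) ⟩
    f (2 ℕ.+ 2 ℕ.* m)
      ≈⟨ 𝔽.+-identityʳ _ ⟨
    f (2 ℕ.+ 2 ℕ.* m) + 0#
      ≈⟨ 𝔽.+-congˡ (odd m) ⟨
    f (2 ℕ.+ 2 ℕ.* m) + f (3 ℕ.+ 2 ℕ.* m)  ∎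

fromℚ-∗ : ∀ a b n → fromℚ ((a ℚ-Series.∗ b) n) ≋ ((fromℚ ∘ a) ∗ (fromℚ ∘ b)) n
fromℚ-∗ a b zero    = fromℚ-* (a 0) (b 0)
fromℚ-∗ a b (suc n) = 𝔽.trans (fromℚ-+ _ _) (𝔽.+-cong (fromℚ-∗ (a ∘ suc) b n) (fromℚ-∗ a (b ∘ suc) n))

Bᶜ : ℕ → ℂ
Bᶜ = fromℚ ∘ B

B⁺≐B⊞var : B⁺ ≐ Bᶜ ⊞ var
B⁺≐B⊞var n = 𝔽.trans (fromℚ-+ (B n) (ℚ-Series.var n)) (𝔽.+-congˡ (fromℚ-var n))
  where
  fromℚ-var : ∀ n → fromℚ (ℚ-Series.var n) ≋ var n
  fromℚ-var zero          = 𝔽.refl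
  fromℚ-var (suc zero)    = 𝔽.refl
  fromℚ-var (suc (suc n)) = 𝔽.refl

B⁺≐B∗exp : B⁺ ≐ Bᶜ ∗ powers 1#
B⁺≐B∗exp n = begin
  fromℚ (B n ℚ.+ ℚ-Series.var n)               ≡⟨ cong fromℚ (B∗exp n) ⟨
  fromℚ ((B ℚ-Series.∗ ℚ-Series.powers 1ℚ) n)  ≈⟨ fromℚ-∗ B (ℚ-Series.powers 1ℚ) n ⟩
  (Bᶜ ∗ (fromℚ ∘ ℚ-Series.powers 1ℚ)) n
    ≈⟨ ℂ-Series.∗-cong {Bᶜ} (λ _ → 𝔽.refl)
           (λ k → 𝔽.trans (𝔽.reflexive (cong fromℚ (ℚ-Series.powers-1 k))) (𝔽.sym (ℂ-Series.powers-1 k))) n ⟩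
  (Bᶜ ∗ powers 1#) n                           ∎
  where open ≋-Reasoning

-- B⁺ has the two forms B + t and B eᵗ. The first splits off t e^{zt}; the second, as B = B⁺ e⁻ᵗ,
-- turns the rest B e^{zt} into B⁺ e^{(z-1)t}.
B⁺∗powers : ∀ z → B⁺ ∗ powers z ≐ B⁺ ∗ powers (z - 1#) ⊞ var ∗ powers z
B⁺∗powers z n = begin
  (B⁺ ∗ powers z) n
    ≈⟨ ℂ-Series.∗-cong {b = powers z} B⁺≐B⊞var (λ _ → 𝔽.refl) n ⟩
  ((Bᶜ ⊞ var) ∗ powers z) n
    ≈⟨ ℂ-Series.∗-distribʳ Bᶜ var (powers z) n ⟩
  (Bᶜ ∗ powers z) n + (var ∗ powers z) n
    ≈⟨ 𝔽.+-congʳ (begin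
         (Bᶜ ∗ powers z) n
           ≈⟨ ℂ-Series.∗-cong {b = powers z} (ℂ-Series.powers-inverse Bᶜ 1#) (λ _ → 𝔽.refl) n ⟨
         (Bᶜ ∗ powers 1# ∗ powers (- 1#) ∗ powers z) n
           ≈⟨ ℂ-Series.∗-cong {b = powers z} (ℂ-Series.∗-cong {b = powers (- 1#)} B⁺≐B∗exp (λ _ → 𝔽.refl)) (λ _ → 𝔽.refl) n ⟨
         (B⁺ ∗ powers (- 1#) ∗ powers z) n
           ≈⟨ ℂ-Series.∗-assoc B⁺ (powers (- 1#)) (powers z) n ⟩
         (B⁺ ∗ (powers (- 1#) ∗ powers z)) n
           ≈⟨ ℂ-Series.∗-cong {B⁺} (λ _ → 𝔽.refl)
                  (λ k → 𝔽.trans (ℂ-Series.powers-∗ (- 1#) z k) (ℂ-Series.powers-cong (𝔽.+-comm (- 1#) z) k)) n ⟩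
         (B⁺ ∗ powers (z - 1#)) n  ∎) ⟩
  (B⁺ ∗ powers (z - 1#)) n + (var ∗ powers z) n  ∎
  where open ≋-Reasoning

eulerMaclaurin-difference : ∀ p z → eval (eulerMaclaurin p) z - eval (eulerMaclaurin p) (z - 1#) ≋ eval p z
eulerMaclaurin-difference p z = begin
  Q z - Q (z - 1#)
    ≈⟨ 𝔽.+-cong (begin
         Q z                                               ≈⟨ eulerMaclaurin≋pair p z ⟩
         pair A (B⁺ ∗ powers z)                            ≈⟨ pair-cong A (B⁺∗powers z) ⟩
         pair A (B⁺ ∗ powers (z - 1#) ⊞ var ∗ powers z)
           ≈⟨ pair-⊞ A (B⁺ ∗ powers (z - 1#)) (var ∗ powers z) ⟩
         pair A (B⁺ ∗ powers (z - 1#)) + pair A (var ∗ powers z)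
           ≈⟨ 𝔽.+-cong (eulerMaclaurin≋pair p (z - 1#)) (eval-⁽⁾≋pair p 0 z) ⟨
         Q (z - 1#) + eval p z                             ∎)
       𝔽.refl ⟩
  Q (z - 1#) + eval p z - Q (z - 1#)
    ≈⟨ solve 2 (λ q p → q :+ p :- q := p) 𝔽.refl (Q (z - 1#)) (eval p z) ⟩
  eval p z  ∎
  where
  open ≋-Reasoning
  A = antiderivative p
  Q = eval (eulerMaclaurin p)

-- Fractional sums of polynomials

eval-cong : ∀ p {z w} → z ≋ w → eval p z ≋ eval p w
eval-cong p {z} {w} (wrap z≈w) = wrap (Func.cong ⟦ p ⟧ {z} {w} z≈w)

⟶-eventually-≋ : ∀ {a l} → Eventually (λ n → a n ≋ l) → a ⟶ l
⟶-eventually-≋ (N , a≋l) ε 0<ε = N , λ n N≤n →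
  ≋0⇒∣∣< (𝔽.trans (𝔽.+-congʳ (a≋l n N≤n)) (𝔽.-‿inverseʳ _)) 0<ε

⟶0-constant : ∀ {a c} → (∀ n → a n ≋ c) → a ⟶ 0# → c ≋ 0#
⟶0-constant {a} {c} a≋c a⟶0 = small⇒≋0 λ ε 0<ε → let N , p = a⟶0 ε 0<ε in
  a N - 0# , 𝔽.trans (solve 1 (λ x → x :- con 0ℚ := x) 𝔽.refl (a N)) (a≋c N) , p N ℕ.≤-refl

1≉0 : ¬ 1# ≈ 0#
1≉0 (p , _) = let N , h = p 1ℚ (ℚ.positive⁻¹ 1ℚ) in ℚ.<-irrefl refl (h N ℕ.≤-refl)

monic-hasDegree : ∀ p → HasDegree (p ∷ʳ 1#) [ length p ]
monic-hasDegree p = subst (λ a → ¬ a ≈ 0#) (sym (leading p)) 1≉0 , λ k → unwrap ∘ above p k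
  where
  leading : ∀ p → coeff (p ∷ʳ 1#) (length p) ≡ 1#
  leading []      = refl
  leading (a ∷ p) = leading p
  above : ∀ p k → length p ℕ.< k → coeff (p ∷ʳ 1#) k ≋ 0#
  above []      (suc k) _           = 𝔽.refl
  above (a ∷ p) (suc k) (ℕ.s<s p<k) = above p k p<k

module _ {ℓ} {U : Pred Fun ℓ} (fractionalSum : FractionalSum U) (ℂ[x]⊆S : ∀ p → ⟦ p ⟧ ∈ S U) where

  open FractionalSum fractionalSum

  private
    polynomial : ℂ[x] → ∃ (S U)
    polynomial p = ⟦ p ⟧ , ℂ[x]⊆S p

  ∑ₚ : ℂ[x] → ℂ → ℂ → ℂ
  ∑ₚ p = ⨋ (polynomial p)

  ∑ₚ-cong : ∀ p {x x′ y y′} → x ≋ x′ → y ≋ y′ → ∑ₚ p x y ≋ ∑ₚ p x′ y′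
  ∑ₚ-cong p {x} {x′} {y} {y′} (wrap x≈x′) (wrap y≈y′) = wrap
    (⨋-cong (polynomial p) (polynomial p) {x} {x′} {y} {y′} (λ z → unwrap (𝔽.refl {eval p z})) x≈x′ y≈y′)

  ∑ₚ-split : ∀ p x y z → ∑ₚ p x y + ∑ₚ p (y + 1#) z ≋ ∑ₚ p x z
  ∑ₚ-split p x y z = wrap (A1 (polynomial p) x y z)

  ∑ₚ-translate : ∀ p s x y → ∑ₚ p (x + s) (y + s) ≋ ∑ₚ (translate s p) x y
  ∑ₚ-translate p s x y = wrap
    (A2 (polynomial p) (polynomial (translate s p)) s x y (λ t → unwrap (eval-translate s p t)))

  -- (A4) knows the one-term sum only at 1, and (A2) carries it to z + 1.
  ∑ₚ-single : ∀ p z → ∑ₚ p (z + 1#) (z + 1#) ≋ eval p (z + 1#)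
  ∑ₚ-single p z = begin
    ∑ₚ p (z + 1#) (z + 1#)      ≈⟨ ∑ₚ-cong p (𝔽.+-comm z 1#) (𝔽.+-comm z 1#) ⟩
    ∑ₚ p (1# + z) (1# + z)      ≈⟨ ∑ₚ-translate p z 1# 1# ⟩
    ∑ₚ (translate z p) 1# 1#    ≈⟨ wrap (A4 (polynomial (translate z p))) ⟩
    eval (translate z p) 1#     ≈⟨ eval-translate z p 1# ⟩
    eval p (1# + z)             ≈⟨ eval-cong p (𝔽.+-comm 1# z) ⟩
    eval p (z + 1#)             ∎
    where open ≋-Reasoning

  -- By (A1), the sum from 1 to 0 followed by the sum from 1 to 1 is again the sum from 1 to 1.
  ∑ₚ-empty : ∀ p → ∑ₚ p 1# 0# ≋ 0#
  ∑ₚ-empty p = begin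
    ∑ₚ p 1# 0#
      ≈⟨ solve 2 (λ x y → x := x :+ y :- y) 𝔽.refl (∑ₚ p 1# 0#) (∑ₚ p 1# 1#) ⟩
    ∑ₚ p 1# 0# + ∑ₚ p 1# 1# - ∑ₚ p 1# 1#
      ≈⟨ 𝔽.+-congʳ (𝔽.+-congˡ (∑ₚ-cong p (𝔽.+-identityˡ 1#) 𝔽.refl)) ⟨
    ∑ₚ p 1# 0# + ∑ₚ p (0# + 1#) 1# - ∑ₚ p 1# 1#
      ≈⟨ 𝔽.+-congʳ (∑ₚ-split p 1# 0# 1#) ⟩
    ∑ₚ p 1# 1# - ∑ₚ p 1# 1#
      ≈⟨ 𝔽.-‿inverseʳ _ ⟩
    0#  ∎
    where open ≋-Reasoning

  module _ (p W : ℂ[x]) (W-difference : ∀ z → eval W z - eval W (z - 1#) ≋ eval p z) where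

    private
      G : ℂ → ℂ
      G z = ∑ₚ p 1# z - eval W z

      G-cong : ∀ {z w} → z ≋ w → G z ≋ G w
      G-cong z≋w = 𝔽.+-cong (∑ₚ-cong p 𝔽.refl z≋w) (𝔽.-‿cong (eval-cong W z≋w))

      G-step : ∀ z → G (z + 1#) ≋ G z
      G-step z = begin
        ∑ₚ p 1# (z + 1#) - eval W (z + 1#)
          ≈⟨ 𝔽.+-congʳ (∑ₚ-split p 1# z (z + 1#)) ⟨
        ∑ₚ p 1# z + ∑ₚ p (z + 1#) (z + 1#) - eval W (z + 1#)
          ≈⟨ 𝔽.+-congʳ (𝔽.+-congˡ (𝔽.trans (∑ₚ-single p z) (𝔽.sym (W-difference (z + 1#))))) ⟩
        ∑ₚ p 1# z + (eval W (z + 1#) - eval W (z + 1# - 1#)) - eval W (z + 1#)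
          ≈⟨ solve 3 (λ s w v → s :+ (w :- v) :- w := s :- v) 𝔽.refl
               (∑ₚ p 1# z) (eval W (z + 1#)) (eval W (z + 1# - 1#)) ⟩
        ∑ₚ p 1# z - eval W (z + 1# - 1#)
          ≈⟨ 𝔽.+-congˡ (𝔽.-‿cong (eval-cong W (solve 1 (λ z → z :+ con 1ℚ :- con 1ℚ := z) 𝔽.refl z))) ⟩
        ∑ₚ p 1# z - eval W z  ∎
        where open ≋-Reasoning

      G-periodic : ∀ n z → G (z + ι n) ≋ G z
      G-periodic zero    z = G-cong (𝔽.trans (𝔽.+-congˡ ι-0) (𝔽.+-identityʳ z))
      G-periodic (suc n) z = begin
        G (z + ι (suc n))
          ≈⟨ G-cong (𝔽.trans (𝔽.+-congˡ (ι-suc n)) (solve 2 (λ z i → z :+ (con 1ℚ :+ i) := z :+ i :+ con 1ℚ) 𝔽.refl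
               z (ι n))) ⟩
        G (z + ι n + 1#)      ≈⟨ G-step (z + ι n) ⟩
        G (z + ι n)           ≈⟨ G-periodic n z ⟩
        G z                   ∎
        where open ≋-Reasoning

      -- The antidifference of p(· + n), normalised to vanish at 0 as `IsPolynomialSum` requires.
      Q : ℕ → ℂ[x]
      Q n = translate (ι n) W +ₚ (- eval W (ι n) ∷ [])

      eval-Q : ∀ n z → eval (Q n) z ≋ eval W (z + ι n) - eval W (ι n)
      eval-Q n z = 𝔽.trans (eval-+ₚ (translate (ι n) W) (- eval W (ι n) ∷ []) z) (𝔽.+-cong (eval-translate (ι n) W z)
        (solve 2 (λ w z → :- w :+ z :* con 0ℚ := :- w) 𝔽.refl (eval W (ι n)) z))

      Q-difference : ∀ n z → eval (Q n) z - eval (Q n) (z - 1#) ≋ eval p (z + ι n)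
      Q-difference n z = begin
        eval (Q n) z - eval (Q n) (z - 1#)
          ≈⟨ 𝔽.+-cong (eval-Q n z) (𝔽.-‿cong (eval-Q n (z - 1#))) ⟩
        (eval W (z + ι n) - eval W (ι n)) - (eval W (z - 1# + ι n) - eval W (ι n))
          ≈⟨ solve 3 (λ x y c → (x :- c) :- (y :- c) := x :- y) 𝔽.refl
               (eval W (z + ι n)) (eval W (z - 1# + ι n)) (eval W (ι n)) ⟩
        eval W (z + ι n) - eval W (z - 1# + ι n)
          ≈⟨ 𝔽.+-congˡ (𝔽.-‿cong (eval-cong W (solve 2 (λ z i → z :- con 1ℚ :+ i := z :+ i :- con 1ℚ) 𝔽.refl
               z (ι n)))) ⟩
        eval W (z + ι n) - eval W (z + ι n - 1#)
          ≈⟨ W-difference (z + ι n) ⟩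
        eval p (z + ι n)  ∎
        where open ≋-Reasoning

      Q-0 : ∀ n {z} → z ≋ 0# → eval (Q n) z ≋ 0#
      Q-0 n {z} z≋0 = 𝔽.trans (eval-Q n z) (𝔽.trans
        (𝔽.+-congʳ (eval-cong W (𝔽.trans (𝔽.+-congʳ z≋0) (𝔽.+-identityˡ (ι n)))))
        (𝔽.-‿inverseʳ (eval W (ι n))))

      -- The argument `1# - 1#` is left unsimplified, since `IsPolynomialSum` states the lower end
      -- in this form; `Q-0` applies to it as well as to `0#`.
      v : ℂ → ℕ → ℂ
      v z n = eval (Q n) z - eval (Q n) (1# - 1#)

      -- (A2) and (A1) make the translated sum a difference of two sums from 1, hence the whole a
      -- difference of values of `G`; periodicity removes n. A null sequence that is constant has
      -- the value zero.
      error : ∀ z n → ∑ₚ (translate (ι n) p) 1# z - v z n ≋ G z - G 0#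
      error z n = begin
        ∑ₚ (translate (ι n) p) 1# z - v z n
          ≈⟨ 𝔽.+-cong
               (begin
                 ∑ₚ (translate (ι n) p) 1# z
                   ≈⟨ ∑ₚ-translate p (ι n) 1# z ⟨
                 ∑ₚ p (1# + ι n) (z + ι n)
                   ≈⟨ ∑ₚ-cong p (𝔽.+-comm 1# (ι n)) 𝔽.refl ⟩
                 ∑ₚ p (ι n + 1#) (z + ι n)
                   ≈⟨ solve 2 (λ s t → t := (s :+ t) :- s) 𝔽.refl
                        (∑ₚ p 1# (ι n)) (∑ₚ p (ι n + 1#) (z + ι n)) ⟩
                 ∑ₚ p 1# (ι n) + ∑ₚ p (ι n + 1#) (z + ι n) - ∑ₚ p 1# (ι n)
                   ≈⟨ 𝔽.+-congʳ (∑ₚ-split p 1# (ι n) (z + ι n)) ⟩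
                 ∑ₚ p 1# (z + ι n) - ∑ₚ p 1# (ι n)  ∎)
               (𝔽.-‿cong (𝔽.+-cong (eval-Q n z) (𝔽.-‿cong (Q-0 n (𝔽.-‿inverseʳ 1#))))) ⟩
        (∑ₚ p 1# (z + ι n) - ∑ₚ p 1# (ι n)) - ((eval W (z + ι n) - eval W (ι n)) - 0#)
          ≈⟨ solve 4 (λ s t w v → (s :- t) :- ((w :- v) :- con 0ℚ) := (s :- w) :- (t :- v)) 𝔽.refl
               (∑ₚ p 1# (z + ι n)) (∑ₚ p 1# (ι n)) (eval W (z + ι n)) (eval W (ι n)) ⟩
        G (z + ι n) - G (ι n)
          ≈⟨ 𝔽.+-cong (G-periodic n z) (𝔽.-‿cong (𝔽.trans (G-cong (𝔽.sym (𝔽.+-identityˡ (ι n)))) (G-periodic n 0#))) ⟩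
        G z - G 0#  ∎
        where open ≋-Reasoning

    -- z ↦ ∑ₚ p 1# z - eval W z has period 1, and by (A6) its values at z and 0
    -- get arbitrarily close under integer translations.
    ∑ₚ-hasDegree : ∀ {d} → HasDegree p d → ∀ z → ∑ₚ p 1# z ≋ eval W z - eval W 0#
    ∑ₚ-hasDegree {d} p-degree z = begin
      ∑ₚ p 1# z
        ≈⟨ solve 4 (λ s w t v → s := ((s :- w) :- (t :- v)) :+ (w :+ (t :- v))) 𝔽.refl
             (∑ₚ p 1# z) (eval W z) (∑ₚ p 1# 0#) (eval W 0#) ⟩
      (G z - G 0#) + (eval W z + (∑ₚ p 1# 0# - eval W 0#))
        ≈⟨ 𝔽.+-cong Gz-G0≋0 (𝔽.+-congˡ (𝔽.+-congʳ (∑ₚ-empty p))) ⟩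
      0# + (eval W z + (0# - eval W 0#))
        ≈⟨ solve 2 (λ w v → con 0ℚ :+ (w :+ (con 0ℚ :- v)) := w :- v) 𝔽.refl (eval W z) (eval W 0#) ⟩
      eval W z - eval W 0#  ∎
      where
      open ≋-Reasoning
      Gz-G0≋0 : G z - G 0# ≋ 0#
      Gz-G0≋0 = ⟶0-constant (error z)
        (A6-polynomial (polynomial p) (λ n → polynomial (translate (ι n) p)) 1# z
          (λ n t → unwrap (eval-translate (ι n) p t))
          -- Every approximating polynomial is p itself, so the approximation error in (A6) is
          -- identically zero.
          d (λ _ → p) (λ _ → p-degree)
          (λ t → ⟶-eventually-≋ (0 , λ n _ → 𝔽.-‿inverseʳ (eval p (t + ι n))))
          (v z)
          (λ n → Q n , (λ t → unwrap (Q-difference n t)) , unwrap (Q-0 n 𝔽.refl) , unwrap (𝔽.refl {v z n})))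

  -- Adding a monic monomial of high degree makes the degree of p known.
  ∑ₚ≋difference : ∀ p W → (∀ z → eval W z - eval W (z - 1#) ≋ eval p z) →
                  ∀ z → ∑ₚ p 1# z ≋ eval W z - eval W 0#
  ∑ₚ≋difference p W W-difference z = begin
    ∑ₚ p 1# z
      ≈⟨ wrap (A3 (polynomial (p ∷ʳ 1#)) (polynomial x^N) (polynomial p) 1# (- 1#) 1# z (λ t → unwrap (p≋ t))) ⟩
    1# * ∑ₚ (p ∷ʳ 1#) 1# z + - 1# * ∑ₚ x^N 1# z
      ≈⟨ 𝔽.+-cong
           (𝔽.*-congˡ (∑ₚ-hasDegree (p ∷ʳ 1#) (W +ₚ V) W+V-difference (monic-hasDegree p) z))
           (𝔽.*-congˡ (∑ₚ-hasDegree x^N V (eulerMaclaurin-difference x^N) (monic-hasDegree (replicate (length p) 0#)) z)) ⟩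
    1# * (eval (W +ₚ V) z - eval (W +ₚ V) 0#) + - 1# * (eval V z - eval V 0#)
      ≈⟨ 𝔽.+-congʳ (𝔽.*-congˡ (𝔽.+-cong (eval-+ₚ W V z) (𝔽.-‿cong (eval-+ₚ W V 0#)))) ⟩
    1# * ((eval W z + eval V z) - (eval W 0# + eval V 0#)) + - 1# * (eval V z - eval V 0#)
      ≈⟨ solve 4 (λ a b c d → con 1ℚ :* ((a :+ b) :- (c :+ d)) :+ :- con 1ℚ :* (b :- d) := a :- c) 𝔽.refl
           (eval W z) (eval V z) (eval W 0#) (eval V 0#) ⟩
    eval W z - eval W 0#  ∎
    where
    open ≋-Reasoning
    x^N V : ℂ[x]
    x^N = replicate (length p) 0# ∷ʳ 1#
    -- Any antidifference of the monomial serves here, as its values cancel in the end.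
    V = eulerMaclaurin x^N
    eval-∷ʳ : ∀ q t → eval (q ∷ʳ 1#) t ≋ eval q t + eval (replicate (length q) 0# ∷ʳ 1#) t
    eval-∷ʳ []      t = 𝔽.sym (𝔽.+-identityˡ _)
    eval-∷ʳ (a ∷ q) t = 𝔽.trans (𝔽.+-congˡ (𝔽.*-congˡ (eval-∷ʳ q t)))
      (solve 4 (λ a t x y → a :+ t :* (x :+ y) := (a :+ t :* x) :+ (con 0ℚ :+ t :* y)) 𝔽.refl
           a t (eval q t) _)
    p≋ : ∀ t → eval p t ≋ 1# * eval (p ∷ʳ 1#) t + - 1# * eval x^N t
    p≋ t = 𝔽.trans
      (solve 2 (λ p x → p := con 1ℚ :* (p :+ x) :+ :- con 1ℚ :* x) 𝔽.refl (eval p t) (eval x^N t))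
      (𝔽.+-congʳ (𝔽.*-congˡ (𝔽.sym (eval-∷ʳ p t))))
    W+V-difference : ∀ t → eval (W +ₚ V) t - eval (W +ₚ V) (t - 1#) ≋ eval (p ∷ʳ 1#) t
    W+V-difference t = begin
      eval (W +ₚ V) t - eval (W +ₚ V) (t - 1#)
        ≈⟨ 𝔽.+-cong (eval-+ₚ W V t) (𝔽.-‿cong (eval-+ₚ W V (t - 1#))) ⟩
      (eval W t + eval V t) - (eval W (t - 1#) + eval V (t - 1#))
        ≈⟨ solve 4 (λ a b c d → (a :+ b) :- (c :+ d) := (a :- c) :+ (b :- d)) 𝔽.refl
             (eval W t) (eval V t) (eval W (t - 1#)) (eval V (t - 1#)) ⟩
      (eval W t - eval W (t - 1#)) + (eval V t - eval V (t - 1#))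
        ≈⟨ 𝔽.+-cong (W-difference t) (eulerMaclaurin-difference x^N t) ⟩
      eval p t + eval x^N t
        ≈⟨ eval-∷ʳ p t ⟨
      eval (p ∷ʳ 1#) t  ∎

-- Convergence of the series and of Riemann sums

∑<-stable : ∀ N n {a} → (∀ k → N ℕ.≤ k → a k ≋ 0#) → N ℕ.≤ n → ∑< n a ≋ ∑< N a
∑<-stable zero    n       a≋0 _           = ∑<-0 n (λ k → a≋0 k ℕ.z≤n)
∑<-stable (suc N) (suc n) a≋0 (ℕ.s≤s N≤n) = 𝔽.+-congˡ (∑<-stable N n (λ k N≤k → a≋0 (suc k) (ℕ.s≤s N≤k)) N≤n)

hasSum₁-finite : ∀ N a → (∀ k → N ℕ.≤ k → a (suc k) ≋ 0#) → HasSum₁ a (∑₁ N a)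
hasSum₁-finite N a a≋0 = ⟶-eventually-≋ (N , λ n → ∑<-stable N n a≋0)

-- Bounds and divided differences of polynomials

‖z*w‖≼p*q : ∀ z w {p q} → 0ℚ ℚ.≤ q → ‖ z ‖ ≼ fromℚᵣ p → ‖ w ‖ ≼ fromℚᵣ q → ‖ z * w ‖ ≼ fromℚᵣ (q ℚ.* p)
‖z*w‖≼p*q z w {p} {q} 0≤q z≼p w≼q =
  ≼-trans (‖z*w‖≼‖z‖*‖w‖ z w) (≼-trans (*ᵣ-monoʳ-≼ (‖‖-nonNeg z) w≼q)
    (≼-trans (*ᵣ-comm-≼ ‖ z ‖ (fromℚᵣ q)) (≼-trans (*ᵣ-monoʳ-≼ (λ _ → 0≤q) z≼p) (fromℚᵣ-*-≼ q p))))

-- Bounds are built along the structure of an expression, which replaces compactness arguments.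
Bounded : ℚ → (ℂ → ℂ → ℂ) → Set
Bounded R F = ∃ λ K → 0ℚ ℚ.< K ×
  (∀ z w → ‖ z ‖ ≼ fromℚᵣ R → ‖ w ‖ ≼ fromℚᵣ R → ‖ F z w ‖ ≼ fromℚᵣ K)

0<p*q : ∀ {p q} → 0ℚ ℚ.< p → 0ℚ ℚ.< q → 0ℚ ℚ.< p ℚ.* q
0<p*q {p} {q} 0<p 0<q = ℚ.positive⁻¹ (p ℚ.* q) {{ℚ.pos*pos⇒pos p {{ℚ.positive 0<p}} q {{ℚ.positive 0<q}}}}

bounded-const : ∀ {R} c → Bounded R (λ _ _ → c)
bounded-const c = let K , 0<K , c≼K = rational-bound ‖ c ‖ in K , 0<K , λ _ _ _ _ → c≼K

bounded-+ : ∀ {R F G} → Bounded R F → Bounded R G → Bounded R (λ z w → F z w + G z w)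
bounded-+ {F = F} {G} (K , 0<K , f) (L , 0<L , g) = K ℚ.+ L , ℚ.+-mono-< 0<K 0<L , λ z w z≼ w≼ →
  ≼-trans (‖z+w‖≼‖z‖+‖w‖ (F z w) (G z w)) (≼-trans (+ᵣ-mono-≼ (f z w z≼ w≼) (g z w z≼ w≼)) (fromℚᵣ-+-≼ K L))

bounded-* : ∀ {R F G} → Bounded R F → Bounded R G → Bounded R (λ z w → F z w * G z w)
bounded-* {F = F} {G} (K , 0<K , f) (L , 0<L , g) = L ℚ.* K , 0<p*q 0<L 0<K , λ z w z≼ w≼ →
  ‖z*w‖≼p*q (F z w) (G z w) (ℚ.<⇒≤ 0<L) (f z w z≼ w≼) (g z w z≼ w≼)

bounded-proj₁ : ∀ {R} → 0ℚ ℚ.< R → Bounded R (λ z w → z)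
bounded-proj₁ {R} 0<R = R , 0<R , λ _ _ z≼ _ → z≼

bounded-proj₂ : ∀ {R} → 0ℚ ℚ.< R → Bounded R (λ z w → w)
bounded-proj₂ {R} 0<R = R , 0<R , λ _ _ _ w≼ → w≼

bounded-eval : ∀ {R} p → 0ℚ ℚ.< R → Bounded R (λ z _ → eval p z)
bounded-eval []      0<R = bounded-const 0#
bounded-eval (a ∷ p) 0<R = bounded-+ (bounded-const a) (bounded-* (bounded-proj₁ 0<R) (bounded-eval p 0<R))

-- The divided differences (p(z) − p(w))/(z − w) and (p(z) − p(w) − p′(w)(z − w))/(z − w)².

slope : ℂ[x] → ℂ → ℂ → ℂ
slope []      z w = 0#
slope (a ∷ p) z w = eval p z + w * slope p z w

curvature : ℂ[x] → ℂ → ℂ → ℂ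
curvature []      z w = 0#
curvature (a ∷ p) z w = slope p z w + w * curvature p z w

eval-slope : ∀ p z w → eval p z ≋ eval p w + (z - w) * slope p z w
eval-slope []      z w = solve 2 (λ z w → con 0ℚ := con 0ℚ :+ (z :- w) :* con 0ℚ) 𝔽.refl z w
eval-slope (a ∷ p) z w = begin
  a + z * eval p z
    ≈⟨ solve 4 (λ a z w y → a :+ z :* y := a :+ w :* y :+ (z :- w) :* y) 𝔽.refl a z w (eval p z) ⟩
  a + w * eval p z + (z - w) * eval p z
    ≈⟨ 𝔽.+-congʳ (𝔽.+-congˡ (𝔽.*-congˡ (eval-slope p z w))) ⟩
  a + w * (eval p w + (z - w) * slope p z w) + (z - w) * eval p z
    ≈⟨ solve 6 (λ a z w x s y → a :+ w :* (x :+ (z :- w) :* s) :+ (z :- w) :* y := a :+ w :* x :+ (z :- w) :* (y :+ w :* s))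
         𝔽.refl a z w (eval p w) (slope p z w) (eval p z) ⟩
  a + w * eval p w + (z - w) * (eval p z + w * slope p z w)  ∎
  where open ≋-Reasoning

-- `pair p (var ∗ powers w)` is p′(w). For an antiderivative, `eval-⁽⁾≋pair` identifies it with the
-- value of the original polynomial.
slope-curvature : ∀ p z w → slope p z w ≋ pair p (var ∗ powers w) + (z - w) * curvature p z w
slope-curvature []      z w = solve 2 (λ z w → con 0ℚ := con 0ℚ :+ (z :- w) :* con 0ℚ) 𝔽.refl z w
slope-curvature (a ∷ p) z w = begin
  eval p z + w * slope p z w
    ≈⟨ 𝔽.+-cong (eval-slope p z w) (𝔽.*-congˡ (slope-curvature p z w)) ⟩
  eval p w + (z - w) * slope p z w + w * (d + (z - w) * curvature p z w)
    ≈⟨ solve 6 (λ x z w s d c → x :+ (z :- w) :* s :+ w :* (d :+ (z :- w) :* c) := (x :+ w :* d) :+ (z :- w) :* (s :+ w :* c))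
         𝔽.refl (eval p w) z w (slope p z w) d (curvature p z w) ⟩
  (eval p w + w * d) + (z - w) * curvature (a ∷ p) z w
    ≈⟨ 𝔽.+-congʳ derivative-step ⟩
  pair (a ∷ p) (var ∗ powers w) + (z - w) * curvature (a ∷ p) z w  ∎
  where
  open ≋-Reasoning
  d = pair p (var ∗ powers w)
  -- The product rule (a + xp)′ = p + xp′.
  derivative-step : eval p w + w * d ≋ a * (0# * 1#) + pair p ((var ∗ powers w) ∘ suc)
  derivative-step = begin
    eval p w + w * d
      ≈⟨ 𝔽.+-cong (eval≋pair p w) (𝔽.sym (pair-· p w (var ∗ powers w))) ⟩
    pair p (powers w) + pair p (w · (var ∗ powers w))
      ≈⟨ pair-⊞ p (powers w) (w · (var ∗ powers w)) ⟨
    pair p (powers w ⊞ w · (var ∗ powers w))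
      ≈⟨ pair-cong p (λ n → 𝔽.trans (ℂ-Series.var-∗-suc (powers w) n) (𝔽.+-congˡ (ℂ-Series.·-∗ʳ w var (powers w) n))) ⟨
    pair p ((var ∗ powers w) ∘ suc)
      ≈⟨ solve 2 (λ a x → x := a :* (con 0ℚ :* con 1ℚ) :+ x) 𝔽.refl a (pair p ((var ∗ powers w) ∘ suc)) ⟩
    a * (0# * 1#) + pair p ((var ∗ powers w) ∘ suc)  ∎

bounded-slope : ∀ {R} p → 0ℚ ℚ.< R → Bounded R (slope p)
bounded-slope []      0<R = bounded-const 0#
bounded-slope (a ∷ p) 0<R = bounded-+ (bounded-eval p 0<R) (bounded-* (bounded-proj₂ 0<R) (bounded-slope p 0<R))

bounded-curvature : ∀ {R} p → 0ℚ ℚ.< R → Bounded R (curvature p)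
bounded-curvature []      0<R = bounded-const 0#
bounded-curvature (a ∷ p) 0<R = bounded-+ (bounded-slope p 0<R) (bounded-* (bounded-proj₂ 0<R) (bounded-curvature p 0<R))

antiderivative-taylor : ∀ p z w → eval (antiderivative p) z ≋
  eval (antiderivative p) w + (z - w) * (eval p w + (z - w) * curvature (antiderivative p) z w)
antiderivative-taylor p z w = 𝔽.trans (eval-slope A z w) (𝔽.+-congˡ (𝔽.*-congˡ
  (𝔽.trans (slope-curvature A z w) (𝔽.+-congʳ (𝔽.sym (eval-⁽⁾≋pair p 0 w))))))
  where A = antiderivative p

-- Riemann sums along a segment

sum-telescope : ∀ n (f : Vector ℂ n) (g : Vector ℂ (suc n)) →
  sum f - (g (fromℕ n) - g Fin.zero) ≋ sum (λ i → f i - (g (Fin.suc i) - g (inject₁ i)))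
sum-telescope zero    f g = solve 1 (λ x → con 0ℚ :- (x :- x) := con 0ℚ) 𝔽.refl (g Fin.zero)
sum-telescope (suc n) f g = 𝔽.trans
  (solve 5 (λ x s l k m → (x :+ s) :- (l :- k) := (x :- (m :- k)) :+ (s :- (l :- m))) 𝔽.refl
    (f Fin.zero) (sum (f ∘ Fin.suc)) (g (fromℕ (suc n))) (g Fin.zero) (g (Fin.suc Fin.zero)))
  (𝔽.+-congˡ (sum-telescope n (f ∘ Fin.suc) (g ∘ Fin.suc)))

-- Bounds proportional to the widths telescope, so the total does not depend on the number of
-- subintervals.
‖sum‖≼ : ∀ n c (e : Vector ℂ n) (t : Vector ℝ (suc n)) →
  (∀ i → ‖ e i ‖ ≼ c *ᵣ (t (Fin.suc i) +ᵣ -ᵣ t (inject₁ i))) →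
  ‖ sum e ‖ ≼ c *ᵣ (t (fromℕ n) +ᵣ -ᵣ t Fin.zero)
‖sum‖≼ zero    c e t e≼ = ≼-trans ‖0‖≼0 (0≼c*[t-t] c (t Fin.zero))
‖sum‖≼ (suc n) c e t e≼ = ≼-trans (‖z+w‖≼‖z‖+‖w‖ (e Fin.zero) (sum (e ∘ Fin.suc)))
  (≼-trans (+ᵣ-mono-≼ (e≼ Fin.zero) (‖sum‖≼ n c (e ∘ Fin.suc) (t ∘ Fin.suc) (e≼ ∘ Fin.suc)))
    (*ᵣ-telescope-≼ c (t Fin.zero) (t (Fin.suc Fin.zero)) (t (fromℕ (suc n)))))

first≼ : ∀ {n} (t : Vector ℝ (suc n)) → (∀ i → t (inject₁ i) ≼ t (Fin.suc i)) → ∀ i → t Fin.zero ≼ t i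
first≼         t t≼ Fin.zero    = ≼-refl
first≼ {suc n} t t≼ (Fin.suc i) = ≼-trans (t≼ Fin.zero) (first≼ (t ∘ Fin.suc) (t≼ ∘ Fin.suc) i)

≼last : ∀ n (t : Vector ℝ (suc n)) → (∀ i → t (inject₁ i) ≼ t (Fin.suc i)) → ∀ i → t i ≼ t (fromℕ n)
≼last zero    t t≼ Fin.zero    = ≼-refl
≼last (suc n) t t≼ Fin.zero    = ≼-trans (t≼ Fin.zero) (≼last n (t ∘ Fin.suc) (t≼ ∘ Fin.suc) Fin.zero)
≼last (suc n) t t≼ (Fin.suc i) = ≼last n (t ∘ Fin.suc) (t≼ ∘ Fin.suc) i

-- Of the two factors s, one is estimated by the mesh δ; the other is kept, to be summed over the
-- partition.
‖s*[s*z]‖≼ : ∀ s z {δ K} → 0ℚ ℚ.≤ δ → 0ℚ ℚ.≤ K → fromℚᵣ 0ℚ ≼ s → s ≼ fromℚᵣ δ → ‖ z ‖ ≼ fromℚᵣ K →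
  ‖ fromℝ s * (fromℝ s * z) ‖ ≼ fromℚᵣ (K ℚ.* δ) *ᵣ s
‖s*[s*z]‖≼ s z {δ} {K} 0≤δ 0≤K 0≼s s≼δ z≼K =
  ≼-trans (‖z*w‖≼‖z‖*‖w‖ (fromℝ s) (fromℝ s * z))
    (≼-trans (*ᵣ-monoʳ-≼ (‖‖-nonNeg (fromℝ s)) (‖z*w‖≼p*q (fromℝ s) z 0≤K (≼-trans (‖fromℝt‖≼t 0≼s) s≼δ) z≼K))
      (≼-trans (*ᵣ-comm-≼ ‖ fromℝ s ‖ (fromℚᵣ (K ℚ.* δ)))
        (*ᵣ-monoʳ-≼ (λ _ → 0≤p*q 0≤K 0≤δ) (‖fromℝt‖≼t 0≼s))))

-- On each subinterval the increment of the antiderivative is expanded at the tag towards both ends.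
-- The linear terms reproduce the Riemann summand exactly, and the quadratic remainders add up to at
-- most Kδ.
integral-antiderivative : ∀ p x → IsIntegral (eval p) 0# x (eval (antiderivative p) x - eval (antiderivative p) 0#)
integral-antiderivative p x ε 0<ε = δ , 0<δ , λ π mesh →
  ‖z‖≼q⇒∣z∣<ε _ (ℚ.<⇒≤ (0<½ε 0<ε)) ½ε<ε (bound π mesh)
  where
  A = antiderivative p
  X⁺ = rational-bound ‖ x ‖
  X = proj₁ X⁺
  0<X = proj₁ (proj₂ X⁺)
  x≼X = proj₂ (proj₂ X⁺)
  -- The product form is the bound that `‖z*w‖≼p*q` returns for a parameter at most 1 times x.
  R = X ℚ.* 1ℚ
  0<R : 0ℚ ℚ.< R
  0<R = 0<p*q 0<X (ℚ.positive⁻¹ 1ℚ)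
  -- The increments of the path carry a factor x each, hence x² in front of the curvature.
  K⁺ = bounded-* (bounded-const {R} (x * x)) (bounded-curvature A 0<R)
  K = proj₁ K⁺
  0<K = proj₁ (proj₂ K⁺)
  -- Half of ε, because the final estimate must be strict.
  δ⁺ = positive-quotient 0<K (0<½ε 0<ε)
  δ = proj₁ δ⁺
  0<δ = proj₁ (proj₂ δ⁺)
  Kδ≡½ε = proj₂ (proj₂ δ⁺)
  ½ε<ε : ½ ℚ.* ε ℚ.< ε
  ½ε<ε = subst (½ ℚ.* ε ℚ.<_) (½ε+½ε ε)
    (subst (ℚ._< ½ ℚ.* ε ℚ.+ ½ ℚ.* ε) (ℚ.+-identityʳ (½ ℚ.* ε)) (ℚ.+-monoʳ-< (½ ℚ.* ε) (0<½ε 0<ε)))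

  γ : ℝ → ℂ
  γ t = 0# + fromℝ t * (x - 0#)

  γ≋ : ∀ t → γ t ≋ fromℝ t * x
  γ≋ t = solve 2 (λ t x → con 0ℚ :+ t :* (x :- con 0ℚ) := t :* x) 𝔽.refl (fromℝ t) x

  γ-bound : ∀ t → fromℚᵣ 0ℚ ≼ t → t ≼ fromℚᵣ 1ℚ → ‖ γ t ‖ ≼ fromℚᵣ R
  γ-bound t 0≼t t≼1 = ≼-trans (‖‖-cong (γ≋ t))
    (‖z*w‖≼p*q (fromℝ t) x (ℚ.<⇒≤ 0<X) (≼-trans (‖fromℝt‖≼t 0≼t) t≼1) x≼X)

  γ-sub : ∀ s t → γ s - γ t ≋ fromℝ (s +ᵣ -ᵣ t) * x
  γ-sub s t = 𝔽.trans
    (solve 3 (λ s t x → (con 0ℚ :+ s :* (x :- con 0ℚ)) :- (con 0ℚ :+ t :* (x :- con 0ℚ)) := (s :- t) :* x) 𝔽.refl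
         (fromℝ s) (fromℝ t) x)
    (𝔽.*-congʳ (𝔽.sym (fromℝ-sub s t)))

  module _ (π : TaggedPartition) (mesh : TaggedPartition.mesh<_ π δ) where
    open TaggedPartition π
    t = point
    left right : Fin size → ℝ
    left i = t (inject₁ i)
    right i = t (Fin.suc i)

    left≼tag : ∀ i → left i ≼ tag i
    left≼tag i = wrap (below i)
    tag≼right : ∀ i → tag i ≼ right i
    tag≼right i = wrap (above i)
    left≼right : ∀ i → left i ≼ right i
    left≼right i = ≼-trans (left≼tag i) (tag≼right i)
    0≼t : ∀ i → fromℚᵣ 0ℚ ≼ t i
    0≼t i = ≼-trans (≈ᵣ⇒≼ (fromℚᵣ 0ℚ) (t Fin.zero) (≈ᵣ-sym {t Fin.zero} {fromℚᵣ 0ℚ} start)) (first≼ t left≼right i)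
    t≼1 : ∀ i → t i ≼ fromℚᵣ 1ℚ
    t≼1 i = ≼-trans (≼last size t left≼right i) (≈ᵣ⇒≼ (t (fromℕ size)) (fromℚᵣ 1ℚ) end)

    width≼δ : ∀ i → right i +ᵣ -ᵣ left i ≼ fromℚᵣ δ
    width≼δ i = <ᵣ⇒≼ (right i +ᵣ -ᵣ left i) (fromℚᵣ δ) (mesh i)

    error : Fin size → ℂ
    error i = eval p (γ (tag i)) * (γ (right i) - γ (left i)) - (eval A (γ (right i)) - eval A (γ (left i)))

    remainder : ∀ s w → ℂ
    remainder s w = fromℝ s * (fromℝ s * w)

    Y : ℝ → ℝ → ℂ
    Y r s = x * x * curvature A (γ r) (γ s)

    Y-bound : ∀ i j → fromℚᵣ 0ℚ ≼ t j → t j ≼ fromℚᵣ 1ℚ → ‖ Y (t j) (tag i) ‖ ≼ fromℚᵣ K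
    Y-bound i j 0≼ ≼1 = proj₂ (proj₂ K⁺) (γ (t j)) (γ (tag i)) (γ-bound (t j) 0≼ ≼1)
      (γ-bound (tag i) (≼-trans (0≼t (inject₁ i)) (left≼tag i)) (≼-trans (tag≼right i) (t≼1 (Fin.suc i))))

    error≋ : ∀ i → error i ≋
      remainder (tag i +ᵣ -ᵣ left i) (Y (left i) (tag i)) - remainder (right i +ᵣ -ᵣ tag i) (Y (right i) (tag i))
    error≋ i = begin
      f * (v - u) - (eval A v - eval A u)
        ≈⟨ 𝔽.+-congˡ (𝔽.-‿cong (𝔽.+-cong (antiderivative-taylor p v w) (𝔽.-‿cong (antiderivative-taylor p u w)))) ⟩
      f * (v - u) - ((a + (v - w) * (f + (v - w) * cᵥ)) - (a + (u - w) * (f + (u - w) * cᵤ)))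
        -- The values at the tag and the linear terms cancel. In the square, u - w may be reversed,
        -- so that both increments of the parameter are nonnegative.
        ≈⟨ solve 7 (λ f u v w a c d →
             f :* (v :- u) :- ((a :+ (v :- w) :* (f :+ (v :- w) :* c)) :- (a :+ (u :- w) :* (f :+ (u :- w) :* d)))
               := (w :- u) :* ((w :- u) :* d) :- (v :- w) :* ((v :- w) :* c)) 𝔽.refl f u v w a cᵥ cᵤ ⟩
      (w - u) * ((w - u) * cᵤ) - (v - w) * ((v - w) * cᵥ)
        ≈⟨ 𝔽.+-cong (factor (tag i) (left i) cᵤ) (𝔽.-‿cong (factor (right i) (tag i) cᵥ)) ⟩
      remainder (tag i +ᵣ -ᵣ left i) (x * x * cᵤ) - remainder (right i +ᵣ -ᵣ tag i) (x * x * cᵥ)  ∎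
      where
      open ≋-Reasoning
      u = γ (left i)
      v = γ (right i)
      w = γ (tag i)
      f = eval p w
      a = eval A w
      cᵤ = curvature A u w
      cᵥ = curvature A v w
      factor : ∀ r s c → (γ r - γ s) * ((γ r - γ s) * c) ≋ remainder (r +ᵣ -ᵣ s) (x * x * c)
      factor r s c = 𝔽.trans
        (𝔽.*-cong (γ-sub r s) (𝔽.*-congʳ (γ-sub r s)))
        (solve 3 (λ d x c → d :* x :* (d :* x :* c) := d :* (d :* (x :* x :* c))) 𝔽.refl
             (fromℝ (r +ᵣ -ᵣ s)) x c)

    error-bound : ∀ i → ‖ error i ‖ ≼ fromℚᵣ (K ℚ.* δ) *ᵣ (right i +ᵣ -ᵣ left i)
    error-bound i = ≼-trans (‖‖-cong (error≋ i)) (≼-trans (‖z+w‖≼‖z‖+‖w‖ _ _)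
      (≼-trans (+ᵣ-mono-≼
          (‖s*[s*z]‖≼ (tag i +ᵣ -ᵣ left i) (Y (left i) (tag i)) (ℚ.<⇒≤ 0<δ) (ℚ.<⇒≤ 0<K) (≼⇒0≼t-s (left≼tag i))
            (≼-trans (+ᵣ-neg-mono-≼ (tag≼right i) ≼-refl) (width≼δ i))
            (Y-bound i (inject₁ i) (0≼t (inject₁ i)) (t≼1 (inject₁ i))))
          (≼-trans (‖-z‖≼‖z‖ _)
            (‖s*[s*z]‖≼ (right i +ᵣ -ᵣ tag i) (Y (right i) (tag i)) (ℚ.<⇒≤ 0<δ) (ℚ.<⇒≤ 0<K) (≼⇒0≼t-s (tag≼right i))
              (≼-trans (+ᵣ-neg-mono-≼ ≼-refl (left≼tag i)) (width≼δ i))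
              (Y-bound i (Fin.suc i) (0≼t (Fin.suc i)) (t≼1 (Fin.suc i))))))
        (*ᵣ-telescope-≼ (fromℚᵣ (K ℚ.* δ)) (left i) (tag i) (right i))))

    γ-start : γ (t Fin.zero) ≋ 0#
    γ-start = 𝔽.trans (γ≋ (t Fin.zero)) (𝔽.trans (𝔽.*-congʳ (wrap (start , ≈ᵣ-refl {fromℚᵣ 0ℚ}))) (𝔽.zeroˡ x))

    γ-end : γ (t (fromℕ size)) ≋ x
    γ-end = 𝔽.trans (γ≋ (t (fromℕ size))) (𝔽.trans (𝔽.*-congʳ (wrap (end , ≈ᵣ-refl {fromℚᵣ 0ℚ}))) (𝔽.*-identityˡ x))

    bound : ‖ riemannSum (eval p) (λ z → 0# + z * (x - 0#)) - (eval A x - eval A 0#) ‖ ≼ fromℚᵣ (½ ℚ.* ε)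
    bound = ≼-trans (‖‖-cong sum-error) (≼-trans (‖sum‖≼ size (fromℚᵣ (K ℚ.* δ)) error t error-bound)
      (≼-trans (*ᵣ-monoʳ-≼ (λ _ → 0≤p*q (ℚ.<⇒≤ 0<K) (ℚ.<⇒≤ 0<δ))
          (≼-trans (+ᵣ-neg-mono-≼ (t≼1 (fromℕ size)) (0≼t Fin.zero)) (fromℚᵣ-sub-≼ 1ℚ 0ℚ)))
        (≼-trans (fromℚᵣ-*-≼ (K ℚ.* δ) 1ℚ)
          (pointwise-≼ λ _ → ℚ.≤-reflexive (trans (ℚ.*-identityʳ (K ℚ.* δ)) Kδ≡½ε)))))
      where
      open ≋-Reasoning
      sum-error : riemannSum (eval p) (λ z → 0# + z * (x - 0#)) - (eval A x - eval A 0#) ≋ sum error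
      sum-error = begin
        riemannSum (eval p) (λ z → 0# + z * (x - 0#)) - (eval A x - eval A 0#)
          ≈⟨ 𝔽.+-congˡ (𝔽.-‿cong (𝔽.+-cong (eval-cong A γ-end) (𝔽.-‿cong (eval-cong A γ-start)))) ⟨
        riemannSum (eval p) (λ z → 0# + z * (x - 0#)) - (eval A (γ (t (fromℕ size))) - eval A (γ (t Fin.zero)))
          ≈⟨ sum-telescope size (λ i → eval p (γ (tag i)) * (γ (right i) - γ (left i))) (λ i → eval A (γ (t i))) ⟩
        sum error  ∎

-- The Euler-Maclaurin formula for fractional sums

theorem5p2p1 : ∀ {ℓ} (U : Pred Fun ℓ) (summable : SummableSet U)
    (ℂ[x]⊆S : ∀ p → ⟦ p ⟧ ∈ S U) (P : ℂ[x]) (x : ℂ) →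
    ∃₂ λ I E →
    IsIntegral (eval P) 0# x I ×
    HasSum₁ (λ m → fromℚ (B/! (2 ℕ.* m)) * (eval (P ⁽ 2 ℕ.* m ℕ.∸ 1 ⁾) x - eval (P ⁽ 2 ℕ.* m ℕ.∸ 1 ⁾) 0#)) E ×
    SummableSet.⨋ summable (⟦ P ⟧ , ℂ[x]⊆S P) 1# x ≈ I + fromℚ ½ * (eval P x - eval P 0#) + E
theorem5p2p1 U summable ℂ[x]⊆S P x =
  -- The partial sum of length N is already the limit, since the derivatives in all later terms
  -- vanish.
  eval A x - eval A 0# , ∑₁ N term , integral-antiderivative P x , hasSum₁-finite N term term≋0 , unwrap (begin
    ∑ₚ fractionalSum ℂ[x]⊆S P 1# x
      ≈⟨ ∑ₚ≋difference fractionalSum ℂ[x]⊆S P (eulerMaclaurin P) (eulerMaclaurin-difference P) x ⟩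
    eval (eulerMaclaurin P) x - eval (eulerMaclaurin P) 0#
      ≈⟨ 𝔽.+-cong (eval-eulerMaclaurin P x) (𝔽.-‿cong (eval-eulerMaclaurin P 0#)) ⟩
    (eval A x + fromℚ ½ * eval P x + ∑₁ N (eulerMaclaurinTerm P x))
      - (eval A 0# + fromℚ ½ * eval P 0# + ∑₁ N (eulerMaclaurinTerm P 0#))
      ≈⟨ solve 7 (λ h a b c d e f → (a :+ h :* c :+ e) :- (b :+ h :* d :+ f) := (a :- b) :+ h :* (c :- d) :+ (e :- f)) 𝔽.refl
           (fromℚ ½) (eval A x) (eval A 0#) (eval P x) (eval P 0#)
           (∑₁ N (eulerMaclaurinTerm P x)) (∑₁ N (eulerMaclaurinTerm P 0#)) ⟩
    (eval A x - eval A 0#) + fromℚ ½ * (eval P x - eval P 0#)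
      + (∑₁ N (eulerMaclaurinTerm P x) - ∑₁ N (eulerMaclaurinTerm P 0#))
      ≈⟨ 𝔽.+-congˡ term-difference ⟩
    (eval A x - eval A 0#) + fromℚ ½ * (eval P x - eval P 0#) + ∑₁ N term  ∎)
  where
  open ≋-Reasoning
  open SummableSet summable using (fractionalSum)
  A = antiderivative P
  N = length P
  term : ℕ → ℂ
  term m = fromℚ (B/! (2 ℕ.* m)) * (eval (P ⁽ 2 ℕ.* m ℕ.∸ 1 ⁾) x - eval (P ⁽ 2 ℕ.* m ℕ.∸ 1 ⁾) 0#)
  term≋0 : ∀ k → N ℕ.≤ k → term (suc k) ≋ 0#
  term≋0 k N≤k = 𝔽.trans
    (𝔽.*-congˡ (𝔽.+-cong (eval-⁽⁾≋0 P x N≤j) (𝔽.-‿cong (eval-⁽⁾≋0 P 0# N≤j))))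
    (solve 1 (λ b → b :* (con 0ℚ :- con 0ℚ) := con 0ℚ) 𝔽.refl (fromℚ (B/! (2 ℕ.* suc k))))
    where
    N≤j : N ℕ.≤ 2 ℕ.* suc k ℕ.∸ 1
    -- `2 * suc k ∸ 1` reduces to `k + suc (k + 0)`, which is at least k.
    N≤j = ℕ.≤-trans N≤k (ℕ.m≤m+n k _)
  term-difference : ∑₁ N (eulerMaclaurinTerm P x) - ∑₁ N (eulerMaclaurinTerm P 0#) ≋ ∑₁ N term
  term-difference = begin
    ∑< N a - ∑< N b                ≈⟨ 𝔽.+-congˡ (∑<-neg N b) ⟨
    ∑< N a + ∑< N (-_ ∘ b)         ≈⟨ ∑<-+ N a (-_ ∘ b) ⟨
    ∑< N (λ m → a m - b m)
      ≈⟨ ∑<-cong N (λ m → solve 3 (λ c x y → c :* x :- c :* y := c :* (x :- y)) 𝔽.refl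
           (fromℚ (B/! (2 ℕ.* suc m))) (eval (P ⁽ 2 ℕ.* suc m ℕ.∸ 1 ⁾) x) (eval (P ⁽ 2 ℕ.* suc m ℕ.∸ 1 ⁾) 0#)) ⟩
    ∑₁ N term  ∎
    where
    a b : ℕ → ℂ
    a m = eulerMaclaurinTerm P x (suc m)
    b m = eulerMaclaurinTerm P 0# (suc m)
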